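{- Fix any real constant $c$ with $0<c<\frac{1}{2\log 2}$. For each prime $p$, let $k=\lfloor \log_2 p + c\log\log p\rfloor$ and let $A\subseteq \mathbb{F}_p$ be a uniformly random $k$-element subset. Then $$\mathbb{P}\bigl(\Sigma(A)=\mathbb{F}_p\bigr)\longrightarrow 0 \qquad (p\to\infty,\ p \text{ prime}).$$
   Context: Here $\log$ is the natural logarithm and $\log_2 x=\log x/\log 2$. $\mathbb{F}_p$ is viewed as the additive cyclic group of prime order $p$. For $A\subseteq\mathbb{F}_p$, $\Sigma(A):=\{\sum_{x\in S}x : S\subseteq A\}$ is the set of all subset sums of $A$, where the empty sum is $0$. -}

module Defs where

open import Data.Fin.Base using (Fin; toℕ)
import Data.Fin.Properties as Fin
open import Data.Fin.Subset using (Subset; inside; outside; _⊆_; ∣_∣)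
open import Data.Fin.Subset.Properties using (_∈?_; _⊆?_; anySubset?)
open import Data.Integer.Base as ℤ using (ℤ; +_; +[1+_]; -[1+_])
import Data.Integer.Properties as ℤ
open import Data.List.Base using (List; []; _∷_; [_]; _++_; map; filter; length; allFin)
open import Data.Nat.Base as ℕ using (ℕ; zero; suc)
open import Data.Nat.DivMod using (_mod_)
open import Data.Nat.ListAction using (sum)
import Data.Nat.Properties as ℕ
open import Data.Product using (∃; _×_; _,_; proj₁; proj₂)
open import Data.Rational.Base
  using (ℚ; mkℚ; 0ℚ; 1ℚ; _+_; _*_; _-_; -_; 1/_; _/_; _≤_; _<_; *<*;
         ≢-nonZero; positive; nonNegative; toℚᵘ)
  renaming (∣_∣ to abs)
import Data.Rational.Properties as ℚ
open import Data.Rational.Solver using (module +-*-Solver)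
import Data.Rational.Unnormalised.Base as ℚᵘ
import Data.Rational.Unnormalised.Properties as ℚᵘ
open import Data.Sum.Base using (inj₁; inj₂)
open import Data.Vec.Base using ([]; _∷_)
open import Level using (0ℓ)
open import Relation.Binary.PropositionalEquality
  using (_≡_; refl; sym; trans; cong; cong₂; subst; subst₂)
open import Relation.Nullary using (¬_; yes; no; contradiction)
open import Relation.Nullary.Decidable using (_×-dec_)
open import Relation.Unary using (Pred; Decidable)

open +-*-Solver using (solve; _:+_; _:*_; _:-_; :-_; con; _:=_)

ι : ℕ → ℚ
ι n = + n / 1

-- Total reciprocal, with the junk value inv 0 = 0.
inv : ℚ → ℚ
inv q with q ℚ.≟ 0ℚ
... | yes _   = 0ℚ
... | no  q≢0 = (1/ q) {{≢-nonZero q≢0}}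

sumTo : ℕ → (ℕ → ℚ) → ℚ
sumTo zero    f = 0ℚ
sumTo (suc n) f = sumTo n f + f n

module RationalLemmas where
  toℚᵘ-ι : ∀ n → toℚᵘ (ι n) ℚᵘ.≃ ℚᵘ.mkℚᵘ (+ n) 0
  toℚᵘ-ι n = ℚ.toℚᵘ-fromℚᵘ (ℚᵘ.mkℚᵘ (+ n) 0)

  ι-+ : ∀ m n → ι (m ℕ.+ n) ≡ ι m + ι n
  ι-+ m n = ℚ.toℚᵘ-injective
    (ℚᵘ.≃-trans (toℚᵘ-ι (m ℕ.+ n))
    (ℚᵘ.≃-trans (ℚᵘ.*≡* (cong (ℤ._* + 1) eq))
    (ℚᵘ.≃-sym (ℚᵘ.≃-trans (ℚ.toℚᵘ-homo-+ (ι m) (ι n)) (ℚᵘ.+-cong (toℚᵘ-ι m) (toℚᵘ-ι n))))))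
    where
    eq : + (m ℕ.+ n) ≡ + m ℤ.* + 1 ℤ.+ + n ℤ.* + 1
    eq = trans (ℤ.pos-+ m n) (sym (cong₂ ℤ._+_ (ℤ.*-identityʳ (+ m)) (ℤ.*-identityʳ (+ n))))

  ι-* : ∀ m n → ι (m ℕ.* n) ≡ ι m * ι n
  ι-* m n = ℚ.toℚᵘ-injective
    (ℚᵘ.≃-trans (toℚᵘ-ι (m ℕ.* n))
    (ℚᵘ.≃-trans (ℚᵘ.*≡* (cong (ℤ._* + 1) (ℤ.pos-* m n)))
    (ℚᵘ.≃-sym (ℚᵘ.≃-trans (ℚ.toℚᵘ-homo-* (ι m) (ι n)) (ℚᵘ.*-cong (toℚᵘ-ι m) (toℚᵘ-ι n))))))

  ι-suc : ∀ n → ι (suc n) ≡ 1ℚ + ι n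
  ι-suc n = ι-+ 1 n

  0<1 : 0ℚ < 1ℚ
  0<1 = *<* (ℤ.+<+ (ℕ.s≤s ℕ.z≤n))

  0≤ι : ∀ n → 0ℚ ≤ ι n
  0≤ι zero    = ℚ.≤-refl
  0≤ι (suc n) = subst (0ℚ ≤_) (sym (ι-suc n)) (ℚ.+-mono-≤ (ℚ.<⇒≤ 0<1) (0≤ι n))

  ι-mono : ∀ {m n} → m ℕ.≤ n → ι m ≤ ι n
  ι-mono {n = n} ℕ.z≤n = 0≤ι n
  ι-mono {suc m} {suc n} (ℕ.s≤s p) =
    subst₂ _≤_ (sym (ι-suc m)) (sym (ι-suc n)) (ℚ.+-monoʳ-≤ 1ℚ (ι-mono p))

  0<ι : ∀ {n} → 1 ℕ.≤ n → 0ℚ < ι n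
  0<ι p = ℚ.<-≤-trans 0<1 (ι-mono p)

  *-nonneg : ∀ {p q} → 0ℚ ≤ p → 0ℚ ≤ q → 0ℚ ≤ p * q
  *-nonneg {p} {q} 0≤p 0≤q = ℚ.nonNegative⁻¹ (p * q)
    {{ℚ.nonNeg*nonNeg⇒nonNeg p {{nonNegative 0≤p}} q {{nonNegative 0≤q}}}}

  *-pos : ∀ {p q} → 0ℚ < p → 0ℚ < q → 0ℚ < p * q
  *-pos {p} {q} 0<p 0<q = ℚ.positive⁻¹ (p * q)
    {{ℚ.pos*pos⇒pos p {{positive 0<p}} q {{positive 0<q}}}}

  *-monoʳ : ∀ {r p q} → 0ℚ ≤ r → p ≤ q → r * p ≤ r * q
  *-monoʳ {r} 0≤r = ℚ.*-monoˡ-≤-nonNeg r {{nonNegative 0≤r}}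

  *-monoˡ : ∀ {r p q} → 0ℚ ≤ r → p ≤ q → p * r ≤ q * r
  *-monoˡ {r} 0≤r = ℚ.*-monoʳ-≤-nonNeg r {{nonNegative 0≤r}}

  *-mono : ∀ {p q r s} → 0ℚ ≤ p → p ≤ q → 0ℚ ≤ r → r ≤ s → p * r ≤ q * s
  *-mono 0≤p p≤q 0≤r r≤s = ℚ.≤-trans (*-monoˡ 0≤r p≤q) (*-monoʳ (ℚ.≤-trans 0≤p p≤q) r≤s)

  inv-right : ∀ {q} → 0ℚ < q → q * inv q ≡ 1ℚ
  inv-right {q} 0<q with q ℚ.≟ 0ℚ
  ... | yes q≡0 = contradiction (sym q≡0) (ℚ.<⇒≢ 0<q)
  ... | no  q≢0 = ℚ.*-inverseʳ q {{≢-nonZero q≢0}}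

  inv-unique : ∀ {q r} → 0ℚ < q → q * r ≡ 1ℚ → r ≡ inv q
  inv-unique {q} {r} 0<q qr≡1 =
    trans (sym (ℚ.*-identityˡ r))
    (trans (cong (_* r) (sym (inv-right 0<q)))
    (trans (solve 3 (λ q i r → (q :* i) :* r := (q :* r) :* i) refl q (inv q) r)
    (trans (cong (_* inv q) qr≡1) (ℚ.*-identityˡ (inv q)))))

  0<inv : ∀ {q} → 0ℚ < q → 0ℚ < inv q
  0<inv {q} 0<q with inv q ℚ.≤? 0ℚ
  ... | no  i≰0 = ℚ.≰⇒> i≰0
  ... | yes i≤0 = contradiction
    (subst₂ _≤_ (inv-right 0<q) (ℚ.*-zeroʳ q) (*-monoʳ (ℚ.<⇒≤ 0<q) i≤0))
    (λ 1≤0 → ℚ.<-irrefl refl (ℚ.<-≤-trans 0<1 1≤0))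

  inv-anti : ∀ {p q} → 0ℚ < p → p ≤ q → inv q ≤ inv p
  inv-anti {p} {q} 0<p p≤q = subst₂ _≤_
    (trans (cong (_* inv q) (inv-right 0<p)) (ℚ.*-identityˡ (inv q)))
    (trans (solve 3 (λ p' q q' → (q :* p') :* q' := p' :* (q :* q')) refl (inv p) q (inv q))
      (trans (cong (inv p *_) (inv-right 0<q)) (ℚ.*-identityʳ (inv p))))
    (*-monoˡ (ℚ.<⇒≤ (0<inv 0<q)) (*-monoˡ (ℚ.<⇒≤ (0<inv 0<p)) p≤q))
    where 0<q = ℚ.<-≤-trans 0<p p≤q

  abs-swap : ∀ p q → abs (p - q) ≡ abs (q - p)
  abs-swap p q = trans (cong abs (solve 2 (λ p q → p :- q := :- (q :- p)) refl p q))
                       (ℚ.∣-p∣≡∣p∣ (q - p))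

  abs-tri : ∀ p q r → abs (p - r) ≤ abs (p - q) + abs (q - r)
  abs-tri p q r = subst (λ t → abs t ≤ abs (p - q) + abs (q - r))
    (solve 3 (λ p q r → (p :- q) :+ (q :- r) := p :- r) refl p q r)
    (ℚ.∣p+q∣≤∣p∣+∣q∣ (p - q) (q - r))

  abs-near : ∀ p q → abs p ≤ abs (p - q) + abs q
  abs-near p q = subst (λ t → abs t ≤ abs (p - q) + abs q)
    (solve 2 (λ p q → (p :- q) :+ q := p) refl p q)
    (ℚ.∣p+q∣≤∣p∣+∣q∣ (p - q) q)

  abs-pos : ∀ {p} → 0ℚ < p → abs p ≡ p
  abs-pos 0<p = ℚ.0≤p⇒∣p∣≡p (ℚ.<⇒≤ 0<p)

  p≤abs : ∀ p → p ≤ abs p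
  p≤abs p with ℚ.≤-total 0ℚ p
  ... | inj₁ 0≤p = ℚ.≤-reflexive (sym (ℚ.0≤p⇒∣p∣≡p 0≤p))
  ... | inj₂ p≤0 = ℚ.≤-trans p≤0 (ℚ.0≤∣p∣ p)

  abs-mul-diff : ∀ p q r s → abs (p * q - r * s) ≤ abs (p - r) * abs q + abs r * abs (q - s)
  abs-mul-diff p q r s = subst₂ _≤_
    (cong abs (solve 4 (λ p q r s → (p :- r) :* q :+ r :* (q :- s) := p :* q :- r :* s) refl p q r s))
    (cong₂ _+_ (ℚ.∣p*q∣≡∣p∣*∣q∣ (p - r) q) (ℚ.∣p*q∣≡∣p∣*∣q∣ r (q - s)))
    (ℚ.∣p+q∣≤∣p∣+∣q∣ ((p - r) * q) (r * (q - s)))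

  inv-lipschitz : ∀ {δ p q} → 0ℚ < δ → δ ≤ p → δ ≤ q →
                  abs (inv p - inv q) ≤ inv δ * inv δ * abs (p - q)
  inv-lipschitz {δ} {p} {q} 0<δ δ≤p δ≤q = subst (_≤ inv δ * inv δ * abs (p - q)) (sym eq)
    (*-monoˡ (ℚ.0≤∣p∣ (p - q))
      (*-mono (ℚ.<⇒≤ (0<inv 0<p)) (inv-anti 0<δ δ≤p) (ℚ.<⇒≤ (0<inv 0<q)) (inv-anti 0<δ δ≤q)))
    where
    0<p = ℚ.<-≤-trans 0<δ δ≤p
    0<q = ℚ.<-≤-trans 0<δ δ≤q
    ip = inv p
    iq = inv q
    diff : ip - iq ≡ ip * iq * (q - p)
    diff = trans
      (cong₂ _-_ (trans (sym (ℚ.*-identityʳ ip)) (cong (ip *_) (sym (inv-right 0<q))))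
                 (trans (sym (ℚ.*-identityʳ iq)) (cong (iq *_) (sym (inv-right 0<p)))))
      (solve 4 (λ ip iq p q → ip :* (q :* iq) :- iq :* (p :* ip) := ip :* iq :* (q :- p))
             refl ip iq p q)
    eq : abs (ip - iq) ≡ ip * iq * abs (p - q)
    eq = trans (cong abs diff)
      (trans (ℚ.∣p*q∣≡∣p∣*∣q∣ (ip * iq) (q - p))
        (cong₂ _*_ (abs-pos (*-pos (0<inv 0<p) (0<inv 0<q))) (abs-swap q p)))

  archimedean : ∀ {ε} → 0ℚ < ε → ∃ λ N → ∀ n → N ℕ.≤ n → 1 ℕ.≤ n × inv (ι n) ≤ ε
  archimedean {mkℚ +[1+ k ] d-1 c} 0<ε = suc d-1 , λ n N≤n →
      ℕ.≤-trans (ℕ.s≤s ℕ.z≤n) N≤n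
    , ℚ.≤-trans (inv-anti 0<N (ι-mono {N} {n} N≤n)) bound
    where
    N = suc d-1
    ε = mkℚ +[1+ k ] d-1 c
    0<N : 0ℚ < ι N
    0<N = 0<ι {N} (ℕ.s≤s ℕ.z≤n)
    Nε : ι (suc k) ≡ ι N * ε
    Nε = ℚ.toℚᵘ-injective
      (ℚᵘ.≃-trans (toℚᵘ-ι (suc k))
      (ℚᵘ.≃-trans (ℚᵘ.*≡* cross)
      (ℚᵘ.≃-sym (ℚᵘ.≃-trans (ℚ.toℚᵘ-homo-* (ι N) ε) (ℚᵘ.*-cong (toℚᵘ-ι N) (ℚᵘ.≃-refl {toℚᵘ ε}))))))
      where
      cross : + suc k ℤ.* + (1 ℕ.* N) ≡ (+ N ℤ.* + suc k) ℤ.* + 1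
      cross = trans (cong (λ t → + suc k ℤ.* + t) (ℕ.*-identityˡ N))
        (trans (ℤ.*-comm (+ suc k) (+ N)) (sym (ℤ.*-identityʳ (+ N ℤ.* + suc k))))
    bound : inv (ι N) ≤ ε
    bound = subst₂ _≤_ (ℚ.*-identityʳ (inv (ι N)))
      (trans (solve 3 (λ i N ε → i :* (N :* ε) := (N :* i) :* ε) refl (inv (ι N)) (ι N) ε)
        (trans (cong (_* ε) (inv-right 0<N)) (ℚ.*-identityˡ ε)))
      (*-monoʳ (ℚ.<⇒≤ (0<inv 0<N))
        (subst (1ℚ ≤_) Nε (ι-mono {1} {suc k} (ℕ.s≤s ℕ.z≤n))))
  archimedean {mkℚ (+ zero) d-1 c} (*<* (ℤ.+<+ ()))
  archimedean {mkℚ -[1+ k ] d-1 c} (*<* ())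

  sumTo-cong : ∀ n {f g} → (∀ i → f i ≡ g i) → sumTo n f ≡ sumTo n g
  sumTo-cong zero    eq = refl
  sumTo-cong (suc n) eq = cong₂ _+_ (sumTo-cong n eq) (eq n)

  sumTo-++ : ∀ m n f → sumTo (m ℕ.+ n) f ≡ sumTo m f + sumTo n (λ j → f (m ℕ.+ j))
  sumTo-++ m zero    f = trans (cong (λ t → sumTo t f) (ℕ.+-identityʳ m))
                               (sym (ℚ.+-identityʳ (sumTo m f)))
  sumTo-++ m (suc n) f = trans (cong (λ t → sumTo t f) (ℕ.+-suc m n))
    (trans (cong (_+ f (m ℕ.+ n)) (sumTo-++ m n f))
           (ℚ.+-assoc (sumTo m f) (sumTo n (λ j → f (m ℕ.+ j))) (f (m ℕ.+ n))))

  sumTo-blocks : ∀ n m f → sumTo (n ℕ.* m) f ≡ sumTo n (λ i → sumTo m (λ j → f (i ℕ.* m ℕ.+ j)))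
  sumTo-blocks zero    m f = refl
  sumTo-blocks (suc n) m f = trans (cong (λ t → sumTo t f) (ℕ.+-comm m (n ℕ.* m)))
    (trans (sumTo-++ (n ℕ.* m) m f)
           (cong (_+ sumTo m (λ j → f (n ℕ.* m ℕ.+ j))) (sumTo-blocks n m f)))

  ι-suc-* : ∀ n c → ι (suc n) * c ≡ ι n * c + c
  ι-suc-* n c = trans (cong (_* c) (ι-suc n))
    (solve 2 (λ n c → (con 1ℚ :+ n) :* c := n :* c :+ c) refl (ι n) c)

  sumTo-const : ∀ n c → sumTo n (λ _ → c) ≡ ι n * c
  sumTo-const zero    c = sym (ℚ.*-zeroˡ c)
  sumTo-const (suc n) c = trans (cong (_+ c) (sumTo-const n c)) (sym (ι-suc-* n c))

  sumTo-lower : ∀ n {f c} → (∀ i → i ℕ.< n → c ≤ f i) → ι n * c ≤ sumTo n f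
  sumTo-lower zero    {f} {c} b = ℚ.≤-reflexive (ℚ.*-zeroˡ c)
  sumTo-lower (suc n) {f} {c} b = subst (_≤ sumTo n f + f n) (sym (ι-suc-* n c))
    (ℚ.+-mono-≤ (sumTo-lower n (λ i i<n → b i (ℕ.m<n⇒m<1+n i<n))) (b n ℕ.≤-refl))

  sumTo-diff : ∀ n {f g e} → (∀ i → i ℕ.< n → abs (f i - g i) ≤ e) →
               abs (sumTo n f - sumTo n g) ≤ ι n * e
  sumTo-diff zero    {f} {g} {e} b = ℚ.≤-reflexive (sym (ℚ.*-zeroˡ e))
  sumTo-diff (suc n) {f} {g} {e} b = subst₂ _≤_
    (cong abs (solve 4 (λ a b c d → (a :- b) :+ (c :- d) := (a :+ c) :- (b :+ d)) refl
                     (sumTo n f) (sumTo n g) (f n) (g n)))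
    (sym (ι-suc-* n e))
    (ℚ.≤-trans (ℚ.∣p+q∣≤∣p∣+∣q∣ (sumTo n f - sumTo n g) (f n - g n))
      (ℚ.+-mono-≤ (sumTo-diff n (λ i i<n → b i (ℕ.m<n⇒m<1+n i<n))) (b n ℕ.≤-refl)))

open RationalLemmas

Eventually : (ℕ → Set) → Set
Eventually P = ∃ λ N → ∀ n → N ℕ.≤ n → P n

module EventuallyLemmas where
  infixr 4 _⊗_
  _⊗_ : ∀ {P Q : ℕ → Set} → Eventually P → Eventually Q → Eventually (λ n → P n × Q n)
  (M , f) ⊗ (N , g) = M ℕ.⊔ N , λ n h →
    f n (ℕ.m⊔n≤o⇒m≤o M N h) , g n (ℕ.m⊔n≤o⇒n≤o M N h)

  mapE : ∀ {P Q : ℕ → Set} → (∀ n → P n → Q n) → Eventually P → Eventually Q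
  mapE f (N , h) = N , λ n N≤n → f n (h n N≤n)

open EventuallyLemmas

IsCauchy : (ℕ → ℚ) → Set
IsCauchy x = ∀ ε → 0ℚ < ε → ∃ λ N → ∀ m n → N ℕ.≤ m → N ℕ.≤ n → abs (x m - x n) < ε

-- Representatives of reals, with no quotient taken: _<ᴿ_ and _≤ᴿ_ below are
-- invariant under equivalence of Cauchy sequences.
record ℝ : Set where
  constructor mkℝ
  field
    seq      : ℕ → ℚ
    isCauchy : IsCauchy seq

open ℝ public

infix 4 _<ᴿ_ _≤ᴿ_

_<ᴿ_ : ℝ → ℝ → Set
x <ᴿ y = ∃ λ ε → 0ℚ < ε × Eventually (λ n → seq x n + ε ≤ seq y n)

_≤ᴿ_ : ℝ → ℝ → Set
x ≤ᴿ y = ¬ (y <ᴿ x)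

module CauchyLemmas where
  cauchy-scaled : ∀ x C → (∀ ε → 0ℚ < ε → ∃ λ N → ∀ m n → N ℕ.≤ m → N ℕ.≤ n →
                  abs (x m - x n) ≤ C * ε) → IsCauchy x
  cauchy-scaled x C h ε 0<ε with h (inv D * ε) (*-pos (0<inv 0<D) 0<ε)
    where
    D = abs C + 1ℚ
    0<D : 0ℚ < D
    0<D = ℚ.+-mono-≤-< (ℚ.0≤∣p∣ C) 0<1
  ... | N , b = N , λ m n N≤m N≤n → ℚ.≤-<-trans (b m n N≤m N≤n) Cη<ε
    where
    D = abs C + 1ℚ
    0<D : 0ℚ < D
    0<D = ℚ.+-mono-≤-< (ℚ.0≤∣p∣ C) 0<1
    η = inv D * ε
    0<η : 0ℚ < η
    0<η = *-pos (0<inv 0<D) 0<ε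
    C<D : C < D
    C<D = ℚ.≤-<-trans (p≤abs C)
      (subst (_< D) (ℚ.+-identityʳ (abs C)) (ℚ.+-monoʳ-< (abs C) 0<1))
    Dη : D * η ≡ ε
    Dη = trans (sym (ℚ.*-assoc D (inv D) ε))
      (trans (cong (_* ε) (inv-right 0<D)) (ℚ.*-identityˡ ε))
    Cη<ε : C * η < ε
    Cη<ε = subst (C * η <_) Dη (ℚ.*-monoˡ-<-pos η {{positive 0<η}} C<D)

  bounded : ∀ x → ∃ λ B → 0ℚ < B × Eventually (λ n → abs (seq x n) ≤ B)
  bounded x with isCauchy x 1ℚ 0<1
  ... | N , h = 1ℚ + abs (seq x N)
    , ℚ.+-mono-<-≤ 0<1 (ℚ.0≤∣p∣ (seq x N))
    , N , λ n N≤n → ℚ.≤-trans (abs-near (seq x n) (seq x N))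
        (ℚ.+-monoˡ-≤ (abs (seq x N)) (ℚ.<⇒≤ (h n N N≤n ℕ.≤-refl)))

open CauchyLemmas

fromℚ : ℚ → ℝ
fromℚ q = mkℝ (λ _ → q) λ ε 0<ε → 0 , λ _ _ _ _ →
  subst (_< ε) (cong abs (sym (ℚ.+-inverseʳ q))) 0<ε

fromℤ : ℤ → ℝ
fromℤ i = fromℚ (i / 1)

fromℕ : ℕ → ℝ
fromℕ n = fromℤ (+ n)

0ᴿ 1ᴿ : ℝ
0ᴿ = fromℕ 0
1ᴿ = fromℕ 1

infixl 6 _+ᴿ_
infixl 7 _*ᴿ_

module ArithmeticLemmas where
  +-cauchy : ∀ x y → IsCauchy (λ n → seq x n + seq y n)
  +-cauchy x y = cauchy-scaled (λ n → seq x n + seq y n) (1ℚ + 1ℚ) λ ε 0<ε →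
    let M , f = isCauchy x ε 0<ε
        N , g = isCauchy y ε 0<ε
    in M ℕ.⊔ N , λ m n p q → subst₂ _≤_
         (cong abs (solve 4 (λ a b c d → (a :- b) :+ (c :- d) := (a :+ c) :- (b :+ d)) refl
                          (seq x m) (seq x n) (seq y m) (seq y n)))
         (solve 1 (λ e → e :+ e := (con 1ℚ :+ con 1ℚ) :* e) refl ε)
         (ℚ.≤-trans (ℚ.∣p+q∣≤∣p∣+∣q∣ (seq x m - seq x n) (seq y m - seq y n))
           (ℚ.+-mono-≤
             (ℚ.<⇒≤ (f m n (ℕ.m⊔n≤o⇒m≤o M N p) (ℕ.m⊔n≤o⇒m≤o M N q)))
             (ℚ.<⇒≤ (g m n (ℕ.m⊔n≤o⇒n≤o M N p) (ℕ.m⊔n≤o⇒n≤o M N q)))))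

  *-cauchy : ∀ x y → IsCauchy (λ n → seq x n * seq y n)
  *-cauchy x y =
    let B , 0<B , K , b = bounded x
        C , 0<C , L , c = bounded y
    in cauchy-scaled (λ n → seq x n * seq y n) (C + B) λ ε 0<ε →
      let M , f = isCauchy x ε 0<ε
          N , g = isCauchy y ε 0<ε
      in (K ℕ.⊔ L) ℕ.⊔ (M ℕ.⊔ N) , λ m n p q →
         let pˡ = ℕ.m⊔n≤o⇒m≤o (K ℕ.⊔ L) (M ℕ.⊔ N) p
             pʳ = ℕ.m⊔n≤o⇒n≤o (K ℕ.⊔ L) (M ℕ.⊔ N) p
             qˡ = ℕ.m⊔n≤o⇒m≤o (K ℕ.⊔ L) (M ℕ.⊔ N) q
             qʳ = ℕ.m⊔n≤o⇒n≤o (K ℕ.⊔ L) (M ℕ.⊔ N) q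
         in subst (abs (seq x m * seq y m - seq x n * seq y n) ≤_)
           (solve 3 (λ e B C → e :* C :+ B :* e := (C :+ B) :* e) refl ε B C)
           (ℚ.≤-trans (abs-mul-diff (seq x m) (seq y m) (seq x n) (seq y n))
             (ℚ.+-mono-≤
               (*-mono (ℚ.0≤∣p∣ (seq x m - seq x n))
                       (ℚ.<⇒≤ (f m n (ℕ.m⊔n≤o⇒m≤o M N pʳ) (ℕ.m⊔n≤o⇒m≤o M N qʳ)))
                       (ℚ.0≤∣p∣ (seq y m)) (c m (ℕ.m⊔n≤o⇒n≤o K L pˡ)))
               (*-mono (ℚ.0≤∣p∣ (seq x n)) (b n (ℕ.m⊔n≤o⇒m≤o K L qˡ))
                       (ℚ.0≤∣p∣ (seq y m - seq y n))
                       (ℚ.<⇒≤ (g m n (ℕ.m⊔n≤o⇒n≤o M N pʳ) (ℕ.m⊔n≤o⇒n≤o M N qʳ))))))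

  positive-bound : ∀ x → 0ᴿ <ᴿ x → ∃ λ δ → 0ℚ < δ × Eventually (λ n → δ ≤ seq x n)
  positive-bound x (δ , 0<δ , e) = δ , 0<δ ,
    mapE (λ n → subst (_≤ seq x n) (ℚ.+-identityˡ δ)) e

  <-from-bound : ∀ x → (∃ λ δ → 0ℚ < δ × Eventually (λ n → δ ≤ seq x n)) → 0ᴿ <ᴿ x
  <-from-bound x (δ , 0<δ , e) = δ , 0<δ ,
    mapE (λ n → subst (_≤ seq x n) (sym (ℚ.+-identityˡ δ))) e

  recip-cauchy : ∀ x → 0ᴿ <ᴿ x → IsCauchy (λ n → inv (seq x n))
  recip-cauchy x 0<x =
    let δ , 0<δ , K , b = positive-bound x 0<x
        C = inv δ * inv δ
        0≤C = *-nonneg (ℚ.<⇒≤ (0<inv 0<δ)) (ℚ.<⇒≤ (0<inv 0<δ))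
    in cauchy-scaled (λ n → inv (seq x n)) C λ ε 0<ε →
      let N , f = isCauchy x ε 0<ε
      in K ℕ.⊔ N , λ m n p q →
         ℚ.≤-trans (inv-lipschitz 0<δ (b m (ℕ.m⊔n≤o⇒m≤o K N p)) (b n (ℕ.m⊔n≤o⇒m≤o K N q)))
           (*-monoʳ 0≤C (ℚ.<⇒≤ (f m n (ℕ.m⊔n≤o⇒n≤o K N p) (ℕ.m⊔n≤o⇒n≤o K N q))))

open ArithmeticLemmas

_+ᴿ_ : ℝ → ℝ → ℝ
x +ᴿ y = mkℝ (λ n → seq x n + seq y n) (+-cauchy x y)

_*ᴿ_ : ℝ → ℝ → ℝ
x *ᴿ y = mkℝ (λ n → seq x n * seq y n) (*-cauchy x y)

recip : (x : ℝ) → 0ᴿ <ᴿ x → ℝ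
recip x 0<x = mkℝ (λ n → inv (seq x n)) (recip-cauchy x 0<x)

infixl 7 _/ᴿ_⟨_⟩

_/ᴿ_⟨_⟩ : ℝ → (y : ℝ) → 0ᴿ <ᴿ y → ℝ
x /ᴿ y ⟨ 0<y ⟩ = x *ᴿ recip y 0<y

*ᴿ-pos : ∀ x y → 0ᴿ <ᴿ x → 0ᴿ <ᴿ y → 0ᴿ <ᴿ x *ᴿ y
*ᴿ-pos x y 0<x 0<y =
  let δ , 0<δ , K , b = positive-bound x 0<x
      η , 0<η , L , c = positive-bound y 0<y
  in <-from-bound (x *ᴿ y)
       (δ * η , *-pos 0<δ 0<η , K ℕ.⊔ L , λ n p →
         *-mono (ℚ.<⇒≤ 0<δ) (b n (ℕ.m⊔n≤o⇒m≤o K L p))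
                (ℚ.<⇒≤ 0<η) (c n (ℕ.m⊔n≤o⇒n≤o K L p)))

fromℕ-pos : ∀ n → 1 ℕ.≤ n → 0ᴿ <ᴿ fromℕ n
fromℕ-pos n p = <-from-bound (fromℕ n) (1ℚ , 0<1 , 0 , λ _ _ → ι-mono {1} {n} p)

1<fromℕ : ∀ n → 2 ℕ.≤ n → 1ᴿ <ᴿ fromℕ n
1<fromℕ n p = 1ℚ , 0<1 , 0 , λ _ _ → ι-mono {2} {n} p

step : ℕ → ℚ → ℚ
step n x = (x - 1ℚ) * inv (ι n)

-- Left Riemann sum for ∫₁ˣ dt/t with n cells of signed length step n x.
riemann : ℕ → ℚ → ℚ
riemann n x = sumTo n (λ i → step n x * inv (1ℚ + ι i * step n x))

module LogLemmas where
  ι*inv : ∀ {n} → 1 ℕ.≤ n → ι n * inv (ι n) ≡ 1ℚ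
  ι*inv {n} 1≤n = inv-right (0<ι {n} 1≤n)

  0<inv-ι : ∀ {n} → 1 ℕ.≤ n → 0ℚ < inv (ι n)
  0<inv-ι {n} 1≤n = 0<inv (0<ι {n} 1≤n)

  -- The sample points are convex combinations of 1 and x.
  module Sample {n i} (1≤n : 1 ℕ.≤ n) (i≤n : i ℕ.≤ n) (x : ℚ) where
    t : ℚ
    t = ι i * inv (ι n)

    0≤t : 0ℚ ≤ t
    0≤t = *-nonneg (0≤ι i) (ℚ.<⇒≤ (0<inv-ι {n} 1≤n))

    t≤1 : t ≤ 1ℚ
    t≤1 = subst (t ≤_) (ι*inv {n} 1≤n) (*-monoˡ (ℚ.<⇒≤ (0<inv-ι {n} 1≤n)) (ι-mono {i} {n} i≤n))

    0≤1-t : 0ℚ ≤ 1ℚ - t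
    0≤1-t = subst (_≤ 1ℚ - t) (ℚ.+-inverseʳ t) (ℚ.+-monoˡ-≤ (- t) t≤1)

    point : 1ℚ + ι i * step n x ≡ (1ℚ - t) * 1ℚ + t * x
    point = solve 3 (λ i w x → con 1ℚ :+ i :* ((x :- con 1ℚ) :* w)
                             := (con 1ℚ :- i :* w) :* con 1ℚ :+ (i :* w) :* x)
                    refl (ι i) (inv (ι n)) x

    combine : ∀ q → (1ℚ - t) * q + t * q ≡ q
    combine q = solve 2 (λ t q → (con 1ℚ :- t) :* q :+ t :* q := q) refl t q

    lower : ∀ {δ} → δ ≤ 1ℚ → δ ≤ x → δ ≤ 1ℚ + ι i * step n x
    lower {δ} δ≤1 δ≤x = subst₂ _≤_ (combine δ) (sym point)
      (ℚ.+-mono-≤ (*-monoʳ 0≤1-t δ≤1) (*-monoʳ 0≤t δ≤x))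

    upper : ∀ {B} → 1ℚ ≤ B → x ≤ B → 1ℚ + ι i * step n x ≤ B
    upper {B} 1≤B x≤B = subst₂ _≤_ (sym point) (combine B)
      (ℚ.+-mono-≤ (*-monoʳ 0≤1-t 1≤B) (*-monoʳ 0≤t x≤B))

  step-refine : ∀ {n m} → 1 ℕ.≤ n → 1 ℕ.≤ m → ∀ x → step n x ≡ ι m * step (n ℕ.* m) x
  step-refine {n} {m} 1≤n 1≤m x = sym (trans
    (cong (λ v → ι m * ((x - 1ℚ) * v)) (sym (inv-unique (0<ι {n ℕ.* m} (ℕ.*-mono-≤ 1≤n 1≤m)) one)))
    (trans (solve 4 (λ m u v w → m :* (u :* (v :* w)) := (m :* w) :* (u :* v)) refl
                    (ι m) (x - 1ℚ) (inv (ι n)) (inv (ι m)))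
    (trans (cong (_* step n x) (ι*inv {m} 1≤m)) (ℚ.*-identityˡ (step n x)))))
    where
    one : ι (n ℕ.* m) * (inv (ι n) * inv (ι m)) ≡ 1ℚ
    one = trans (cong (_* (inv (ι n) * inv (ι m))) (ι-* n m))
      (trans (solve 4 (λ a b c d → (a :* b) :* (c :* d) := (a :* c) :* (b :* d)) refl
                      (ι n) (ι m) (inv (ι n)) (inv (ι m)))
             (cong₂ _*_ (ι*inv {n} 1≤n) (ι*inv {m} 1≤m)))

  abs-step : ∀ {n} → 1 ℕ.≤ n → ∀ x → ι n * abs (step n x) ≡ abs (x - 1ℚ)
  abs-step {n} 1≤n x =
    trans (cong (λ v → ι n * v) (trans (ℚ.∣p*q∣≡∣p∣*∣q∣ (x - 1ℚ) (inv (ι n)))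
                                     (cong (abs (x - 1ℚ) *_) (abs-pos (0<inv-ι {n} 1≤n)))))
    (trans (solve 3 (λ n u w → n :* (u :* w) := (n :* w) :* u) refl (ι n) (abs (x - 1ℚ)) (inv (ι n)))
    (trans (cong (_* abs (x - 1ℚ)) (ι*inv {n} 1≤n)) (ℚ.*-identityˡ (abs (x - 1ℚ)))))

  module _ {δ} (0<δ : 0ℚ < δ) (δ≤1 : δ ≤ 1ℚ) where
    F K : ℚ
    F = inv δ
    K = inv δ * inv δ

    0≤F : 0ℚ ≤ F
    0≤F = ℚ.<⇒≤ (0<inv 0<δ)

    0≤K : 0ℚ ≤ K
    0≤K = *-nonneg 0≤F 0≤F

    riemann-refine : ∀ {n m x} → 1 ℕ.≤ n → 1 ℕ.≤ m → δ ≤ x →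
      abs (riemann n x - riemann (n ℕ.* m) x) ≤ abs (x - 1ℚ) * (K * abs (step n x))
    riemann-refine {n} {m} {x} 1≤n 1≤m δ≤x = subst₂ _≤_
      (cong (λ s → abs (riemann n x - s)) (sym (sumTo-blocks n m fine)))
      total
      (sumTo-diff n {g = λ i → sumTo m (λ j → fine (i ℕ.* m ℕ.+ j))} cell)
      where
      h g : ℚ
      h = step n x
      g = step (n ℕ.* m) x
      h≡mg : h ≡ ι m * g
      h≡mg = step-refine {n} {m} 1≤n 1≤m x
      fine : ℕ → ℚ
      fine l = g * inv (1ℚ + ι l * g)
      abs-h : ι m * abs g ≡ abs h
      abs-h = trans (cong (_* abs g) (sym (ℚ.0≤p⇒∣p∣≡p (0≤ι m))))
                    (trans (sym (ℚ.∣p*q∣≡∣p∣*∣q∣ (ι m) g)) (cong abs (sym h≡mg)))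
      total : ι n * (abs h * (K * abs h)) ≡ abs (x - 1ℚ) * (K * abs h)
      total = trans (sym (ℚ.*-assoc (ι n) (abs h) (K * abs h)))
                    (cong (_* (K * abs h)) (abs-step {n} 1≤n x))
      1≤nm : 1 ℕ.≤ n ℕ.* m
      1≤nm = ℕ.*-mono-≤ 1≤n 1≤m

      cell : ∀ i → i ℕ.< n →
             abs (h * inv (1ℚ + ι i * h) - sumTo m (λ j → fine (i ℕ.* m ℕ.+ j))) ≤ abs h * (K * abs h)
      cell i i<n = subst₂ _≤_
        (cong (λ s → abs (s - sumTo m (λ j → fine (i ℕ.* m ℕ.+ j)))) coarse)
        (trans (sym (ℚ.*-assoc (ι m) (abs g) (K * abs h))) (cong (_* (K * abs h)) abs-h))
        (sumTo-diff m {f = λ _ → g * inv p} point)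
        where
        p : ℚ
        p = 1ℚ + ι i * h
        δ≤p : δ ≤ p
        δ≤p = Sample.lower {n} {i} 1≤n (ℕ.<⇒≤ i<n) x δ≤1 δ≤x
        coarse : sumTo m (λ _ → g * inv p) ≡ h * inv p
        coarse = trans (sumTo-const m (g * inv p))
          (trans (sym (ℚ.*-assoc (ι m) g (inv p))) (cong (_* inv p) (sym h≡mg)))
        point : ∀ j → j ℕ.< m → abs (g * inv p - fine (i ℕ.* m ℕ.+ j)) ≤ abs g * (K * abs h)
        point j j<m = subst (_≤ abs g * (K * abs h))
          (trans (sym (ℚ.∣p*q∣≡∣p∣*∣q∣ g (inv p - inv q)))
                 (cong abs (solve 3 (λ g a b → g :* (a :- b) := g :* a :- g :* b) refl g (inv p) (inv q))))
          (*-monoʳ (ℚ.0≤∣p∣ g)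
            (ℚ.≤-trans (inv-lipschitz 0<δ δ≤p δ≤q) (*-monoʳ 0≤K p-q)))
          where
          l : ℕ
          l = i ℕ.* m ℕ.+ j
          l≤nm : l ℕ.≤ n ℕ.* m
          l≤nm = ℕ.≤-trans (ℕ.+-monoʳ-≤ (i ℕ.* m) (ℕ.<⇒≤ j<m))
            (ℕ.≤-trans (ℕ.≤-reflexive (ℕ.+-comm (i ℕ.* m) m)) (ℕ.*-monoˡ-≤ m i<n))
          q : ℚ
          q = 1ℚ + ι l * g
          δ≤q : δ ≤ q
          δ≤q = Sample.lower {n ℕ.* m} {l} 1≤nm l≤nm x δ≤1 δ≤x
          q≡ : q ≡ p + ι j * g
          q≡ = trans (cong (λ v → 1ℚ + v * g) (trans (ι-+ (i ℕ.* m) j) (cong (_+ ι j) (ι-* i m))))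
            (trans (solve 4 (λ i m j g → con 1ℚ :+ (i :* m :+ j) :* g
                                       := (con 1ℚ :+ i :* (m :* g)) :+ j :* g) refl
                            (ι i) (ι m) (ι j) g)
                   (cong (λ v → (1ℚ + ι i * v) + ι j * g) (sym h≡mg)))
          p-q : abs (p - q) ≤ abs h
          p-q = subst₂ _≤_
            (trans (cong (_* abs g) (sym (ℚ.0≤p⇒∣p∣≡p (0≤ι j))))
              (trans (sym (ℚ.∣p*q∣≡∣p∣*∣q∣ (ι j) g))
              (trans (sym (ℚ.∣-p∣≡∣p∣ (ι j * g)))
                     (cong abs (trans (solve 2 (λ p v → :- v := p :- (p :+ v)) refl p (ι j * g))
                                      (cong (_-_ p) (sym q≡)))))))
            abs-h
            (*-monoˡ (ℚ.0≤∣p∣ g) (ι-mono {j} {m} (ℕ.<⇒≤ j<m)))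

    riemann-lipschitz : ∀ {n x y} → 1 ℕ.≤ n → δ ≤ x → δ ≤ y →
      abs (riemann n x - riemann n y) ≤ (F + abs (y - 1ℚ) * K) * abs (x - y)
    riemann-lipschitz {n} {x} {y} 1≤n δ≤x δ≤y = subst (abs (riemann n x - riemann n y) ≤_)
      (trans (sym (ℚ.*-assoc (ι n) w L)) (trans (cong (_* L) (ι*inv {n} 1≤n)) (ℚ.*-identityˡ L)))
      (sumTo-diff n cell)
      where
      w L : ℚ
      w = inv (ι n)
      L = (F + abs (y - 1ℚ) * K) * abs (x - y)
      abs-w : abs w ≡ w
      abs-w = abs-pos (0<inv-ι {n} 1≤n)
      step-diff : abs (step n x - step n y) ≡ w * abs (x - y)
      step-diff = trans (cong abs (solve 3 (λ x y w → (x :- con 1ℚ) :* w :- (y :- con 1ℚ) :* w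
                                                    := w :* (x :- y)) refl x y w))
        (trans (ℚ.∣p*q∣≡∣p∣*∣q∣ w (x - y)) (cong (_* abs (x - y)) abs-w))
      cell : ∀ i → i ℕ.< n → abs (step n x * inv (1ℚ + ι i * step n x)
                                - step n y * inv (1ℚ + ι i * step n y)) ≤ w * L
      cell i i<n = subst (abs (step n x * inv p - step n y * inv q) ≤_)
        (solve 5 (λ w d F y K → (w :* d) :* F :+ (y :* w) :* (K :* d)
                              := w :* ((F :+ y :* K) :* d)) refl w (abs (x - y)) F (abs (y - 1ℚ)) K)
        (ℚ.≤-trans (abs-mul-diff (step n x) (inv p) (step n y) (inv q))
          (ℚ.+-mono-≤
            (*-mono (ℚ.0≤∣p∣ (step n x - step n y)) (ℚ.≤-reflexive step-diff)
                    (ℚ.0≤∣p∣ (inv p))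
                    (subst (_≤ F) (sym (abs-pos (0<inv (ℚ.<-≤-trans 0<δ δ≤p)))) (inv-anti 0<δ δ≤p)))
            (*-mono (ℚ.0≤∣p∣ (step n y))
                    (ℚ.≤-reflexive (trans (ℚ.∣p*q∣≡∣p∣*∣q∣ (y - 1ℚ) w) (cong (abs (y - 1ℚ) *_) abs-w)))
                    (ℚ.0≤∣p∣ (inv p - inv q))
                    (ℚ.≤-trans (inv-lipschitz 0<δ δ≤p δ≤q) (*-monoʳ 0≤K p-q)))))
        where
        module P = Sample {n} {i} 1≤n (ℕ.<⇒≤ i<n)
        p q : ℚ
        p = 1ℚ + ι i * step n x
        q = 1ℚ + ι i * step n y
        δ≤p : δ ≤ p
        δ≤p = P.lower x δ≤1 δ≤x
        δ≤q : δ ≤ q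
        δ≤q = P.lower y δ≤1 δ≤y
        p-q : abs (p - q) ≤ abs (x - y)
        p-q = subst₂ _≤_
          (trans (sym (cong (_* abs (x - y)) (ℚ.0≤p⇒∣p∣≡p (P.0≤t x))))
            (trans (sym (ℚ.∣p*q∣≡∣p∣*∣q∣ (ι i * w) (x - y)))
              (cong abs (solve 4 (λ i w x y → (i :* w) :* (x :- y)
                                            := (con 1ℚ :+ i :* ((x :- con 1ℚ) :* w))
                                            :- (con 1ℚ :+ i :* ((y :- con 1ℚ) :* w)))
                               refl (ι i) w x y))))
          (ℚ.*-identityˡ (abs (x - y)))
          (*-monoˡ (ℚ.0≤∣p∣ (x - y)) (P.t≤1 x))

  small-bound : ∀ x → 0ᴿ <ᴿ x → ∃ λ δ → 0ℚ < δ × δ ≤ 1ℚ × Eventually (λ n → δ ≤ seq x n)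
  small-bound x 0<x with positive-bound x 0<x
  ... | δ , 0<δ , b with ℚ.≤-total δ 1ℚ
  ...   | inj₁ δ≤1 = δ , 0<δ , δ≤1 , b
  ...   | inj₂ 1≤δ = 1ℚ , 0<1 , ℚ.≤-refl , mapE (λ _ → ℚ.≤-trans 1≤δ) b

  log-cauchy : ∀ x → 0ᴿ <ᴿ x → IsCauchy (λ n → riemann n (seq x n))
  log-cauchy x 0<x = cauchy-scaled (λ n → riemann n (seq x n)) C bound
    where
    x-1 : ℝ
    x-1 = x +ᴿ fromℚ (- 1ℚ)
    lo = small-bound x 0<x
    hi = bounded x-1
    δ = proj₁ lo
    0<δ = proj₁ (proj₂ lo)
    δ≤1 = proj₁ (proj₂ (proj₂ lo))
    U = proj₁ hi
    0≤U = ℚ.<⇒≤ (proj₁ (proj₂ hi))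
    F′ = F 0<δ δ≤1
    K′ = K 0<δ δ≤1
    0≤K′ = 0≤K 0<δ δ≤1
    R L C : ℚ
    R = U * (K′ * U)
    L = F′ + U * K′
    C = R + L + R
    0≤L : 0ℚ ≤ L
    0≤L = ℚ.+-mono-≤ (0≤F 0<δ δ≤1) (*-nonneg 0≤U 0≤K′)
    bound : ∀ ε → 0ℚ < ε → ∃ λ N → ∀ m n → N ℕ.≤ m → N ℕ.≤ n →
            abs (riemann m (seq x m) - riemann n (seq x n)) ≤ C * ε
    bound ε 0<ε = proj₁ good ℕ.⊔ proj₁ cau , λ m n p q →
      let M = proj₁ good
          N = proj₁ cau
          gm = proj₂ good m (ℕ.m⊔n≤o⇒m≤o M N p)
          gn = proj₂ good n (ℕ.m⊔n≤o⇒m≤o M N q)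
          1≤m = proj₁ (proj₁ gm)
          1≤n = proj₁ (proj₁ gn)
          a = riemann m (seq x m)
          b = riemann (m ℕ.* n) (seq x m)
          c = riemann (m ℕ.* n) (seq x n)
          d = riemann n (seq x n)
          ab = refined m n gm 1≤n
          cd = subst (λ v → abs (riemann v (seq x n) - d) ≤ R * ε) (ℕ.*-comm n m)
                 (subst (_≤ R * ε) (abs-swap d (riemann (n ℕ.* m) (seq x n))) (refined n m gn 1≤m))
          bc = ℚ.≤-trans
                 (riemann-lipschitz 0<δ δ≤1 {m ℕ.* n} (ℕ.*-mono-≤ 1≤m 1≤n)
                   (proj₁ (proj₂ gm)) (proj₁ (proj₂ gn)))
                 (*-mono (ℚ.+-mono-≤ (0≤F 0<δ δ≤1) (*-nonneg (ℚ.0≤∣p∣ (seq x n - 1ℚ)) 0≤K′))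
                         (ℚ.+-monoʳ-≤ F′ (*-monoˡ 0≤K′ (proj₂ (proj₂ gn))))
                         (ℚ.0≤∣p∣ (seq x m - seq x n))
                         (ℚ.<⇒≤ (proj₂ cau m n (ℕ.m⊔n≤o⇒n≤o M N p) (ℕ.m⊔n≤o⇒n≤o M N q))))
      in subst (abs (a - d) ≤_)
           (solve 3 (λ R L e → (R :* e :+ L :* e) :+ R :* e := (R :+ L :+ R) :* e) refl R L ε)
           (ℚ.≤-trans (abs-tri a c d)
             (ℚ.+-mono-≤ (ℚ.≤-trans (abs-tri a b c) (ℚ.+-mono-≤ ab bc)) cd))
      where
      Good : ℕ → Set
      Good n = (1 ℕ.≤ n × inv (ι n) ≤ ε) × (δ ≤ seq x n × abs (seq x n - 1ℚ) ≤ U)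
      good : Eventually Good
      good = archimedean 0<ε ⊗ proj₂ (proj₂ (proj₂ lo)) ⊗ proj₂ (proj₂ hi)
      cau = isCauchy x ε 0<ε
      refined : ∀ m n → Good m → 1 ℕ.≤ n →
                abs (riemann m (seq x m) - riemann (m ℕ.* n) (seq x m)) ≤ R * ε
      refined m n ((1≤m , w≤ε) , δ≤x , u≤U) 1≤n = ℚ.≤-trans
        (riemann-refine 0<δ δ≤1 {m} {n} 1≤m 1≤n δ≤x)
        (subst (abs (seq x m - 1ℚ) * (K′ * abs (step m (seq x m))) ≤_)
          (solve 3 (λ U K e → U :* (K :* (U :* e)) := (U :* (K :* U)) :* e) refl U K′ ε)
          (*-mono (ℚ.0≤∣p∣ (seq x m - 1ℚ)) u≤U
            (*-nonneg 0≤K′ (ℚ.0≤∣p∣ (step m (seq x m))))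
            (*-monoʳ 0≤K′ (subst (_≤ U * ε) (sym abs-eq)
              (*-mono (ℚ.0≤∣p∣ (seq x m - 1ℚ)) u≤U (ℚ.<⇒≤ (0<inv-ι {m} 1≤m)) w≤ε)))))
        where
        abs-eq : abs (step m (seq x m)) ≡ abs (seq x m - 1ℚ) * inv (ι m)
        abs-eq = trans (ℚ.∣p*q∣≡∣p∣*∣q∣ (seq x m - 1ℚ) (inv (ι m)))
          (cong (abs (seq x m - 1ℚ) *_) (abs-pos (0<inv-ι {m} 1≤m)))

open LogLemmas

-- log x = ∫₁ˣ dt/t, the n-th approximation being the n-cell Riemann sum
-- up to the n-th approximation of x.
log : (x : ℝ) → 0ᴿ <ᴿ x → ℝ
log x 0<x = mkℝ (λ n → riemann n (seq x n)) (log-cauchy x 0<x)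

1<⇒0< : ∀ x → 1ᴿ <ᴿ x → 0ᴿ <ᴿ x
1<⇒0< x (ε , 0<ε , b) = <-from-bound x
  (1ℚ + ε , ℚ.+-mono-<-≤ 0<1 (ℚ.<⇒≤ 0<ε) , b)

log-pos : ∀ x (1<x : 1ᴿ <ᴿ x) → 0ᴿ <ᴿ log x (1<⇒0< x 1<x)
log-pos x 1<x@(ε , 0<ε , b) = <-from-bound (log x (1<⇒0< x 1<x))
  ( ε * inv B , *-pos 0<ε (0<inv 0<B)
  , mapE bound (archimedean 0<1 ⊗ b ⊗ proj₂ (proj₂ hi)))
  where
  hi = bounded x
  B = proj₁ hi
  0<B = proj₁ (proj₂ hi)
  bound : ∀ n → (1 ℕ.≤ n × inv (ι n) ≤ 1ℚ) × (1ℚ + ε ≤ seq x n × abs (seq x n) ≤ B) →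
          ε * inv B ≤ riemann n (seq x n)
  bound n ((1≤n , _) , 1+ε≤x , absx≤B) = ℚ.≤-trans (*-monoˡ (ℚ.<⇒≤ (0<inv 0<B)) ε≤u)
    (subst (_≤ riemann n X) whole (sumTo-lower n cell))
    where
    X h : ℚ
    X = seq x n
    h = step n X
    ε≤u : ε ≤ X - 1ℚ
    ε≤u = subst (_≤ X - 1ℚ) (solve 1 (λ e → (con 1ℚ :+ e) :- con 1ℚ := e) refl ε)
                (ℚ.+-monoˡ-≤ (- 1ℚ) 1+ε≤x)
    1≤X : 1ℚ ≤ X
    1≤X = ℚ.≤-trans (ℚ.+-monoʳ-≤ 1ℚ (ℚ.<⇒≤ 0<ε)) 1+ε≤x
    X≤B : X ≤ B
    X≤B = ℚ.≤-trans (p≤abs X) absx≤B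
    0≤h : 0ℚ ≤ h
    0≤h = *-nonneg (ℚ.≤-trans (ℚ.<⇒≤ 0<ε) ε≤u) (ℚ.<⇒≤ (0<inv-ι {n} 1≤n))
    whole : ι n * (h * inv B) ≡ (X - 1ℚ) * inv B
    whole = trans (solve 4 (λ n u w b → n :* ((u :* w) :* b) := (n :* w) :* (u :* b)) refl
                           (ι n) (X - 1ℚ) (inv (ι n)) (inv B))
      (trans (cong (_* ((X - 1ℚ) * inv B)) (ι*inv {n} 1≤n)) (ℚ.*-identityˡ ((X - 1ℚ) * inv B)))
    cell : ∀ i → i ℕ.< n → h * inv B ≤ h * inv (1ℚ + ι i * h)
    cell i i<n = *-monoʳ 0≤h (inv-anti
      (ℚ.<-≤-trans 0<1 (P.lower ℚ.≤-refl 1≤X))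
      (P.upper (ℚ.≤-trans 1≤X X≤B) X≤B))
      where module P = Sample {n} {i} 1≤n (ℕ.<⇒≤ i<n) X

1<2 : 1ᴿ <ᴿ fromℕ 2
1<2 = 1<fromℕ 2 ℕ.≤-refl

log2 : ℝ
log2 = log (fromℕ 2) (1<⇒0< (fromℕ 2) 1<2)

log2-pos : 0ᴿ <ᴿ log2
log2-pos = log-pos (fromℕ 2) 1<2

2log2-pos : 0ᴿ <ᴿ fromℕ 2 *ᴿ log2
2log2-pos = *ᴿ-pos (fromℕ 2) log2 (1<⇒0< (fromℕ 2) 1<2) log2-pos

log₂ : (x : ℝ) → 0ᴿ <ᴿ x → ℝ
log₂ x 0<x = log x 0<x /ᴿ log2 ⟨ log2-pos ⟩

-- A relation, because ⌊_⌋ is not a computable function on ℝ.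
IsFloor : ℤ → ℝ → Set
IsFloor k x = fromℤ k ≤ᴿ x × x <ᴿ fromℤ (k ℤ.+ + 1)

-- The list must be repetition-free and nonempty; the value at [] is junk.
-- (kSubsets n k is nonempty exactly when k ≤ n.)
uniformProb : {A : Set} {P : Pred A 0ℓ} → Decidable P → List A → ℚ
uniformProb P? []         = 0ℚ
uniformProb P? xs@(_ ∷ _) = + length (filter P? xs) / length xs

allSubsets : ∀ n → List (Subset n)
allSubsets zero    = [ [] ]
allSubsets (suc n) = map (outside ∷_) (allSubsets n) ++ map (inside ∷_) (allSubsets n)

kSubsets : (n k : ℕ) → List (Subset n)
kSubsets n k = filter (λ A → ∣ A ∣ ℕ.≟ k) (allSubsets n)

-- 𝔽ₚ is represented by Fin p, and a sum in 𝔽ₚ is the residue of the sum of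
-- the representatives 0, …, p − 1.
sumOf : ∀ {p} .{{_ : ℕ.NonZero p}} → Subset p → Fin p
sumOf {p} S = sum (map toℕ (filter (_∈? S) (allFin p))) mod p

SubsetSums : ∀ {p} .{{_ : ℕ.NonZero p}} → Subset p → Pred (Fin p) 0ℓ
SubsetSums A y = ∃ λ S → S ⊆ A × sumOf S ≡ y

Complete : ∀ p .{{_ : ℕ.NonZero p}} → Pred (Subset p) 0ℓ
Complete p A = ∀ y → SubsetSums A y

complete? : ∀ p .{{_ : ℕ.NonZero p}} → Decidable (Complete p)
complete? p A = Fin.all? λ y → anySubset? λ S → S ⊆? A ×-dec sumOf S Fin.≟ y

-- Choose k residues a independently and write Σ for the set of their 2^k subset
-- sums. For a target y let N(y) count the subsets with sum −y. For even R the
-- truncated inclusion–exclusion sum Σ_{i<R} (−1)^i C(N(y), i) is ≤ 0 when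
-- N(y) ≥ 1, so its total X over all y is ≤ 0 whenever every residue is a subset
-- sum. If 2^k ≤ ℓ p and R = 8ℓ, the mean that X would have if any R subset sums
-- were independent is p · main with main ≥ 16^{−ℓ}. The second moment of X about
-- this value counts linear relations over 𝔽_p among n ≤ 2R distinct vectors of
-- {0,1}^{k+2}. Distinctness forces every relation to have at least three nonzero
-- coefficients, and a Littlewood–Offord bound for such relations makes the second
-- moment at most 2^{O(ℓ²)} (3/4)^k p², so the probability of Σ = 𝔽_p is small as
-- soon as ℓ² is a small multiple of k. For c < 1/(2 log 2) the floor condition
-- gives 4^k ≤ η p² k for every fixed η and large p, i.e. ℓ² ≤ η k is admissible.

module Submission where

-- If the sums were independent, a residue would be missed with probability about exp(-2^k/p), so
-- many are missed on average; what has to be shown is concentration. The event N(y) = 0 depends on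
-- all 2^k sums at once, whereas the second moment of a truncated sum involves fewer than 2R of them
-- at a time. There rank-nullity makes the joint law a matter of relations: a relation space of
-- dimension e multiplies the independent value by p^e. A relation has to hold in every coordinate.
-- Were this to happen in a random 0/1 coordinate with probability 1/2, its contribution would be
-- about p/2^k, at least 1/ℓ, which cannot pay for factors 2^(O(ℓ²)). With three nonzero
-- coefficients and odd p the probability is at most 3/8, and the whole saving (3/4)^k comes from
-- there. The condition on c enters because 2^k/p is at most (log p)^(c log 2), whose exponent is
-- below 1/2 exactly when c < 1/(2 log 2), and ℓ may be a small multiple of sqrt k.

open import Data.Product using (_,_; _×_; proj₁; proj₂; ∃)
open import Data.Sum.Base using ([_,_]′; _⊎_; inj₁; inj₂)
open import Relation.Binary.PropositionalEquality hiding ([_]; J)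
open import Relation.Nullary using (Dec; contradiction; no; yes; ¬_)
open import Relation.Nullary.Decidable using (_×-dec_; _⊎-dec_; decidable-stable; ¬?)

-- Finite sums over lists, indicators and finite types.

module FiniteSums where

  open import Data.Bool.Base using (Bool; true; false)
  open import Data.Bool.Properties using () renaming (_≟_ to _≟ᵇ_)
  open import Data.Fin.Base using (Fin; zero; suc)
  import Data.Fin.Properties as Fin
  open import Data.List.Base using (List; []; _∷_; _++_; map; concatMap; length; allFin; tabulate)
  import Data.List.Properties as List
  open import Data.List.Membership.Propositional using (_∈_; lose)
  open import Data.List.Relation.Unary.Any using (Any; here; there; any?; satisfied)
  open import Data.Nat.Base
  open import Data.Nat.Properties hiding (_≟_)
  open import Data.Nat.Tactic.RingSolver using (solve-∀)
  open import Data.Vec.Base using (Vec; []; _∷_)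
  import Data.Vec.Properties as Vec
  open import Relation.Binary.Definitions using (DecidableEquality)

  private variable A B : Set

  ∑ : List A → (A → ℕ) → ℕ
  ∑ [] f = 0
  ∑ (x ∷ xs) f = f x + ∑ xs f

  ∑-cong : ∀ (xs : List A) {f g} → (∀ x → f x ≡ g x) → ∑ xs f ≡ ∑ xs g
  ∑-cong [] h = refl
  ∑-cong (x ∷ xs) h = cong₂ _+_ (h x) (∑-cong xs h)

  ∑-mono : ∀ (xs : List A) {f g} → (∀ x → f x ≤ g x) → ∑ xs f ≤ ∑ xs g
  ∑-mono [] h = ≤-refl
  ∑-mono (x ∷ xs) h = +-mono-≤ (h x) (∑-mono xs h)

  ∑-++ : ∀ (xs ys : List A) f → ∑ (xs ++ ys) f ≡ ∑ xs f + ∑ ys f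
  ∑-++ [] ys f = refl
  ∑-++ (x ∷ xs) ys f = trans (cong (f x +_) (∑-++ xs ys f)) (sym (+-assoc (f x) _ _))

  ∑-map : ∀ (g : A → B) xs f → ∑ (map g xs) f ≡ ∑ xs (λ x → f (g x))
  ∑-map g [] f = refl
  ∑-map g (x ∷ xs) f = cong (f (g x) +_) (∑-map g xs f)

  ∑-concatMap : ∀ (g : A → List B) xs f → ∑ (concatMap g xs) f ≡ ∑ xs (λ x → ∑ (g x) f)
  ∑-concatMap g [] f = refl
  ∑-concatMap g (x ∷ xs) f =
    trans (∑-++ (g x) (concatMap g xs) f) (cong (∑ (g x) f +_) (∑-concatMap g xs f))

  ∑-zero : ∀ (xs : List A) → ∑ xs (λ _ → 0) ≡ 0
  ∑-zero [] = refl
  ∑-zero (x ∷ xs) = ∑-zero xs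

  ∑-+ : ∀ (xs : List A) f g → ∑ xs (λ x → f x + g x) ≡ ∑ xs f + ∑ xs g
  ∑-+ [] f g = refl
  ∑-+ (x ∷ xs) f g = trans (cong (f x + g x +_) (∑-+ xs f g)) (interchange (f x) (g x) _ _)
    where
    interchange : ∀ a b c d → a + b + (c + d) ≡ a + c + (b + d)
    interchange = solve-∀

  ∑-*ˡ : ∀ (xs : List A) c f → ∑ xs (λ x → c * f x) ≡ c * ∑ xs f
  ∑-*ˡ [] c f = sym (*-zeroʳ c)
  ∑-*ˡ (x ∷ xs) c f = trans (cong (c * f x +_) (∑-*ˡ xs c f)) (sym (*-distribˡ-+ c (f x) _))

  ∑-*ʳ : ∀ (xs : List A) f c → ∑ xs (λ x → f x * c) ≡ ∑ xs f * c
  ∑-*ʳ xs f c = trans (∑-cong xs (λ x → *-comm (f x) c)) (trans (∑-*ˡ xs c f) (*-comm c _))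

  ∑-const : ∀ (xs : List A) c → ∑ xs (λ _ → c) ≡ ∑ xs (λ _ → 1) * c
  ∑-const xs c = trans (∑-cong xs (λ _ → sym (*-identityˡ c))) (∑-*ʳ xs (λ _ → 1) c)

  ∑-one : ∀ (xs : List A) → ∑ xs (λ _ → 1) ≡ length xs
  ∑-one [] = refl
  ∑-one (x ∷ xs) = cong suc (∑-one xs)

  ∑-swap : ∀ (xs : List A) (ys : List B) (f : A → B → ℕ) →
           ∑ xs (λ x → ∑ ys (f x)) ≡ ∑ ys (λ y → ∑ xs (λ x → f x y))
  ∑-swap [] ys f = sym (∑-zero ys)
  ∑-swap (x ∷ xs) ys f = trans (cong (∑ ys (f x) +_) (∑-swap xs ys f)) (sym (∑-+ ys (f x) _))

  ∑-term : ∀ {xs : List A} {a} f → a ∈ xs → f a ≤ ∑ xs f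
  ∑-term {xs = x ∷ xs} f (here refl) = m≤m+n (f x) _
  ∑-term {xs = x ∷ xs} f (there a∈) = ≤-trans (∑-term f a∈) (m≤n+m _ (f x))

  𝟙 : ∀ {P : Set} → Dec P → ℕ
  𝟙 (yes _) = 1
  𝟙 (no _) = 0

  𝟙-yes : ∀ {P : Set} (d : Dec P) → P → 𝟙 d ≡ 1
  𝟙-yes (yes _) _ = refl
  𝟙-yes (no ¬p) p = contradiction p ¬p

  𝟙-no : ∀ {P : Set} (d : Dec P) → ¬ P → 𝟙 d ≡ 0
  𝟙-no (yes p) ¬p = contradiction p ¬p
  𝟙-no (no _) _ = refl

  𝟙-true : ∀ {P : Set} (d : Dec P) → 𝟙 d ≡ 1 → P
  𝟙-true (yes p) _ = p

  𝟙-mono : ∀ {P Q : Set} (d : Dec P) (e : Dec Q) → (P → Q) → 𝟙 d ≤ 𝟙 e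
  𝟙-mono (yes p) e f = ≤-reflexive (sym (𝟙-yes e (f p)))
  𝟙-mono (no _) e f = z≤n

  𝟙-⇔ : ∀ {P Q : Set} (d : Dec P) (e : Dec Q) → (P → Q) → (Q → P) → 𝟙 d ≡ 𝟙 e
  𝟙-⇔ d e f g = ≤-antisym (𝟙-mono d e f) (𝟙-mono e d g)

  𝟙-× : ∀ {P Q : Set} (d : Dec P) (e : Dec Q) → 𝟙 (d ×-dec e) ≡ 𝟙 d * 𝟙 e
  𝟙-× (yes _) (yes _) = refl
  𝟙-× (yes _) (no _) = refl
  𝟙-× (no _) e = refl

  𝟙≤1 : ∀ {P : Set} (d : Dec P) → 𝟙 d ≤ 1
  𝟙≤1 (yes _) = ≤-refl
  𝟙≤1 (no _) = z≤n

  -- Exhaustiveness and absence of repetitions are stated together, as the arithmetic identity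
  -- `once`. This is the form that double counting consumes; `sift` is the resulting Kronecker
  -- delta.
  record Finite (A : Set) : Set where
    infix 4 _≟_
    field
      elems : List A
      _≟_ : DecidableEquality A
      once : ∀ t → ∑ elems (λ x → 𝟙 (x ≟ t)) ≡ 1

    ∈-elems : ∀ t → t ∈ elems
    ∈-elems t with any? (λ x → t ≟ x) elems
    ... | yes t∈ = t∈
    ... | no t∉ = contradiction (trans (sym (once t)) (absent elems t∉)) λ ()
      where
      absent : ∀ xs → ¬ Any (t ≡_) xs → ∑ xs (λ x → 𝟙 (x ≟ t)) ≡ 0
      absent [] _ = refl
      absent (x ∷ xs) t∉ =
        cong₂ _+_ (𝟙-no (x ≟ t) (λ x≡t → t∉ (here (sym x≡t)))) (absent xs (λ t∈ → t∉ (there t∈)))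

    ∃⊎∀ : {P : A → Set} → (∀ x → Dec (P x)) → ∃ P ⊎ (∀ x → ¬ P x)
    ∃⊎∀ P? with any? P? elems
    ... | yes h = inj₁ (satisfied h)
    ... | no h = inj₂ λ x Px → h (lose (∈-elems x) Px)

    sift : ∀ t (g : A → ℕ) → ∑ elems (λ x → 𝟙 (x ≟ t) * g x) ≡ g t
    sift t g = trans (∑-cong elems eq)
      (trans (∑-*ʳ elems (λ x → 𝟙 (x ≟ t)) (g t)) (trans (cong (_* g t) (once t)) (*-identityˡ (g t))))
      where
      eq : ∀ x → 𝟙 (x ≟ t) * g x ≡ 𝟙 (x ≟ t) * g t
      eq x with x ≟ t
      ... | yes refl = refl
      ... | no _ = refl

  open Finite using (elems)

  sum : Finite A → (A → ℕ) → ℕ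
  sum fin = ∑ (elems fin)

  card : Finite A → ℕ
  card fin = sum fin (λ _ → 1)

  -- Exactly one `a` lies over each `b`. Inserting the delta `𝟙 (b ≟ σ a)` and exchanging the two
  -- sums shows this without permuting any list.
  reindex : (finA : Finite A) (finB : Finite B) (σ : A → B) (τ : B → A) →
            (∀ a → τ (σ a) ≡ a) → (∀ b → σ (τ b) ≡ b) →
            ∀ (g : B → ℕ) → sum finA (λ a → g (σ a)) ≡ sum finB g
  reindex finA finB σ τ τσ στ g = begin
    ∑ as (λ a → g (σ a)) ≡⟨ ∑-cong as (λ a → sym (B.sift (σ a) g)) ⟩
    ∑ as (λ a → ∑ bs (λ b → 𝟙 (b B.≟ σ a) * g b)) ≡⟨ ∑-swap as bs _ ⟩
    ∑ bs (λ b → ∑ as (λ a → 𝟙 (b B.≟ σ a) * g b)) ≡⟨ ∑-cong bs (λ b → ∑-*ʳ as _ (g b)) ⟩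
    ∑ bs (λ b → ∑ as (λ a → 𝟙 (b B.≟ σ a)) * g b) ≡⟨ ∑-cong bs (λ b → cong (_* g b) (unique b)) ⟩
    ∑ bs (λ b → 1 * g b) ≡⟨ ∑-cong bs (λ b → *-identityˡ (g b)) ⟩
    ∑ bs g ∎
    where
    open ≡-Reasoning
    module A = Finite finA
    module B = Finite finB
    as = A.elems
    bs = B.elems
    unique : ∀ b → ∑ as (λ a → 𝟙 (b B.≟ σ a)) ≡ 1
    unique b = trans
      (∑-cong as (λ a → 𝟙-⇔ (b B.≟ σ a) (a A.≟ τ b)
        (λ b≡ → sym (trans (cong τ b≡) (τσ a))) (λ a≡ → sym (trans (cong σ a≡) (στ b)))))
      (A.once (τ b))

  finBool : Finite Bool
  finBool = record { elems = false ∷ true ∷ [] ; _≟_ = _≟ᵇ_ ; once = λ { false → refl ; true → refl } }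

  ∑-tabulate-suc : ∀ m {n} (f : Fin m → Fin n) g →
                   ∑ (tabulate (λ i → suc (f i))) g ≡ ∑ (tabulate f) (λ i → g (suc i))
  ∑-tabulate-suc zero f g = refl
  ∑-tabulate-suc (suc m) f g = cong (g (suc (f zero)) +_) (∑-tabulate-suc m (λ i → f (suc i)) g)

  ∑-allFin : ∀ n g → ∑ (allFin (suc n)) g ≡ g zero + ∑ (allFin n) (λ i → g (suc i))
  ∑-allFin n g = cong (g zero +_) (∑-tabulate-suc n (λ i → i) g)

  finFin : ∀ n → Finite (Fin n)
  finFin n = record { elems = allFin n ; _≟_ = Fin._≟_ ; once = once }
    where
    once : ∀ {n} (t : Fin n) → ∑ (allFin n) (λ x → 𝟙 (x Fin.≟ t)) ≡ 1
    once {suc n} zero = trans (∑-allFin n (λ x → 𝟙 (x Fin.≟ zero))) (cong suc (∑-zero (allFin n)))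
    once {suc n} (suc t) = trans (∑-allFin n (λ x → 𝟙 (x Fin.≟ suc t)))
      (trans (∑-cong (allFin n) (λ i → 𝟙-⇔ (suc i Fin.≟ suc t) (i Fin.≟ t) Fin.suc-injective (cong suc)))
             (once t))

  card-Fin : ∀ n → card (finFin n) ≡ n
  card-Fin n = trans (∑-one (allFin n)) (List.length-tabulate {n = n} (λ i → i))

  vecs : List A → ∀ n → List (Vec A n)
  vecs xs zero = [] ∷ []
  vecs xs (suc n) = concatMap (λ x → map (x ∷_) (vecs xs n)) xs

  ∑-vecs : ∀ (xs : List A) n f →
           ∑ (vecs xs (suc n)) f ≡ ∑ xs (λ x → ∑ (vecs xs n) (λ v → f (x ∷ v)))
  ∑-vecs xs n f = trans (∑-concatMap _ xs f) (∑-cong xs (λ x → ∑-map (x ∷_) (vecs xs n) f))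

  finVec : Finite A → ∀ n → Finite (Vec A n)
  finVec fin n = record { elems = vecs A.elems n ; _≟_ = Vec.≡-dec A._≟_ ; once = once }
    where
    module A = Finite fin
    once : ∀ {n} t → ∑ (vecs A.elems n) (λ v → 𝟙 (Vec.≡-dec A._≟_ v t)) ≡ 1
    once [] = refl
    once {suc n} (t ∷ ts) = begin
      ∑ (vecs A.elems (suc n)) (λ v → 𝟙 (v ≟ⱽ (t ∷ ts))) ≡⟨ ∑-vecs A.elems n _ ⟩
      ∑ A.elems (λ x → ∑ (vecs A.elems n) (λ v → 𝟙 ((x ∷ v) ≟ⱽ (t ∷ ts)))) ≡⟨ ∑-cong A.elems inner ⟩
      ∑ A.elems (λ x → 𝟙 (x A.≟ t) * 1) ≡⟨ ∑-*ʳ A.elems _ 1 ⟩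
      ∑ A.elems (λ x → 𝟙 (x A.≟ t)) * 1 ≡⟨ cong (_* 1) (A.once t) ⟩
      1 ∎
      where
      open ≡-Reasoning
      _≟ⱽ_ : ∀ {m} → DecidableEquality (Vec _ m)
      _≟ⱽ_ = Vec.≡-dec A._≟_
      inner : ∀ x → ∑ (vecs A.elems n) (λ v → 𝟙 ((x ∷ v) ≟ⱽ (t ∷ ts))) ≡ 𝟙 (x A.≟ t) * 1
      inner x = trans
        (∑-cong (vecs A.elems n) (λ v → trans
          (𝟙-⇔ ((x ∷ v) ≟ⱽ (t ∷ ts)) ((x A.≟ t) ×-dec (v ≟ⱽ ts)) Vec.∷-injective (λ (p , q) → cong₂ _∷_ p q))
          (𝟙-× (x A.≟ t) (v ≟ⱽ ts))))
        (trans (∑-*ˡ (vecs A.elems n) (𝟙 (x A.≟ t)) _) (cong (𝟙 (x A.≟ t) *_) (once ts)))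

  card-Vec : ∀ (fin : Finite A) n → card (finVec fin n) ≡ card fin ^ n
  card-Vec fin zero = refl
  card-Vec fin (suc n) = trans (∑-vecs (elems fin) n _)
    (trans (∑-const (elems fin) _) (cong (card fin *_) (card-Vec fin n)))

  sum-vec : ∀ (fin : Finite A) n f →
            sum (finVec fin (suc n)) f ≡ sum fin (λ x → sum (finVec fin n) (λ v → f (x ∷ v)))
  sum-vec fin = ∑-vecs (elems fin)

-- Linear algebra over a finite field, by counting.

module LinAlg where

  open FiniteSums
  open import Algebra.Bundles using (CommutativeRing)
  import Algebra.Properties.Ring as RingProperties
  open import Algebra.Structures using (IsCommutativeRing)
  open import Data.Bool.Base using (Bool; true; false; if_then_else_)
  open import Data.List.Base using ([]; _∷_)
  open import Data.Nat.Base
  open import Data.Nat.Properties hiding (_≟_)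
  open import Data.Nat.Tactic.RingSolver using (solve-∀)
  open import Data.Vec.Base using (Vec; []; _∷_; head; map; zipWith; replicate)
  import Data.Vec.Properties as Vec
  open import Level using (0ℓ)

  -- `2≢0` is what `hits₂` rests on through `double≢0`: in characteristic two a random 0/1 vector is
  -- orthogonal to (1, 1, 1) with probability 1/2, and the bound 3/8 fails.
  record FiniteField : Set₁ where
    infixl 6 _⊕_
    infixl 7 _⊗_
    field
      F : Set
      _⊕_ _⊗_ : F → F → F
      ⊖_ : F → F
      0F 1F : F
      isCommutativeRing : IsCommutativeRing _≡_ _⊕_ _⊗_ ⊖_ 0F 1F
      finite : Finite F
      1<card : 1 < card finite
      inverse : ∀ a → a ≢ 0F → ∃ λ b → b ⊗ a ≡ 1F
      2≢0 : 1F ⊕ 1F ≢ 0F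

  module LinearAlgebra (field′ : FiniteField) where
    open FiniteField field′
    open Finite finite using (_≟_; once; sift)

    ring : CommutativeRing 0ℓ 0ℓ
    ring = record { isCommutativeRing = isCommutativeRing }

    module R = CommutativeRing ring
    module RP = RingProperties R.ring

    q : ℕ
    q = card finite

    finFⁿ : ∀ n → Finite (Vec F n)
    finFⁿ = finVec finite

    cube : ∀ n → Finite (Vec Bool n)
    cube = finVec finBool

    card-cube : ∀ n → card (cube n) ≡ 2 ^ n
    card-cube = card-Vec finBool

    infix 4 _≟ⱽ_
    _≟ⱽ_ : ∀ {n} (u v : Vec F n) → Dec (u ≡ v)
    _≟ⱽ_ = Vec.≡-dec _≟_

    infixl 6 _⊞_
    infixl 7 _·_

    _⊞_ : ∀ {n} → Vec F n → Vec F n → Vec F n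
    _⊞_ = zipWith _⊕_

    _·_ : ∀ {n} → F → Vec F n → Vec F n
    α · v = map (α ⊗_) v

    0V : ∀ {n} → Vec F n
    0V = replicate _ 0F

    dot : ∀ {n} → Vec F n → Vec F n → F
    dot [] [] = 0F
    dot (c ∷ cs) (u ∷ us) = c ⊗ u ⊕ dot cs us

    -- A Boolean vector selects summands, so `bdot S a` is literally a subset sum of the entries of
    -- `a`.
    bdot : ∀ {n} → Vec Bool n → Vec F n → F
    bdot [] [] = 0F
    bdot (false ∷ z) (c ∷ cs) = bdot z cs
    bdot (true ∷ z) (c ∷ cs) = c ⊕ bdot z cs

    eval : ∀ {K n} → Vec (Vec Bool K) n → Vec F K → Vec F n
    eval rows b = map (λ S → bdot S b) rows

    scaled : ∀ {K} → F → Vec Bool K → Vec F K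
    scaled c = map (λ s → if s then c else 0F)

    -- The transpose of `eval`: when `combo rows c` vanishes, `c` is a linear relation among the
    -- rows.
    combo : ∀ {K n} → Vec (Vec Bool K) n → Vec F n → Vec F K
    combo [] [] = 0V
    combo (S ∷ Ss) (c ∷ cs) = scaled c S ⊞ combo Ss cs

    dot-0ˡ : ∀ {n} (u : Vec F n) → dot 0V u ≡ 0F
    dot-0ˡ [] = refl
    dot-0ˡ (u ∷ us) = trans (cong₂ _⊕_ (R.zeroˡ u) (dot-0ˡ us)) (R.+-identityˡ 0F)

    dot-0ʳ : ∀ {n} (u : Vec F n) → dot u 0V ≡ 0F
    dot-0ʳ [] = refl
    dot-0ʳ (u ∷ us) = trans (cong₂ _⊕_ (R.zeroʳ u) (dot-0ʳ us)) (R.+-identityˡ 0F)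

    dot-comm : ∀ {n} (u v : Vec F n) → dot u v ≡ dot v u
    dot-comm [] [] = refl
    dot-comm (u ∷ us) (v ∷ vs) = cong₂ _⊕_ (R.*-comm u v) (dot-comm us vs)

    interchange : ∀ a b c d → (a ⊕ b) ⊕ (c ⊕ d) ≡ (a ⊕ c) ⊕ (b ⊕ d)
    interchange a b c d = trans (R.+-assoc a b (c ⊕ d))
      (trans (cong (a ⊕_) (trans (sym (R.+-assoc b c d)) (trans (cong (_⊕ d) (R.+-comm b c)) (R.+-assoc c b d))))
        (sym (R.+-assoc a c (b ⊕ d))))

    dot-+ˡ : ∀ {n} (u v w : Vec F n) → dot (u ⊞ v) w ≡ dot u w ⊕ dot v w
    dot-+ˡ [] [] [] = sym (R.+-identityˡ 0F)
    dot-+ˡ (u ∷ us) (v ∷ vs) (w ∷ ws) =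
      trans (cong₂ _⊕_ (R.distribʳ w u v) (dot-+ˡ us vs ws)) (interchange (u ⊗ w) (v ⊗ w) _ _)

    dot-scaled : ∀ {n} c (S : Vec Bool n) b → dot (scaled c S) b ≡ c ⊗ bdot S b
    dot-scaled c [] [] = sym (R.zeroʳ c)
    dot-scaled c (false ∷ S) (b ∷ bs) =
      trans (cong₂ _⊕_ (R.zeroˡ b) (dot-scaled c S bs)) (R.+-identityˡ _)
    dot-scaled c (true ∷ S) (b ∷ bs) =
      trans (cong (c ⊗ b ⊕_) (dot-scaled c S bs)) (sym (R.distribˡ c b _))

    adjoint : ∀ {K n} (rows : Vec (Vec Bool K) n) c b → dot c (eval rows b) ≡ dot (combo rows c) b
    adjoint [] [] b = sym (dot-0ˡ b)
    adjoint (S ∷ rows) (c ∷ cs) b =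
      trans (cong₂ _⊕_ (sym (dot-scaled c S b)) (adjoint rows cs b))
            (sym (dot-+ˡ (scaled c S) (combo rows cs) b))

    cancelʳ : ∀ a b → (a ⊕ b) ⊕ ⊖ b ≡ a
    cancelʳ a b = trans (R.+-assoc a b (⊖ b)) (trans (cong (a ⊕_) (R.-‿inverseʳ b)) (R.+-identityʳ a))

    cancelʳ′ : ∀ a b → (a ⊕ ⊖ b) ⊕ b ≡ a
    cancelʳ′ a b = trans (R.+-assoc a (⊖ b) b) (trans (cong (a ⊕_) (R.-‿inverseˡ b)) (R.+-identityʳ a))

    sum≡0⇒neg : ∀ {a b} → a ⊕ b ≡ 0F → a ≡ ⊖ b
    sum≡0⇒neg {a} {b} eq = trans (sym (cancelʳ a b)) (trans (cong (_⊕ ⊖ b) eq) (R.+-identityˡ _))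

    zeros : ∀ {n} → Vec F n → ℕ
    zeros {n} u = sum (finFⁿ n) (λ c → 𝟙 (dot c u ≟ 0F))

    zeros-affine : ∀ {u} → u ≢ 0F → ∀ s → sum finite (λ c → 𝟙 (c ⊗ u ⊕ s ≟ 0F)) ≡ 1
    zeros-affine {u} u≢0 s with inverse u u≢0
    ... | v , vu≡1 = trans
      (∑-cong (Finite.elems finite) λ c → 𝟙-⇔ (c ⊗ u ⊕ s ≟ 0F) (c ≟ (⊖ s) ⊗ v) (to c) (from c))
      (once ((⊖ s) ⊗ v))
      where
      to : ∀ c → c ⊗ u ⊕ s ≡ 0F → c ≡ (⊖ s) ⊗ v
      to c eq = trans (sym (R.*-identityʳ c)) (trans (cong (c ⊗_) (sym (trans (R.*-comm u v) vu≡1)))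
        (trans (sym (R.*-assoc c u v)) (cong (_⊗ v) (sum≡0⇒neg eq))))
      from : ∀ c → c ≡ (⊖ s) ⊗ v → c ⊗ u ⊕ s ≡ 0F
      from c refl = trans (cong (_⊕ s) (trans (R.*-assoc (⊖ s) v u)
        (trans (cong ((⊖ s) ⊗_) vu≡1) (R.*-identityʳ _)))) (R.-‿inverseˡ s)

    zeros-0 : ∀ n → zeros (0V {n}) ≡ q ^ n
    zeros-0 n = trans (∑-cong (Finite.elems (finFⁿ n)) (λ c → 𝟙-yes (dot c 0V ≟ 0F) (dot-0ʳ c))) (card-Vec finite n)

    zeros-≢0 : ∀ {n} (u : Vec F n) → u ≢ 0V → q * zeros u ≡ q ^ n
    zeros-≢0 [] u≢0 = contradiction refl u≢0
    zeros-≢0 {suc n} (u ∷ us) u≢0 with u ≟ 0F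
    ... | no u≢0F = cong (q *_) (trans (sum-vec finite n _)
      (trans (∑-swap (Finite.elems finite) (Finite.elems (finFⁿ n)) _)
      (trans (∑-cong (Finite.elems (finFⁿ n)) (λ c → zeros-affine u≢0F (dot c us)))
             (card-Vec finite n))))
    ... | yes refl = cong (q *_) (trans (sum-vec finite n _)
      (trans (∑-cong (Finite.elems finite) (λ c → ∑-cong (Finite.elems (finFⁿ n)) (λ cs →
        cong (λ t → 𝟙 (t ≟ 0F)) (trans (cong (_⊕ dot cs us) (R.zeroʳ c)) (R.+-identityˡ _)))))
      (trans (∑-const (Finite.elems finite) (zeros us))
             (zeros-≢0 us (λ us≡0 → u≢0 (cong (0F ∷_) us≡0))))))

    -- A nonzero `u` is orthogonal to one vector in `q`, the zero vector to all of them. Both cases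
    -- are merged into one identity, arranged without subtraction so that it can be summed in ℕ.
    zeros-count : ∀ {n} (u : Vec F n) →
                  q * zeros u + q ^ n * 𝟙 (u ≟ⱽ 0V) ≡ q ^ n + q ^ n * q * 𝟙 (u ≟ⱽ 0V)
    zeros-count {n} u with u ≟ⱽ 0V
    ... | yes refl = trans (cong (λ z → q * z + q ^ n * 1) (zeros-0 n)) (eq q (q ^ n))
      where
      eq : ∀ a b → a * b + b * 1 ≡ b + b * a * 1
      eq = solve-∀
    ... | no u≢0 = cong₂ _+_ (zeros-≢0 u u≢0) (trans (*-zeroʳ (q ^ n)) (sym (*-zeroʳ (q ^ n * q))))

    incidences : ∀ {A : Set} (fin : Finite A) {n} (f : A → Vec F n) →
      let N = sum fin (λ a → 𝟙 (f a ≟ⱽ 0V)) in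
      q * sum fin (λ a → zeros (f a)) + q ^ n * N ≡ q ^ n * card fin + q ^ n * q * N
    incidences fin {n} f = begin
      q * ∑ as (λ a → zeros (f a)) + q ^ n * ∑ as N
        ≡⟨ cong₂ _+_ (∑-*ˡ as q _) (∑-*ˡ as (q ^ n) N) ⟨
      ∑ as (λ a → q * zeros (f a)) + ∑ as (λ a → q ^ n * N a)
        ≡⟨ ∑-+ as _ _ ⟨
      ∑ as (λ a → q * zeros (f a) + q ^ n * N a)
        ≡⟨ ∑-cong as (λ a → zeros-count (f a)) ⟩
      ∑ as (λ a → q ^ n + q ^ n * q * N a)
        ≡⟨ ∑-+ as _ _ ⟩
      ∑ as (λ a → q ^ n) + ∑ as (λ a → q ^ n * q * N a)
        ≡⟨ cong₂ _+_ (trans (∑-const as (q ^ n)) (*-comm (card fin) (q ^ n))) (∑-*ˡ as (q ^ n * q) N) ⟩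
      q ^ n * card fin + q ^ n * q * ∑ as N ∎
      where
      open ≡-Reasoning
      as = Finite.elems fin
      N = λ a → 𝟙 (f a ≟ⱽ 0V)

    -- Counts the pairs (b , c) with c · (rows b) = 0 once by b and once by c.
    rank-nullity : ∀ {K n} (rows : Vec (Vec Bool K) n) →
      q ^ n * sum (finFⁿ K) (λ b → 𝟙 (eval rows b ≟ⱽ 0V)) ≡
      q ^ K * sum (finFⁿ n) (λ c → 𝟙 (combo rows c ≟ⱽ 0V))
    rank-nullity {K} {n} rows = cancel 1<card (+-cancelˡ-≡ (T + q ^ n * q ^ K) _ _ (begin
      (T + x * y) + (q * s + d) ≡⟨ a₁ T x y (q * s) d ⟩
      (x * y + q * s) + (T + d) ≡⟨ cong (_+ (T + d)) (sym (trans byB (cong (x * y +_) (a₀ x q S)))) ⟩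
      (T + s) + (T + d) ≡⟨ cong ((T + s) +_) (trans byC (cong₂ _+_ (*-comm y x) (a₀ y q Dn))) ⟩
      (T + s) + (x * y + q * d) ≡⟨ a₂ T s (x * y) (q * d) ⟩
      (T + x * y) + (q * d + s) ∎))
      where
      open ≡-Reasoning
      bs = Finite.elems (finFⁿ K)
      cs = Finite.elems (finFⁿ n)
      x = q ^ n
      y = q ^ K
      S = sum (finFⁿ K) (λ b → 𝟙 (eval rows b ≟ⱽ 0V))
      Dn = sum (finFⁿ n) (λ c → 𝟙 (combo rows c ≟ⱽ 0V))
      s = x * S
      d = y * Dn
      T = q * ∑ bs (λ b → zeros (eval rows b))
      a₀ : ∀ x q S → x * q * S ≡ q * (x * S)
      a₀ = solve-∀
      a₁ : ∀ T x y q d → (T + x * y) + (q + d) ≡ (x * y + q) + (T + d)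
      a₁ = solve-∀
      a₂ : ∀ T s z w → (T + s) + (z + w) ≡ (T + z) + (w + s)
      a₂ = solve-∀
      byB : T + s ≡ x * y + x * q * S
      byB = trans (incidences (finFⁿ K) (eval rows))
                  (cong (λ t → x * t + x * q * S) (card-Vec finite K))
      T≡ : T ≡ q * ∑ cs (λ c → zeros (combo rows c))
      T≡ = cong (q *_) (trans (∑-swap bs cs _)
        (∑-cong cs (λ c → ∑-cong bs (λ b →
          cong (λ t → 𝟙 (t ≟ 0F)) (trans (adjoint rows c b) (dot-comm (combo rows c) b))))))
      byC : T + d ≡ y * x + y * q * Dn
      byC = trans (cong (_+ d) T≡) (trans (incidences (finFⁿ n) (combo rows))
                  (cong (λ t → y * t + y * q * Dn) (card-Vec finite n)))
      cancel : ∀ {q} → 1 < q → q * s + d ≡ q * d + s → s ≡ d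
      cancel {suc zero} (s≤s ()) _
      cancel {suc (suc m)} _ eq = *-cancelˡ-≡ s d (suc m) (+-cancelˡ-≡ (s + d) _ _
        (trans (a₃ s d m) (trans eq (a₄ s d m))))
        where
        a₃ : ∀ s d m → (s + d) + suc m * s ≡ suc (suc m) * s + d
        a₃ = solve-∀
        a₄ : ∀ s d m → suc (suc m) * d + s ≡ (s + d) + suc m * d
        a₄ = solve-∀

    size : ∀ {n} {P : Vec F n → Set} → (∀ c → Dec (P c)) → ℕ
    size {n} P? = sum (finFⁿ n) (λ c → 𝟙 (P? c))

    size-cong : ∀ {n} {P Q : Vec F n → Set} (P? : ∀ c → Dec (P c)) (Q? : ∀ c → Dec (Q c)) →
                (∀ {c} → P c → Q c) → (∀ {c} → Q c → P c) → size P? ≡ size Q?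
    size-cong {n} P? Q? f g = ∑-cong (Finite.elems (finFⁿ n)) (λ c → 𝟙-⇔ (P? c) (Q? c) f g)

    -- Dimension is replaced by the number of elements: no basis is ever chosen, and `∣∣-power`
    -- shows that this number is a power of `q`.
    record Subspace (n : ℕ) : Set₁ where
      field
        Mem : Vec F n → Set
        mem? : ∀ c → Dec (Mem c)
        zero∈ : Mem 0V
        closed : ∀ α {c c′} → Mem c → Mem c′ → Mem (α · c ⊞ c′)

      dimCount : ℕ
      dimCount = size mem?

    open Subspace

    ∣_∣ : ∀ {n} → Subspace n → ℕ
    ∣ D ∣ = dimCount D

    record Form (n : ℕ) : Set where
      field
        fun : Vec F n → F
        linear : ∀ α c c′ → fun (α · c ⊞ c′) ≡ α ⊗ fun c ⊕ fun c′
        fun-0 : fun 0V ≡ 0F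

    open Form

    ker : ∀ {n} → Subspace n → Form n → Subspace n
    ker D ℓ = record
      { Mem = λ c → Mem D c × fun ℓ c ≡ 0F
      ; mem? = λ c → mem? D c ×-dec (fun ℓ c ≟ 0F)
      ; zero∈ = zero∈ D , fun-0 ℓ
      ; closed = λ α (d , e) (d′ , e′) → closed D α d d′ ,
          trans (linear ℓ α _ _) (trans (cong₂ _⊕_ (trans (cong (α ⊗_) e) (R.zeroʳ α)) e′) (R.+-identityˡ 0F))
      }

    ∣ker∣ : ∀ {n} (D : Subspace n) ℓ → (∀ {c} → Mem D c → fun ℓ c ≡ 0F) → ∣ ker D ℓ ∣ ≡ ∣ D ∣
    ∣ker∣ D ℓ h = size-cong (mem? (ker D ℓ)) (mem? D) proj₁ (λ d → d , h d)

    shift-inverse : ∀ {n} {α β} → α ⊕ β ≡ 0F → (u c : Vec F n) → α · u ⊞ (β · u ⊞ c) ≡ c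
    shift-inverse _ [] [] = refl
    shift-inverse {α = α} {β} eq (u ∷ us) (c ∷ cs) = cong₂ _∷_
      (trans (sym (R.+-assoc (α ⊗ u) (β ⊗ u) c))
        (trans (cong (_⊕ c) (trans (sym (R.distribʳ u α β)) (trans (cong (_⊗ u) eq) (R.zeroˡ u)))) (R.+-identityˡ c)))
      (shift-inverse eq us cs)

    -- Translation by `α · u` carries the kernel onto the part of `D` where `ℓ` takes the value `α`,
    -- so all `q` level sets have the same size.
    ∣ker∣-unit : ∀ {n} (D : Subspace n) ℓ {u} → Mem D u → fun ℓ u ≡ 1F → ∣ D ∣ ≡ q * ∣ ker D ℓ ∣
    ∣ker∣-unit {n} D ℓ {u} u∈ ℓu≡1 = begin
      ∑ cs (λ c → 𝟙 (mem? D c))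
        ≡⟨ ∑-cong cs (λ c → trans (sym (*-identityʳ _)) (cong (𝟙 (mem? D c) *_) (sym (fibre c)))) ⟩
      ∑ cs (λ c → 𝟙 (mem? D c) * ∑ as (λ α → 𝟙 (fun ℓ c ≟ α)))
        ≡⟨ ∑-cong cs (λ c → trans (sym (∑-*ˡ as (𝟙 (mem? D c)) _))
             (∑-cong as (λ α → sym (𝟙-× (mem? D c) (fun ℓ c ≟ α))))) ⟩
      ∑ cs (λ c → ∑ as (λ α → 𝟙 (mem? D c ×-dec (fun ℓ c ≟ α))))
        ≡⟨ ∑-swap cs as _ ⟩
      ∑ as (λ α → ∑ cs (λ c → 𝟙 (mem? D c ×-dec (fun ℓ c ≟ α))))
        ≡⟨ ∑-cong as translate ⟩
      ∑ as (λ α → ∣ ker D ℓ ∣)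
        ≡⟨ ∑-const as ∣ ker D ℓ ∣ ⟩
      q * ∣ ker D ℓ ∣ ∎
      where
      open ≡-Reasoning
      cs = Finite.elems (finFⁿ n)
      as = Finite.elems finite
      fibre : ∀ c → ∑ as (λ α → 𝟙 (fun ℓ c ≟ α)) ≡ 1
      fibre c = trans (∑-cong as (λ α → 𝟙-⇔ (fun ℓ c ≟ α) (α ≟ fun ℓ c) sym sym)) (once (fun ℓ c))
      translate : ∀ α → ∑ cs (λ c → 𝟙 (mem? D c ×-dec (fun ℓ c ≟ α))) ≡ ∣ ker D ℓ ∣
      translate α = trans
        (sym (reindex (finFⁿ n) (finFⁿ n) (λ c → α · u ⊞ c) (λ c → (⊖ α) · u ⊞ c)
          (shift-inverse (R.-‿inverseˡ α) u) (shift-inverse (R.-‿inverseʳ α) u) _))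
        (∑-cong cs (λ c → 𝟙-⇔ (mem? D (α · u ⊞ c) ×-dec (fun ℓ (α · u ⊞ c) ≟ α)) (mem? (ker D ℓ) c)
          (λ (d , e) → subst (Mem D) (shift-inverse (R.-‿inverseˡ α) u c) (closed D (⊖ α) u∈ d)
                     , RP.+-cancelˡ α _ _ (trans (sym (value c)) (trans e (sym (R.+-identityʳ α)))))
          (λ (d , e) → closed D α u∈ d , trans (value c) (trans (cong (α ⊕_) e) (R.+-identityʳ α)))))
        where
        value : ∀ c → fun ℓ (α · u ⊞ c) ≡ α ⊕ fun ℓ c
        value c = trans (linear ℓ α u c) (cong (_⊕ fun ℓ c) (trans (cong (α ⊗_) ℓu≡1) (R.*-identityʳ α)))

    -- A form that is not zero on `D` can be rescaled to take the value 1 there. This dichotomy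
    -- drives every induction on dimension below.
    vanishes⊎onto : ∀ {n} (D : Subspace n) ℓ →
      (∀ {c} → Mem D c → fun ℓ c ≡ 0F) ⊎
      ((∃ λ u → Mem D u × fun ℓ u ≢ 0F) × ∣ D ∣ ≡ q * ∣ ker D ℓ ∣)
    vanishes⊎onto {n} D ℓ with Finite.∃⊎∀ (finFⁿ n) (λ c → mem? D c ×-dec ¬? (fun ℓ c ≟ 0F))
    ... | inj₂ none = inj₁ λ {c} d → decidable-stable (fun ℓ c ≟ 0F) (λ ≢0 → none c (d , ≢0))
    ... | inj₁ (u , d , ≢0) with inverse (fun ℓ u) ≢0
    ... | v , vℓ≡1 = inj₂ ((u , d , ≢0) , ∣ker∣-unit D ℓ (closed D v d (zero∈ D))
        (trans (linear ℓ v u 0V) (trans (cong₂ _⊕_ vℓ≡1 (fun-0 ℓ)) (R.+-identityʳ 1F))))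

    headForm : ∀ {n} → Form (suc n)
    headForm = record { fun = head ; linear = λ { α (c ∷ _) (c′ ∷ _) → refl } ; fun-0 = refl }

    bdot-linear : ∀ {n} (z : Vec Bool n) α c c′ → bdot z (α · c ⊞ c′) ≡ α ⊗ bdot z c ⊕ bdot z c′
    bdot-linear [] α [] [] = sym (trans (cong (_⊕ 0F) (R.zeroʳ α)) (R.+-identityˡ 0F))
    bdot-linear (false ∷ z) α (c ∷ cs) (c′ ∷ cs′) = bdot-linear z α cs cs′
    bdot-linear (true ∷ z) α (c ∷ cs) (c′ ∷ cs′) =
      trans (cong (α ⊗ c ⊕ c′ ⊕_) (bdot-linear z α cs cs′))
        (trans (interchange (α ⊗ c) c′ (α ⊗ bdot z cs) (bdot z cs′)) (cong (_⊕ (c′ ⊕ bdot z cs′)) (sym (R.distribˡ α c _))))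

    bdot-0 : ∀ {n} (z : Vec Bool n) → bdot z 0V ≡ 0F
    bdot-0 [] = refl
    bdot-0 (false ∷ z) = bdot-0 z
    bdot-0 (true ∷ z) = trans (R.+-identityˡ _) (bdot-0 z)

    column : ∀ {n} → Vec Bool n → Form n
    column z = record { fun = bdot z ; linear = bdot-linear z ; fun-0 = bdot-0 z }

    -- The slice with first coordinate 0, without that coordinate, so that inductions can run over
    -- the number of coordinates.
    restrict : ∀ {n} → Subspace (suc n) → Subspace n
    restrict D = record
      { Mem = λ c → Mem D (0F ∷ c)
      ; mem? = λ c → mem? D (0F ∷ c)
      ; zero∈ = zero∈ D
      ; closed = λ α d d′ → subst (λ t → Mem D (t ∷ _)) (trans (R.+-identityʳ _) (R.zeroʳ α)) (closed D α d d′)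
      }

    ∣restrict∣ : ∀ {n} (D : Subspace (suc n)) → ∣ ker D headForm ∣ ≡ ∣ restrict D ∣
    ∣restrict∣ {n} D = trans (sum-vec finite n _)
      (trans (∑-cong as (λ a → trans (∑-cong cs (λ c → pull a c)) (∑-*ˡ cs (𝟙 (a ≟ 0F)) _)))
             (sift 0F (λ a → ∑ cs (λ c → 𝟙 (mem? D (a ∷ c))))))
      where
      cs = Finite.elems (finFⁿ n)
      as = Finite.elems finite
      pull : ∀ a c → 𝟙 (mem? D (a ∷ c) ×-dec (a ≟ 0F)) ≡ 𝟙 (a ≟ 0F) * 𝟙 (mem? D (a ∷ c))
      pull a c = trans (𝟙-× (mem? D (a ∷ c)) (a ≟ 0F)) (*-comm (𝟙 (mem? D (a ∷ c))) _)

    ∣∣-power : ∀ {n} (D : Subspace n) → ∃ λ e → e ≤ n × ∣ D ∣ ≡ q ^ e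
    ∣∣-power {zero} D = 0 , z≤n , trans (+-identityʳ _) (𝟙-yes (mem? D []) (zero∈ D))
    ∣∣-power {suc n} D with ∣∣-power (restrict D) | vanishes⊎onto D headForm
    ... | e , e≤n , eq | inj₁ h = e , m≤n⇒m≤1+n e≤n , trans (trans (sym (∣ker∣ D headForm h)) (∣restrict∣ D)) eq
    ... | e , e≤n , eq | inj₂ (_ , h) = suc e , s≤s e≤n , trans h (cong (q *_) (trans (∣restrict∣ D) eq))

    -- Littlewood-Offord bounds for 0/1 vectors.

    sum-cube : ∀ n f → sum (cube (suc n)) f ≡ sum (cube n) (λ z → f (false ∷ z)) + sum (cube n) (λ z → f (true ∷ z))
    sum-cube n f = trans (sum-vec finBool n f) (cong (sum (cube n) (λ z → f (false ∷ z)) +_) (+-identityʳ _))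

    sum-cube≤ : ∀ n f → (∀ z → f z ≤ 1) → sum (cube n) f ≤ 2 ^ n
    sum-cube≤ n f h = ≤-trans (∑-mono (Finite.elems (cube n)) h) (≤-reflexive (card-cube n))

    nonzeros : ∀ {n} → Vec F n → ℕ
    nonzeros [] = 0
    nonzeros (c ∷ cs) with c ≟ 0F
    ... | yes _ = nonzeros cs
    ... | no _ = suc (nonzeros cs)

    -- The Littlewood-Offord count: 2^n times the probability that a random subset sum of `c` equals
    -- `v`.
    hits : ∀ {n} → F → Vec F n → ℕ
    hits {n} v c = sum (cube n) (λ z → 𝟙 (bdot z c ≟ v))

    hits-∷ : ∀ {n} v c (cs : Vec F n) → hits v (c ∷ cs) ≡ hits v cs + hits (v ⊕ ⊖ c) cs
    hits-∷ {n} v c cs = trans (sum-cube n _) (cong (hits v cs +_)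
      (∑-cong (Finite.elems (cube n)) (λ z → 𝟙-⇔ (c ⊕ bdot z cs ≟ v) (bdot z cs ≟ v ⊕ ⊖ c)
        (λ eq → trans (sym (cancelʳ _ c)) (cong (_⊕ ⊖ c) (trans (R.+-comm _ c) eq)))
        (λ eq → trans (R.+-comm c _) (trans (cong (_⊕ c) eq) (cancelʳ′ v c))))))

    hits-0∷ : ∀ {n} v (cs : Vec F n) → hits v (0F ∷ cs) ≡ 2 * hits v cs
    hits-0∷ v cs = trans (hits-∷ v 0F cs) (cong (hits v cs +_)
      (trans (cong (λ w → hits w cs) (trans (cong (v ⊕_) RP.-0#≈0#) (R.+-identityʳ v))) (sym (+-identityʳ _))))

    hits-two : ∀ {n} {v w} → v ≢ w → (c : Vec F n) → hits v c + hits w c ≤ 2 ^ n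
    hits-two {n} {v} {w} v≢w c = ≤-trans (≤-reflexive (sym (∑-+ (Finite.elems (cube n)) _ _)))
      (sum-cube≤ n _ (λ z → bound (bdot z c)))
      where
      bound : ∀ t → 𝟙 (t ≟ v) + 𝟙 (t ≟ w) ≤ 1
      bound t with t ≟ v
      ... | no _ = 𝟙≤1 (t ≟ w)
      ... | yes refl = ≤-reflexive (cong suc (𝟙-no (t ≟ w) v≢w))

    hits-three : ∀ {n} {u v w} → u ≢ v → u ≢ w → v ≢ w → (c : Vec F n) →
                 hits u c + (hits v c + hits w c) ≤ 2 ^ n
    hits-three {n} {u} {v} {w} u≢v u≢w v≢w c = ≤-trans
      (≤-reflexive (sym (trans (∑-+ zs _ _) (cong (hits u c +_) (∑-+ zs _ _)))))
      (sum-cube≤ n _ (λ z → bound (bdot z c)))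
      where
      zs = Finite.elems (cube n)
      bound : ∀ t → 𝟙 (t ≟ u) + (𝟙 (t ≟ v) + 𝟙 (t ≟ w)) ≤ 1
      bound t with t ≟ u
      ... | yes refl = ≤-reflexive (cong suc (cong₂ _+_ (𝟙-no (t ≟ v) u≢v) (𝟙-no (t ≟ w) u≢w)))
      ... | no _ with t ≟ v
      ... | no _ = 𝟙≤1 (t ≟ w)
      ... | yes refl = ≤-reflexive (cong suc (𝟙-no (t ≟ w) v≢w))

    ≢-shift : ∀ {c} → c ≢ 0F → ∀ v → v ≢ v ⊕ ⊖ c
    ≢-shift {c} c≢0 v eq = c≢0 (trans (sym (RP.-‿involutive c))
      (trans (cong ⊖_ (RP.+-cancelˡ v _ _ (trans (sym eq) (sym (R.+-identityʳ v))))) RP.-0#≈0#))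

    double≢0 : ∀ {c} → c ≢ 0F → c ⊕ c ≢ 0F
    double≢0 {c} c≢0 eq with inverse c c≢0
    ... | v , vc≡1 = 2≢0 (trans (cong₂ _⊕_ (sym vc≡1) (sym vc≡1))
      (trans (sym (R.distribˡ v c c)) (trans (cong (v ⊗_) eq) (R.zeroʳ v))))

    hits₁ : ∀ {n} v (c : Vec F n) → 1 ≤ nonzeros c → 2 * hits v c ≤ 2 ^ n
    hits₁ v (c ∷ cs) h with c ≟ 0F
    ... | yes refl = ≤-trans (*-monoʳ-≤ 2 (≤-reflexive (hits-0∷ v cs))) (*-monoʳ-≤ 2 (hits₁ v cs h))
    ... | no c≢0 = *-monoʳ-≤ 2 (≤-trans (≤-reflexive (hits-∷ v c cs)) (hits-two (≢-shift c≢0 v) cs))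

    -- Splitting off a nonzero entry c leaves the values v, w, v − c, w − c; since 2c ≠ 0,
    -- at least three of them are distinct.
    hits₂ : ∀ {n} {v w} → v ≢ w → (c : Vec F n) → 2 ≤ nonzeros c → 4 * (hits v c + hits w c) ≤ 3 * 2 ^ n
    hits₂ {suc n} {v} {w} v≢w (c ∷ cs) h with c ≟ 0F
    ... | yes refl = begin
      4 * (hits v (0F ∷ cs) + hits w (0F ∷ cs)) ≡⟨ cong (4 *_) (cong₂ _+_ (hits-0∷ v cs) (hits-0∷ w cs)) ⟩
      4 * (2 * hits v cs + 2 * hits w cs) ≡⟨ eq (hits v cs) (hits w cs) ⟩
      2 * (4 * (hits v cs + hits w cs)) ≤⟨ *-monoʳ-≤ 2 (hits₂ v≢w cs h) ⟩
      2 * (3 * 2 ^ n) ≡⟨ eq′ (2 ^ n) ⟩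
      3 * 2 ^ suc n ∎
      where
      open ≤-Reasoning
      eq : ∀ a b → 4 * (2 * a + 2 * b) ≡ 2 * (4 * (a + b))
      eq = solve-∀
      eq′ : ∀ a → 2 * (3 * a) ≡ 3 * (2 * a)
      eq′ = solve-∀
    ... | no c≢0 = begin
      4 * (hits v (c ∷ cs) + hits w (c ∷ cs)) ≡⟨ cong (4 *_) (cong₂ _+_ (hits-∷ v c cs) (hits-∷ w c cs)) ⟩
      4 * ((a + a′) + (b + b′)) ≤⟨ four ⟩
      4 * 2 ^ n + 2 * 2 ^ n ≡⟨ eq (2 ^ n) ⟩
      3 * 2 ^ suc n ∎
      where
      open ≤-Reasoning
      v′ = v ⊕ ⊖ c
      w′ = w ⊕ ⊖ c
      a = hits v cs
      a′ = hits v′ cs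
      b = hits w cs
      b′ = hits w′ cs
      eq : ∀ t → 4 * t + 2 * t ≡ 3 * (2 * t)
      eq = solve-∀
      eq₁ : ∀ a a′ b b′ → 4 * ((a + a′) + (b + b′)) ≡ 4 * (a + (b + a′)) + 2 * (2 * b′)
      eq₁ = solve-∀
      eq₂ : ∀ a a′ b b′ → 4 * ((a + a′) + (b + b′)) ≡ 4 * (a + (b + b′)) + 2 * (2 * a′)
      eq₂ = solve-∀
      1≤nz : 1 ≤ nonzeros cs
      1≤nz = s≤s⁻¹ h
      four : 4 * ((a + a′) + (b + b′)) ≤ 4 * 2 ^ n + 2 * 2 ^ n
      four with w ≟ v′
      ... | no w≢v′ = ≤-trans (≤-reflexive (eq₁ a a′ b b′))
        (+-mono-≤ (*-monoʳ-≤ 4 (hits-three v≢w (≢-shift c≢0 v) w≢v′ cs)) (*-monoʳ-≤ 2 (hits₁ w′ cs 1≤nz)))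
      ... | yes w≡v′ = ≤-trans (≤-reflexive (eq₂ a a′ b b′))
        (+-mono-≤ (*-monoʳ-≤ 4 (hits-three v≢w v≢w′ (≢-shift c≢0 w) cs)) (*-monoʳ-≤ 2 (hits₁ v′ cs 1≤nz)))
        where
        v≢w′ : v ≢ w′
        v≢w′ v≡w′ = ≢-shift (double≢0 c≢0) v (trans v≡w′ (trans (cong (_⊕ ⊖ c) w≡v′)
          (trans (R.+-assoc v _ _) (cong (v ⊕_) (RP.-‿+-comm c c)))))

    -- Splitting off one nonzero entry leaves the two distinct targets of `hits₂`. The bound 3/8 is
    -- attained at (1, 1, 1); its gain over the 1/2 of `hits₁` becomes the factor (3/4)^K.
    hits₃ : ∀ {n} v (c : Vec F n) → 3 ≤ nonzeros c → 8 * hits v c ≤ 3 * 2 ^ n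
    hits₃ {suc n} v (c ∷ cs) h with c ≟ 0F
    ... | yes refl = ≤-trans (≤-reflexive (trans (cong (8 *_) (hits-0∷ v cs)) (eq (hits v cs))))
        (≤-trans (*-monoʳ-≤ 2 (hits₃ v cs h)) (≤-reflexive (eq′ (2 ^ n))))
      where
      eq : ∀ a → 8 * (2 * a) ≡ 2 * (8 * a)
      eq = solve-∀
      eq′ : ∀ a → 2 * (3 * a) ≡ 3 * (2 * a)
      eq′ = solve-∀
    ... | no c≢0 = ≤-trans (≤-reflexive (trans (cong (8 *_) (hits-∷ v c cs)) (eq (hits v cs + hits (v ⊕ ⊖ c) cs))))
        (≤-trans (*-monoʳ-≤ 2 (hits₂ (≢-shift c≢0 v) cs (s≤s⁻¹ h))) (≤-reflexive (eq′ (2 ^ n))))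
      where
      eq : ∀ a → 8 * a ≡ 2 * (4 * a)
      eq = solve-∀
      eq′ : ∀ a → 2 * (3 * a) ≡ 3 * (2 * a)
      eq′ = solve-∀

-- Odlyzko-type bounds on 0/1 vectors in a subspace.

module Counting where

  open FiniteSums
  open LinAlg
  open import Data.Bool.Base using (Bool; true; false)
  open import Data.Fin.Base using (Fin; toℕ; fromℕ<)
  import Data.Fin.Properties as Fin
  open import Data.List.Base using (List; []; _∷_; allFin)
  open import Data.List.Membership.Propositional using (_∈_)
  open import Data.List.Relation.Unary.Any using (here; there)
  open import Data.Nat.Base
  open import Data.Nat.Properties hiding (_≟_)
  import Data.Nat.Properties as ℕ
  open import Data.Nat.Tactic.RingSolver using (solve-∀)
  open import Data.Unit.Base using (⊤; tt)
  open import Data.Vec.Base using (Vec; []; _∷_; head; tail; zipWith)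

  ∑-tight : ∀ {A : Set} {xs : List A} {f g} → (∀ x → f x ≤ g x) → ∑ xs f ≡ ∑ xs g → ∀ {a} → a ∈ xs → f a ≡ g a
  ∑-tight {xs = x ∷ xs} {f} {g} h eq a∈ with m≤n⇒m<n∨m≡n (h x)
  ... | inj₁ fx<gx = contradiction eq (<⇒≢ (+-mono-<-≤ fx<gx (∑-mono xs h)))
  ... | inj₂ fx≡gx with a∈
  ... | here refl = fx≡gx
  ... | there a∈′ = ∑-tight h (+-cancelˡ-≡ (f x) _ _ (trans eq (cong (_+ ∑ xs g) (sym fx≡gx)))) a∈′

  ^-distribʳ-* : ∀ n a b → (a * b) ^ n ≡ a ^ n * b ^ n
  ^-distribʳ-* zero a b = refl
  ^-distribʳ-* (suc n) a b = trans (cong (a * b *_) (^-distribʳ-* n a b)) (eq a b (a ^ n) (b ^ n))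
    where
    eq : ∀ a b c d → a * b * (c * d) ≡ a * c * (b * d)
    eq = solve-∀

  -- A relation among the rows is a separate condition on each column, so matrices given by their
  -- rows have to be enumerated by columns.
  sum-columns : ∀ t n (f : Vec (Vec Bool (suc t)) n → ℕ) →
    sum (finVec (finVec finBool (suc t)) n) f ≡
    sum (finVec finBool n) (λ x → sum (finVec (finVec finBool t) n) (λ R → f (zipWith _∷_ x R)))
  sum-columns t zero f = sym (+-identityʳ _)
  sum-columns t (suc n) f = begin
    sum (finVec (finVec finBool (suc t)) (suc n)) f
      ≡⟨ sum-vec (finVec finBool (suc t)) n f ⟩
    sum (finVec finBool (suc t)) (λ r → sum (finVec (finVec finBool (suc t)) n) (λ R → f (r ∷ R)))
      ≡⟨ sum-vec finBool t _ ⟩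
    ∑ bs (λ b → ∑ rs (λ r → sum (finVec (finVec finBool (suc t)) n) (λ R → f ((b ∷ r) ∷ R))))
      ≡⟨ ∑-cong bs (λ b → ∑-cong rs (λ r → sum-columns t n (λ R → f ((b ∷ r) ∷ R)))) ⟩
    ∑ bs (λ b → ∑ rs (λ r → ∑ xs (λ x → ∑ Rs (λ R → f ((b ∷ r) ∷ zipWith _∷_ x R)))))
      ≡⟨ ∑-cong bs (λ b → ∑-swap rs xs (λ r x → ∑ Rs (λ R → f ((b ∷ r) ∷ zipWith _∷_ x R)))) ⟩
    ∑ bs (λ b → ∑ xs (λ x → ∑ rs (λ r → ∑ Rs (λ R → f (zipWith _∷_ (b ∷ x) (r ∷ R))))))
      ≡⟨ ∑-cong bs (λ b → ∑-cong xs (λ x → sum-vec (finVec finBool t) n (λ R → f (zipWith _∷_ (b ∷ x) R)))) ⟨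
    ∑ bs (λ b → ∑ xs (λ x → sum (finVec (finVec finBool t) (suc n)) (λ R → f (zipWith _∷_ (b ∷ x) R))))
      ≡⟨ sum-vec finBool n _ ⟨
    sum (finVec finBool (suc n)) (λ x → sum (finVec (finVec finBool t) (suc n)) (λ R → f (zipWith _∷_ x R))) ∎
    where
    open ≡-Reasoning
    bs = Finite.elems finBool
    rs = Finite.elems (finVec finBool t)
    xs = Finite.elems (finVec finBool n)
    Rs = Finite.elems (finVec (finVec finBool t) n)

  module RelationCounting (field′ : FiniteField) where
    open FiniteField field′
    open Finite finite using (_≟_)
    open LinearAlgebra field′
    open Subspace
    open Form

    instance
      q≢0 : NonZero q
      q≢0 = >-nonZero (<-trans z<s 1<card)

    Good : ∀ {n} → (Vec F n → Set) → Set
    Good P = ∀ c → P c → c ≢ 0V → 3 ≤ nonzeros c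

    good? : ∀ {n} {P : Vec F n → Set} → (∀ c → Dec (P c)) → Dec (Good P)
    good? {n} P? with Finite.∃⊎∀ (finFⁿ n) (λ c → P? c ×-dec ¬? (c ≟ⱽ 0V) ×-dec ¬? (3 ≤? nonzeros c))
    ... | inj₁ (c , Pc , c≢0 , few) = no λ good → few (good c Pc c≢0)
    ... | inj₂ none = yes λ c Pc c≢0 → decidable-stable (3 ≤? nonzeros c) (λ few → none c (Pc , c≢0 , few))

    nonzeros-0∷ : ∀ {n} (c : Vec F n) → nonzeros (0F ∷ c) ≡ nonzeros c
    nonzeros-0∷ c with 0F ≟ 0F
    ... | yes _ = refl
    ... | no ≢ = contradiction refl ≢

    _⊥_ : ∀ {n} → Vec Bool n → Subspace n → Set
    z ⊥ D = ∀ c → Mem D c → bdot z c ≡ 0F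

    module _ {n} {G : Vec Bool n → Set} (G? : ∀ z → Dec (G z)) where
      count : ℕ
      count = sum (cube n) (λ z → 𝟙 (G? z))

    -- Two vectors of `G` that differ only in the first bit would both annihilate a vector with
    -- nonzero first entry; so the tail determines that bit.
    count-determined : ∀ {n} {G : Vec Bool (suc n) → Set} (G? : ∀ z → Dec (G z)) (D : Subspace (suc n)) →
      (∀ {z} → G z → z ⊥ D) → (∃ λ u → Mem D u × head u ≢ 0F) →
      count G? ≤ count (λ z → G? (false ∷ z) ⊎-dec G? (true ∷ z))
    count-determined {n} {G} G? D perp (c ∷ cs , d , c≢0) = ≤-trans
      (≤-reflexive (trans (sum-cube n _) (sym (∑-+ (Finite.elems (cube n)) _ _))))
      (∑-mono (Finite.elems (cube n)) bound)
      where
      bound : ∀ z → 𝟙 (G? (false ∷ z)) + 𝟙 (G? (true ∷ z)) ≤ 𝟙 (G? (false ∷ z) ⊎-dec G? (true ∷ z))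
      bound z with G? (false ∷ z) | G? (true ∷ z)
      ... | yes f | yes t = contradiction
        (trans (sym (R.+-identityʳ c)) (trans (cong (c ⊕_) (sym (perp f (c ∷ cs) d))) (perp t (c ∷ cs) d))) c≢0
      ... | yes f | no _ = ≤-refl
      ... | no _ | yes t = ≤-refl
      ... | no _ | no _ = ≤-refl

    perp-restrict : ∀ {n} (D : Subspace (suc n)) b (z : Vec Bool n) → (b ∷ z) ⊥ D → z ⊥ restrict D
    perp-restrict D false z perp c d = perp (0F ∷ c) d
    perp-restrict D true z perp c d = trans (sym (R.+-identityˡ _)) (perp (0F ∷ c) d)

    ∣D∣≤1 : ∀ (D : Subspace 0) → ∣ D ∣ ≤ 1
    ∣D∣≤1 D = ≤-trans (≤-reflexive (+-identityʳ _)) (𝟙≤1 (mem? D []))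

    q^suc≰1 : ∀ e → ¬ (q ^ suc e ≤ 1)
    q^suc≰1 e h = <⇒≱ 1<card (≤-trans (m≤m*n q (q ^ e) {{m^n≢0 q e}}) h)

    -- Odlyzko's lemma: a subspace of codimension `e` contains at most 2^(n-e) of the 0/1 vectors.
    -- At each coordinate either `D` vanishes there and both bits are allowed, or the bit is
    -- determined by the later ones at the price of one dimension. `G` is an arbitrary predicate
    -- because the recursion replaces it by a union over the first bit.
    odlyzko : ∀ {n} (D : Subspace n) e {G : Vec Bool n → Set} (G? : ∀ z → Dec (G z)) →
              q ^ e ≤ ∣ D ∣ → (∀ {z} → G z → z ⊥ D) → 2 ^ e * count G? ≤ 2 ^ n
    odlyzko {n} D zero G? h perp = ≤-trans (≤-reflexive (+-identityʳ _)) (sum-cube≤ n _ (λ z → 𝟙≤1 (G? z)))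
    odlyzko {zero} D (suc e) G? h perp = contradiction (≤-trans h (∣D∣≤1 D)) (q^suc≰1 e)
    odlyzko {suc n} D (suc e) G? h perp with vanishes⊎onto D headForm
    ... | inj₁ van = ≤-trans
      (≤-reflexive (trans (cong (2 ^ suc e *_) (sum-cube n _)) (*-distribˡ-+ (2 ^ suc e) _ _)))
      (≤-trans (+-mono-≤ (half false) (half true)) (≤-reflexive (cong (2 ^ n +_) (sym (+-identityʳ _)))))
      where
      h′ : q ^ suc e ≤ ∣ restrict D ∣
      h′ = ≤-trans h (≤-reflexive (trans (sym (∣ker∣ D headForm van)) (∣restrict∣ D)))
      half : ∀ b → 2 ^ suc e * count (λ z → G? (b ∷ z)) ≤ 2 ^ n
      half b = odlyzko (restrict D) (suc e) (λ z → G? (b ∷ z)) h′ (λ {z} g → perp-restrict D b z (perp g))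
    ... | inj₂ (u , eq) = ≤-trans
      (*-monoʳ-≤ (2 ^ suc e) (count-determined G? D perp u))
      (≤-trans (≤-reflexive (*-assoc 2 (2 ^ e) _)) (*-monoʳ-≤ 2
        (odlyzko (restrict D) e (λ z → G? (false ∷ z) ⊎-dec G? (true ∷ z)) h′
          (λ {z} → [ (λ g → perp-restrict D false z (perp g)) , (λ g → perp-restrict D true z (perp g)) ]′))))
      where
      h′ : q ^ e ≤ ∣ restrict D ∣
      h′ = *-cancelˡ-≤ q (≤-trans h (≤-reflexive (trans eq (cong (q *_) (∣restrict∣ D)))))

    -- Runs as `odlyzko`, but at the last dimension there is a vector with at least three nonzero
    -- entries, and `hits₃` gives 3/8 in place of 1/2. Goodness passes to `restrict D` because a
    -- leading zero does not change the weight.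
    odlyzko-good : ∀ {n} (D : Subspace n) e {G : Vec Bool n → Set} (G? : ∀ z → Dec (G z)) →
                   q ^ suc e ≤ ∣ D ∣ → (∀ {z} → G z → z ⊥ D) → Good (Mem D) →
                   4 * (2 ^ suc e * count G?) ≤ 3 * 2 ^ n
    odlyzko-good {zero} D e G? h perp good = contradiction (≤-trans h (∣D∣≤1 D)) (q^suc≰1 e)
    odlyzko-good {suc n} D e G? h perp good with vanishes⊎onto D headForm
    ... | inj₁ van = begin
      4 * (2 ^ suc e * count G?) ≡⟨ cong (λ t → 4 * (2 ^ suc e * t)) (sum-cube n _) ⟩
      4 * (2 ^ suc e * (half false + half true)) ≡⟨ eq (2 ^ suc e) (half false) (half true) ⟩
      4 * (2 ^ suc e * half false) + 4 * (2 ^ suc e * half true)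
                                                       ≤⟨ +-mono-≤ (bound false) (bound true) ⟩
      3 * 2 ^ n + 3 * 2 ^ n ≡⟨ eq′ (2 ^ n) ⟩
      3 * 2 ^ suc n ∎
      where
      open ≤-Reasoning
      h′ : q ^ suc e ≤ ∣ restrict D ∣
      h′ = ≤-trans h (≤-reflexive (trans (sym (∣ker∣ D headForm van)) (∣restrict∣ D)))
      half : Bool → ℕ
      half b = count (λ z → G? (b ∷ z))
      good′ : Good (Mem (restrict D))
      good′ c d c≢0 = subst (3 ≤_) (nonzeros-0∷ c) (good (0F ∷ c) d (λ { refl → c≢0 refl }))
      bound : ∀ b → 4 * (2 ^ suc e * half b) ≤ 3 * 2 ^ n
      bound b = odlyzko-good (restrict D) e (λ z → G? (b ∷ z)) h′ (λ {z} g → perp-restrict D b z (perp g)) good′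
      eq : ∀ a b c → 4 * (a * (b + c)) ≡ 4 * (a * b) + 4 * (a * c)
      eq = solve-∀
      eq′ : ∀ a → 3 * a + 3 * a ≡ 3 * (2 * a)
      eq′ = solve-∀
    odlyzko-good {suc n} D zero G? h perp good | inj₂ ((u , d , u≢0) , _) = begin
      4 * (2 * count G?) ≡⟨ eq (count G?) ⟩
      8 * count G? ≤⟨ *-monoʳ-≤ 8 (∑-mono (Finite.elems (cube (suc n))) (λ z → 𝟙-mono (G? z) (bdot z u ≟ 0F) (λ g → perp g u d))) ⟩
      8 * hits 0F u ≤⟨ hits₃ 0F u (good u d (λ { refl → u≢0 refl })) ⟩
      3 * 2 ^ suc n ∎
      where
      open ≤-Reasoning
      eq : ∀ a → 4 * (2 * a) ≡ 8 * a
      eq = solve-∀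
    odlyzko-good {suc n} D (suc e) G? h perp good | inj₂ (u , eq) = begin
      4 * (2 ^ suc (suc e) * count G?) ≤⟨ *-monoʳ-≤ 4 (*-monoʳ-≤ (2 ^ suc (suc e)) (count-determined G? D perp u)) ⟩
      4 * (2 ^ suc (suc e) * C) ≡⟨ eq₁ (2 ^ suc e) C ⟩
      2 * (4 * (2 ^ suc e * C)) ≤⟨ *-monoʳ-≤ 2 (odlyzko-good (restrict D) e (λ z → G? (false ∷ z) ⊎-dec G? (true ∷ z)) h′
                                            (λ {z} → [ (λ g → perp-restrict D false z (perp g)) , (λ g → perp-restrict D true z (perp g)) ]′) good′) ⟩
      2 * (3 * 2 ^ n) ≡⟨ eq₂ (2 ^ n) ⟩
      3 * 2 ^ suc n ∎
      where
      open ≤-Reasoning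
      C = count (λ z → G? (false ∷ z) ⊎-dec G? (true ∷ z))
      h′ : q ^ suc e ≤ ∣ restrict D ∣
      h′ = *-cancelˡ-≤ q (≤-trans h (≤-reflexive (trans eq (cong (q *_) (∣restrict∣ D)))))
      good′ : Good (Mem (restrict D))
      good′ c d c≢0 = subst (3 ≤_) (nonzeros-0∷ c) (good (0F ∷ c) d (λ { refl → c≢0 refl }))
      eq₁ : ∀ a b → 4 * ((2 * a) * b) ≡ 2 * (4 * (a * b))
      eq₁ = solve-∀
      eq₂ : ∀ a → 2 * (3 * a) ≡ 3 * (2 * a)
      eq₂ = solve-∀

    combo-columns : ∀ {t n} (x : Vec Bool n) (R : Vec (Vec Bool t) n) c →
                    combo (zipWith _∷_ x R) c ≡ bdot x c ∷ combo R c
    combo-columns [] [] [] = refl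
    combo-columns (false ∷ x) (r ∷ R) (c ∷ cs) = trans (cong (scaled c (false ∷ r) ⊞_) (combo-columns x R cs))
      (cong (_∷ _) (R.+-identityˡ _))
    combo-columns (true ∷ x) (r ∷ R) (c ∷ cs) = cong (scaled c (true ∷ r) ⊞_) (combo-columns x R cs)

    -- Counting matrices with many relations, column by column.

    cut : ∀ {t n} → Subspace n → Vec (Vec Bool t) n → Vec F n → Set
    cut D R c = Mem D c × combo R c ≡ 0V

    cut? : ∀ {t n} (D : Subspace n) (R : Vec (Vec Bool t) n) c → Dec (cut D R c)
    cut? D R c = mem? D c ×-dec (combo R c ≟ⱽ 0V)

    module _ (e : ℕ) where
      -- `D` holds the relations that are still possible and `R` the columns still to come. The
      -- final dimension is prescribed exactly as `e + 1`, so that the cost of a column can be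
      -- measured against it.
      Event : ∀ {t n} → Subspace n → Vec (Vec Bool t) n → Set
      Event D R = Good (cut D R) × size (cut? D R) ≡ q ^ suc e

      event? : ∀ {t n} (D : Subspace n) (R : Vec (Vec Bool t) n) → Dec (Event D R)
      event? D R = good? (cut? D R) ×-dec (size (cut? D R) ℕ.≟ q ^ suc e)

      Φ : ∀ {n} → Subspace n → ℕ → ℕ
      Φ {n} D t = sum (finVec (cube t) n) (λ R → 𝟙 (event? D R))

      event-transport : ∀ {t t′ n} (D D′ : Subspace n) (R : Vec (Vec Bool t) n) (R′ : Vec (Vec Bool t′) n) →
        (∀ {c} → cut D R c → cut D′ R′ c) → (∀ {c} → cut D′ R′ c → cut D R c) →
        𝟙 (event? D R) ≡ 𝟙 (event? D′ R′)
      event-transport D D′ R R′ f g = 𝟙-⇔ (event? D R) (event? D′ R′)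
        (λ (h , s) → (λ c m → h c (g m)) , trans (sym eq) s)
        (λ (h , s) → (λ c m → h c (f m)) , trans eq s)
        where eq = size-cong (cut? D R) (cut? D′ R′) f g

      Φ-suc : ∀ {n} (D : Subspace n) t → Φ D (suc t) ≡ sum (cube n) (λ x → Φ (ker D (column x)) t)
      Φ-suc {n} D t = trans (sum-columns t n _)
        (∑-cong (Finite.elems (cube n)) (λ x → ∑-cong (Finite.elems (finVec (cube t) n)) (λ R →
          event-transport D (ker D (column x)) (zipWith _∷_ x R) R
            (λ {c} (d , eq) → let eq′ = trans (sym (combo-columns x R c)) eq in
                              (d , cong head eq′) , cong tail eq′)
            (λ {c} ((d , b) , eq) → d , trans (combo-columns x R c) (cong₂ _∷_ b eq)))))

      Φ-old : ∀ {n} (D : Subspace n) x t → x ⊥ D → Φ (ker D (column x)) t ≡ Φ D t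
      Φ-old {n} D x t old = ∑-cong (Finite.elems (finVec (cube t) n)) (λ R →
        event-transport (ker D (column x)) D R R (λ ((d , _) , eq) → d , eq) (λ {c} (d , eq) → (d , old c d) , eq))

      ∣cut∣≤ : ∀ {t n} (D : Subspace n) (R : Vec (Vec Bool t) n) → size (cut? D R) ≤ ∣ D ∣
      ∣cut∣≤ {n = n} D R = ∑-mono (Finite.elems (finFⁿ n)) (λ c → 𝟙-mono (cut? D R c) (mem? D c) proj₁)

      Φ-vanish : ∀ {n} (D : Subspace n) t → (∀ (R : Vec (Vec Bool t) n) → ¬ Event D R) → Φ D t ≡ 0
      Φ-vanish {n} D t h = trans (∑-cong (Finite.elems (finVec (cube t) n)) (λ R → 𝟙-no (event? D R) (h R)))
                             (∑-zero (Finite.elems (finVec (cube t) n)))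

      Φ-small : ∀ {n} (D : Subspace n) t → ∣ D ∣ < q ^ suc e → Φ D t ≡ 0
      Φ-small D t h = Φ-vanish D t (λ R (_ , s) → <⇒≱ h (≤-trans (≤-reflexive (sym s)) (∣cut∣≤ D R)))

      -- A space that already has its final size must survive uncut, together with any relation of
      -- small weight in it.
      Φ-bad : ∀ {n} (D : Subspace n) t → ∣ D ∣ ≡ q ^ suc e → ¬ Good (Mem D) → Φ D t ≡ 0
      Φ-bad {n} D t h bad = Φ-vanish D t (λ R (g , s) → bad (λ c d → g c (full R s d)))
        where
        full : ∀ (R : Vec (Vec Bool t) n) → size (cut? D R) ≡ q ^ suc e → ∀ {c} → Mem D c → cut D R c
        full R s {c} d = 𝟙-true (cut? D R c) (trans
          (∑-tight {xs = Finite.elems (finFⁿ n)} (λ c → 𝟙-mono (cut? D R c) (mem? D c) proj₁)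
            (trans s (sym h)) (Finite.∈-elems (finFⁿ n) c))
          (𝟙-yes (mem? D c) d))

      old? : ∀ {n} (D : Subspace n) x → Dec (x ⊥ D)
      old? {n} D x with Finite.∃⊎∀ (finFⁿ n) (λ c → mem? D c ×-dec ¬? (bdot x c ≟ 0F))
      ... | inj₁ (c , d , ≢0) = no λ perp → ≢0 (perp c d)
      ... | inj₂ none = yes λ c d → decidable-stable (bdot x c ≟ 0F) (λ ≢0 → none c (d , ≢0))

      -- A column orthogonal to D leaves D unchanged; any other one lowers its
      -- dimension. The number of columns of the first kind is bounded by odlyzko.
      Φ-step : ∀ {n} (D : Subspace n) t B →
        (∀ x → ∣ D ∣ ≡ q * ∣ ker D (column x) ∣ → 4 ^ t * Φ (ker D (column x)) t ≤ B) →
        4 ^ suc t * Φ D (suc t) ≤ 4 * count (old? D) * (4 ^ t * Φ D t) + 4 * 2 ^ n * B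
      Φ-step {n} D t B h = begin
        4 ^ suc t * Φ D (suc t)
          ≡⟨ cong (4 ^ suc t *_) (Φ-suc D t) ⟩
        4 * 4 ^ t * ∑ xs Φₓ
          ≡⟨ trans (*-assoc 4 (4 ^ t) _) (cong (4 *_) (sym (∑-*ˡ xs (4 ^ t) Φₓ))) ⟩
        4 * ∑ xs (λ x → 4 ^ t * Φₓ x)
          ≤⟨ *-monoʳ-≤ 4 (∑-mono xs pointwise) ⟩
        4 * ∑ xs (λ x → 𝟙 (old? D x) * (4 ^ t * Φ D t) + B)
          ≡⟨ cong (4 *_) (trans (∑-+ xs _ _) (cong₂ _+_ (∑-*ʳ xs _ _)
               (trans (∑-const xs B) (cong (_* B) (card-cube n))))) ⟩
        4 * (count (old? D) * (4 ^ t * Φ D t) + 2 ^ n * B)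
          ≡⟨ eq (count (old? D)) (4 ^ t * Φ D t) (2 ^ n) B ⟩
        4 * count (old? D) * (4 ^ t * Φ D t) + 4 * 2 ^ n * B ∎
        where
        open ≤-Reasoning
        xs = Finite.elems (cube n)
        Φₓ = λ x → Φ (ker D (column x)) t
        eq : ∀ a b c d → 4 * (a * b + c * d) ≡ 4 * a * b + 4 * c * d
        eq = solve-∀
        pointwise : ∀ x → 4 ^ t * Φₓ x ≤ 𝟙 (old? D x) * (4 ^ t * Φ D t) + B
        pointwise x with old? D x
        ... | yes old = ≤-trans (≤-reflexive (trans (cong (4 ^ t *_) (Φ-old D x t old)) (sym (+-identityʳ _)))) (m≤m+n _ B)
        ... | no ¬old with vanishes⊎onto D (column x)
        ... | inj₁ van = contradiction (λ c d → van {c} d) ¬old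
        ... | inj₂ (_ , s) = h x s

      module _ {n w} (n≡ : n ≡ w + suc e) where
        private
          Q Z : ℕ
          Q = 3 * 2 ^ w
          Z = 4 * 2 ^ n

          2^n≡ : 2 ^ n ≡ 2 ^ suc e * 2 ^ w
          2^n≡ = trans (cong (2 ^_) (trans n≡ (+-comm w (suc e)))) (^-distribˡ-+-* 2 (suc e) w)

          1≤Q : 1 ≤ Q
          1≤Q = *-mono-≤ {1} {3} (s≤s z≤n) (m^n>0 2 w)

        -- `m` is the number of dimensions still to be lost. A losing column costs at most `Z` and
        -- has at most `t` possible places; every other column is orthogonal to a space of dimension
        -- at least `e + 1` and costs at most `Q`. The powers of 4 keep the density 3/4 integral:
        -- `Q` is 4 times 3/4 of 2^w.
        Φ-bound : ∀ t (D : Subspace n) m → ∣ D ∣ ≡ q ^ (m + suc e) →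
                  4 ^ t * Φ D t ≤ (t * Z) ^ m * Q ^ t
        Φ-bound zero D zero h = ≤-trans (≤-reflexive (+-identityʳ _))
          (≤-trans (∑-mono (Finite.elems (finVec (cube 0) n)) (λ R → 𝟙≤1 (event? D R)))
                   (≤-reflexive (trans (card-Vec (cube 0) n) (^-zeroˡ n))))
        -- No column is left that could lose the missing dimensions, so the event is empty.
        Φ-bound zero D (suc m) h = ≤-reflexive (trans (+-identityʳ _) (Φ-vanish D 0 (λ R (_ , s) →
          <⇒≢ (^-monoʳ-< q 1<card (m<n+m (suc e) {suc m} z<s))
              (trans (sym s) (trans (size-cong (cut? D R) (mem? D) proj₁ (λ d → d , empty _)) h)))))
          where
          empty : ∀ (v : Vec F 0) → v ≡ 0V
          empty [] = refl
        Φ-bound (suc t) D zero h with good? (mem? D)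
        ... | no bad = ≤-trans (≤-reflexive (trans (cong (4 ^ suc t *_) (Φ-bad D (suc t) h bad)) (*-zeroʳ (4 ^ suc t)))) z≤n
        ... | yes good = begin
          4 ^ suc t * Φ D (suc t) ≤⟨ Φ-step D t 0 new ⟩
          4 * count (old? D) * (4 ^ t * Φ D t) + Z * 0 ≡⟨ trans (cong (4 * count (old? D) * (4 ^ t * Φ D t) +_) (*-zeroʳ Z)) (+-identityʳ _) ⟩
          4 * count (old? D) * (4 ^ t * Φ D t) ≤⟨ *-mono-≤ few (≤-trans (Φ-bound t D 0 h) (≤-reflexive (+-identityʳ _))) ⟩
          Q * Q ^ t ≡⟨ +-identityʳ _ ⟨
          1 * Q ^ suc t ∎
          where
          open ≤-Reasoning
          -- One more lost dimension would fall below the prescribed size.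
          new : ∀ x → ∣ D ∣ ≡ q * ∣ ker D (column x) ∣ → 4 ^ t * Φ (ker D (column x)) t ≤ 0
          new x eq = ≤-reflexive (trans (cong (4 ^ t *_) (Φ-small (ker D (column x)) t
            (≤-<-trans (≤-reflexive (*-cancelˡ-≡ _ _ q (trans (sym eq) h))) (^-monoʳ-< q 1<card (n<1+n e)))))
            (*-zeroʳ (4 ^ t)))
          few : 4 * count (old? D) ≤ Q
          few = *-cancelˡ-≤ (2 ^ suc e) {{m^n≢0 2 (suc e)}} (begin
            2 ^ suc e * (4 * count (old? D)) ≡⟨ e₁ (2 ^ suc e) (count (old? D)) ⟩
            4 * (2 ^ suc e * count (old? D)) ≤⟨ odlyzko-good D e (old? D) (≤-reflexive (sym h)) (λ p → p) good ⟩
            3 * 2 ^ n ≡⟨ trans (cong (3 *_) 2^n≡) (e₂ (2 ^ suc e) (2 ^ w)) ⟩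
            2 ^ suc e * Q ∎)
            where
            e₁ : ∀ a b → a * (4 * b) ≡ 4 * (a * b)
            e₁ = solve-∀
            e₂ : ∀ a b → 3 * (a * b) ≡ a * (3 * b)
            e₂ = solve-∀
        Φ-bound (suc t) D (suc m) h = begin
          4 ^ suc t * Φ D (suc t) ≤⟨ Φ-step D t B new ⟩
          4 * count (old? D) * (4 ^ t * Φ D t) + Z * B ≤⟨ +-monoˡ-≤ (Z * B) (*-mono-≤ few (Φ-bound t D (suc m) h)) ⟩
          Q * ((t * Z) ^ suc m * Q ^ t) + Z * B ≡⟨ e₁ Q (t * Z) ((t * Z) ^ m) (Q ^ t) Z ⟩
          (Q * (t * Z) + 1 * Z) * B ≤⟨ *-monoˡ-≤ B (+-monoʳ-≤ (Q * (t * Z)) (*-monoˡ-≤ Z 1≤Q)) ⟩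
          (Q * (t * Z) + Q * Z) * B ≡⟨ e₂ Q t Z ((t * Z) ^ m) (Q ^ t) ⟩
          suc t * Z * (t * Z) ^ m * Q ^ suc t ≤⟨ *-monoˡ-≤ (Q ^ suc t) (*-monoʳ-≤ (suc t * Z) (^-monoˡ-≤ m (*-monoˡ-≤ Z (n≤1+n t)))) ⟩
          suc t * Z * (suc t * Z) ^ m * Q ^ suc t ∎
          where
          open ≤-Reasoning
          B = (t * Z) ^ m * Q ^ t
          e₁ : ∀ Q T P R Z → Q * (T * P * R) + Z * (P * R) ≡ (Q * T + 1 * Z) * (P * R)
          e₁ = solve-∀
          e₂ : ∀ Q t Z P R → (Q * (t * Z) + Q * Z) * (P * R) ≡ (1 + t) * Z * P * (Q * R)
          e₂ = solve-∀
          new : ∀ x → ∣ D ∣ ≡ q * ∣ ker D (column x) ∣ → 4 ^ t * Φ (ker D (column x)) t ≤ B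
          new x eq = Φ-bound t (ker D (column x)) m (*-cancelˡ-≡ _ _ q (trans (sym eq) h))
          -- Above the final dimension plain `odlyzko` already gives 2 · 2^w, which is below `Q`.
          few : 4 * count (old? D) ≤ Q
          few = ≤-trans (*-cancelˡ-≤ (2 ^ suc e) {{m^n≢0 2 (suc e)}} (begin
            2 ^ suc e * (4 * count (old? D)) ≤⟨ *-monoˡ-≤ (4 * count (old? D)) (m≤m*n (2 ^ suc e) (2 ^ m) {{m^n≢0 2 m}}) ⟩
            2 ^ suc e * 2 ^ m * (4 * count (old? D)) ≡⟨ e₃ (2 ^ suc e) (2 ^ m) (count (old? D)) ⟩
            2 * (2 * (2 ^ m * 2 ^ suc e) * count (old? D))
              ≡⟨ cong (λ z → 2 * (2 * z * count (old? D))) (sym (^-distribˡ-+-* 2 m (suc e))) ⟩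
            2 * (2 ^ (suc m + suc e) * count (old? D)) ≤⟨ *-monoʳ-≤ 2 (odlyzko D (suc m + suc e) (old? D) (≤-reflexive (sym h)) (λ p → p)) ⟩
            2 * 2 ^ n ≡⟨ trans (cong (2 *_) 2^n≡) (e₄ (2 ^ suc e) (2 ^ w)) ⟩
            2 ^ suc e * (2 * 2 ^ w) ∎)) (*-monoˡ-≤ (2 ^ w) (n≤1+n 2))
            where
            e₃ : ∀ a b c → a * b * (4 * c) ≡ 2 * (2 * (b * a) * c)
            e₃ = solve-∀
            e₄ : ∀ a b → 2 * (a * b) ≡ a * (2 * b)
            e₄ = solve-∀

    whole : ∀ n → Subspace n
    whole n = record { Mem = λ _ → ⊤ ; mem? = λ _ → yes tt ; zero∈ = tt ; closed = λ _ _ _ → tt }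

    combo-linear : ∀ {t n} (R : Vec (Vec Bool t) n) α c c′ → combo R (α · c ⊞ c′) ≡ α · combo R c ⊞ combo R c′
    combo-linear [] α [] [] = sym (zero-combination _ α)
      where
      zero-combination : ∀ t α → α · 0V {t} ⊞ 0V ≡ 0V
      zero-combination zero α = refl
      zero-combination (suc t) α = cong₂ _∷_ (trans (R.+-identityʳ _) (R.zeroʳ α)) (zero-combination t α)
    combo-linear (r ∷ R) α (c ∷ cs) (c′ ∷ cs′) =
      trans (cong (scaled (α ⊗ c ⊕ c′) r ⊞_) (combo-linear R α cs cs′)) (rearrange r (combo R cs) (combo R cs′))
      where
      rearrange : ∀ {t} (r : Vec Bool t) u v → scaled (α ⊗ c ⊕ c′) r ⊞ (α · u ⊞ v) ≡
                  α · (scaled c r ⊞ u) ⊞ (scaled c′ r ⊞ v)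
      rearrange [] [] [] = refl
      rearrange (false ∷ r) (u ∷ us) (v ∷ vs) = cong₂ _∷_
        (trans (R.+-identityˡ _) (cong₂ _⊕_ (cong (α ⊗_) (sym (R.+-identityˡ u))) (sym (R.+-identityˡ v))))
        (rearrange r us vs)
      rearrange (true ∷ r) (u ∷ us) (v ∷ vs) = cong₂ _∷_
        (trans (interchange (α ⊗ c) c′ (α ⊗ u) v) (cong (_⊕ (c′ ⊕ v)) (sym (R.distribˡ α c u))))
        (rearrange r us vs)

    combo-0 : ∀ {t n} (R : Vec (Vec Bool t) n) → combo R 0V ≡ 0V
    combo-0 [] = refl
    combo-0 (r ∷ R) = trans (cong (scaled 0F r ⊞_) (combo-0 R)) (scaled-0 r)
      where
      scaled-0 : ∀ {t} (r : Vec Bool t) → scaled 0F r ⊞ 0V ≡ 0V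
      scaled-0 [] = refl
      scaled-0 (false ∷ r) = cong₂ _∷_ (R.+-identityˡ 0F) (scaled-0 r)
      scaled-0 (true ∷ r) = cong₂ _∷_ (R.+-identityˡ 0F) (scaled-0 r)

    relations : ∀ {t n} → Vec (Vec Bool t) n → Subspace n
    relations R = record
      { Mem = λ c → combo R c ≡ 0V
      ; mem? = λ c → combo R c ≟ⱽ 0V
      ; zero∈ = combo-0 R
      ; closed = λ α {c} {c′} d d′ → trans (combo-linear R α c c′)
          (trans (cong₂ (λ u v → α · u ⊞ v) d d′) (trans (cong₂ (λ u v → α · u ⊞ v) (sym (combo-0 R)) (sym (combo-0 R)))
            (trans (sym (combo-linear R α 0V 0V)) (trans (cong (combo R) (zero-vec _)) (combo-0 R)))))
      }
      where
      zero-vec : ∀ {α} n → α · 0V {n} ⊞ 0V ≡ 0V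
      zero-vec zero = refl
      zero-vec (suc n) = cong₂ _∷_ (trans (R.+-identityʳ _) (R.zeroʳ _)) (zero-vec n)

    -- The number of nonzero relations, which up to normalisation bounds a covariance. The indicator
    -- removes the matrices with relations of weight one or two. These do not arise from distinct
    -- sums, and without them the quantity can be summed over all matrices.
    excess : ∀ {t n} → Vec (Vec Bool t) n → ℕ
    excess R = 𝟙 (good? (mem? (relations R))) * (∣ relations R ∣ ∸ 1)

    module _ (K n : ℕ) where
      private
        Rs = Finite.elems (finVec (cube K) n)
        is = allFin n

      excess-bound : ∀ (R : Vec (Vec Bool K) n) →
        excess R ≤ ∑ is (λ i → q ^ suc (toℕ i) * 𝟙 (event? (toℕ i) (whole n) R))
      excess-bound R with good? (mem? (relations R)) | ∣∣-power (relations R)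
      ... | no _ | _ = z≤n
      ... | yes good | zero , _ , eq = ≤-trans (≤-reflexive (trans (+-identityʳ _) (cong (_∸ 1) eq))) z≤n
      ... | yes good | suc e , e<n , eq = begin
        ∣ relations R ∣ ∸ 1 + 0 ≡⟨ +-identityʳ _ ⟩
        ∣ relations R ∣ ∸ 1 ≤⟨ m∸n≤m _ 1 ⟩
        ∣ relations R ∣ ≡⟨ eq ⟩
        q ^ suc e ≡⟨ *-identityʳ _ ⟨
        q ^ suc e * 1 ≡⟨ cong (q ^ suc e *_) (𝟙-yes (event? e (whole n) R) happens) ⟨
        term e ≡⟨ cong term (Fin.toℕ-fromℕ< e<n) ⟨
        term (toℕ (fromℕ< e<n)) ≤⟨ ∑-term (λ i → term (toℕ i)) (Finite.∈-elems (finFin n) (fromℕ< e<n)) ⟩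
        ∑ is (λ i → term (toℕ i)) ∎
        where
        open ≤-Reasoning
        term : ℕ → ℕ
        term e = q ^ suc e * 𝟙 (event? e (whole n) R)
        happens : Event e (whole n) R
        happens = (λ c (_ , d) → good c d)
                , trans (size-cong (cut? (whole n) R) (mem? (relations R)) proj₂ (tt ,_)) eq

      module _ (Y : ℕ) (1≤K : 1 ≤ K) (2^K≤ : 2 ^ K ≤ Y * q) where
        private
          Z : ℕ
          Z = K * (4 * 2 ^ n)

          1≤Y : 1 ≤ Y
          1≤Y = positive 2^K≤
            where
            positive : ∀ {Y} → 2 ^ K ≤ Y * q → 1 ≤ Y
            positive {zero} h = contradiction (≤-trans (m^n>0 2 K) h) λ ()
            positive {suc _} _ = s≤s z≤n

          1≤ZY : 1 ≤ Z * Y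
          1≤ZY = *-mono-≤ {1} {Z} {1} {Y} (*-mono-≤ {1} {K} 1≤K (*-mono-≤ {1} {4} (s≤s z≤n) (m^n>0 2 n))) 1≤Y

        -- A relation space of dimension e weighs q^e, and the columns that lose no dimension bring
        -- (2^w)^K = (2^K)^w, at most (Y q)^w, where w + e = n. The powers of `q` combine to the q^n
        -- of independent sums; what remains is 3^K, against 4^K on the left, and a factor in n, K
        -- and Y.
        event-sum : ∀ i → 4 ^ K * (q ^ suc (toℕ i) * Φ (toℕ i) (whole n) K) ≤ q ^ n * (3 ^ K * (Z * Y) ^ n)
        event-sum i = begin
          4 ^ K * (q ^ e * Φ (toℕ i) (whole n) K) ≡⟨ swap₁ (4 ^ K) (q ^ e) _ ⟩
          q ^ e * (4 ^ K * Φ (toℕ i) (whole n) K) ≤⟨ *-monoʳ-≤ (q ^ e) (Φ-bound (toℕ i) {n} {w} n≡ K (whole n) w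
                                                          (trans (card-Vec finite n) (cong (q ^_) n≡))) ⟩
          q ^ e * (Z ^ w * (3 * 2 ^ w) ^ K) ≡⟨ cong (λ z → q ^ e * (Z ^ w * z)) (trans (^-distribʳ-* K 3 (2 ^ w))
                                                          (cong (3 ^ K *_) (trans (^-*-assoc 2 w K) (trans (cong (2 ^_) (*-comm w K)) (sym (^-*-assoc 2 K w)))))) ⟩
          q ^ e * (Z ^ w * (3 ^ K * (2 ^ K) ^ w)) ≤⟨ *-monoʳ-≤ (q ^ e) (*-monoʳ-≤ (Z ^ w) (*-monoʳ-≤ (3 ^ K) (^-monoˡ-≤ w 2^K≤))) ⟩
          q ^ e * (Z ^ w * (3 ^ K * (Y * q) ^ w)) ≡⟨ cong (λ z → q ^ e * (Z ^ w * (3 ^ K * z))) (^-distribʳ-* w Y q) ⟩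
          q ^ e * (Z ^ w * (3 ^ K * (Y ^ w * q ^ w))) ≡⟨ swap₂ (q ^ e) (Z ^ w) (3 ^ K) (Y ^ w) (q ^ w) ⟩
          (q ^ w * q ^ e) * (3 ^ K * (Z ^ w * Y ^ w)) ≡⟨ cong₂ (λ a b → a * (3 ^ K * b))
                                                          (trans (sym (^-distribˡ-+-* q w e)) (cong (q ^_) (sym n≡)))
                                                          (sym (^-distribʳ-* w Z Y)) ⟩
          q ^ n * (3 ^ K * (Z * Y) ^ w) ≤⟨ *-monoʳ-≤ (q ^ n) (*-monoʳ-≤ (3 ^ K)
                                                          (^-monoʳ-≤ (Z * Y) {{>-nonZero 1≤ZY}} (≤-trans (m≤m+n w e) (≤-reflexive (sym n≡))))) ⟩
          q ^ n * (3 ^ K * (Z * Y) ^ n) ∎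
          where
          open ≤-Reasoning
          e = suc (toℕ i)
          w = n ∸ e
          n≡ : n ≡ w + e
          n≡ = sym (m∸n+n≡m (Fin.toℕ<n i))
          swap₁ : ∀ a b c → a * (b * c) ≡ b * (a * c)
          swap₁ = solve-∀
          swap₂ : ∀ a b c d e → a * (b * (c * (d * e))) ≡ (e * a) * (c * (b * d))
          swap₂ = solve-∀

        excess-sum : 4 ^ K * sum (finVec (cube K) n) excess ≤ n * (q ^ n * (3 ^ K * (Z * Y) ^ n))
        excess-sum = begin
          4 ^ K * ∑ Rs excess
            ≤⟨ *-monoʳ-≤ (4 ^ K) (∑-mono Rs excess-bound) ⟩
          4 ^ K * ∑ Rs (λ R → ∑ is (λ i → q ^ suc (toℕ i) * 𝟙 (event? (toℕ i) (whole n) R)))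
            ≡⟨ cong (4 ^ K *_) (trans (∑-swap Rs is _) (∑-cong is (λ i → ∑-*ˡ Rs (q ^ suc (toℕ i)) _))) ⟩
          4 ^ K * ∑ is (λ i → q ^ suc (toℕ i) * Φ (toℕ i) (whole n) K)
            ≡⟨ ∑-*ˡ is (4 ^ K) _ ⟨
          ∑ is (λ i → 4 ^ K * (q ^ suc (toℕ i) * Φ (toℕ i) (whole n) K))
            ≤⟨ ∑-mono is event-sum ⟩
          ∑ is (λ i → q ^ n * (3 ^ K * (Z * Y) ^ n))
            ≡⟨ trans (∑-const is _) (cong (_* (q ^ n * (3 ^ K * (Z * Y) ^ n))) (card-Fin n)) ⟩
          n * (q ^ n * (3 ^ K * (Z * Y) ^ n)) ∎
          where open ≤-Reasoning

-- Sublists, and relations among distinct rows.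

module Sublists where

  open FiniteSums
  open LinAlg
  open Counting
  open import Data.Bool.Base using (Bool; true; false)
  open import Data.List.Base using (List; []; _∷_; _++_)
  import Data.List.Base as List
  import Data.List.Relation.Unary.All as ListAll
  import Data.List.Relation.Unary.All.Properties as Listₚ
  open import Data.List.Relation.Unary.AllPairs using ([]; _∷_)
  open import Data.List.Relation.Unary.Unique.Propositional using () renaming (Unique to UniqueList)
  open import Data.List.Membership.Propositional using (_∈_)
  open import Data.Nat.Base
  open import Data.Nat.Properties hiding (_≟_)
  open import Data.Vec.Base as Vec using (Vec; []; _∷_)
  import Data.Vec.Relation.Unary.All as VecAll
  open import Data.Vec.Relation.Unary.AllPairs using ([]; _∷_)
  open import Data.Vec.Relation.Unary.Unique.Propositional using (Unique)

  private variable A B : Set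

  ∑-injection : (finA : Finite A) (finB : Finite B) {g : A → B} → (∀ {a a′} → g a ≡ g a′ → a ≡ a′) →
                ∀ (f : B → ℕ) → sum finA (λ a → f (g a)) ≤ sum finB f
  ∑-injection finA finB {g} inj f = begin
    ∑ as (λ a → f (g a)) ≡⟨ ∑-cong as (λ a → B.sift (g a) f) ⟨
    ∑ as (λ a → ∑ bs (λ b → 𝟙 (b B.≟ g a) * f b)) ≡⟨ ∑-swap as bs _ ⟩
    ∑ bs (λ b → ∑ as (λ a → 𝟙 (b B.≟ g a) * f b)) ≡⟨ ∑-cong bs (λ b → ∑-*ʳ as _ (f b)) ⟩
    ∑ bs (λ b → ∑ as (λ a → 𝟙 (b B.≟ g a)) * f b) ≤⟨ ∑-mono bs (λ b → *-monoˡ-≤ (f b) (fibre b)) ⟩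
    ∑ bs (λ b → 1 * f b) ≡⟨ ∑-cong bs (λ b → *-identityˡ (f b)) ⟩
    ∑ bs f ∎
    where
    open ≤-Reasoning
    module A = Finite finA
    module B = Finite finB
    as = A.elems
    bs = B.elems
    fibre : ∀ b → ∑ as (λ a → 𝟙 (b B.≟ g a)) ≤ 1
    fibre b with A.∃⊎∀ (λ a → b B.≟ g a)
    ... | inj₁ (a₀ , refl) = ≤-trans (∑-mono as (λ a → 𝟙-mono (g a₀ B.≟ g a) (a A.≟ a₀) (λ eq → sym (inj eq))))
                                     (≤-reflexive (A.once a₀))
    ... | inj₂ none = ≤-trans (≤-reflexive (trans (∑-cong as (λ a → 𝟙-no (b B.≟ g a) (none a))) (∑-zero as))) z≤n

  -- Serves to pass from rows of two special shapes, one for each target, to arbitrary rows, where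
  -- `excess-sum` applies.
  ∑-blocks : (finA : Finite A) (finB : Finite B) {g g′ : A → B} →
    (∀ {a a′} → g a ≡ g a′ → a ≡ a′) → (∀ {a a′} → g′ a ≡ g′ a′ → a ≡ a′) →
    ∀ i i′ (f : Vec B (i + i′) → ℕ) →
    sum (finVec finA i) (λ F → sum (finVec finA i′) (λ F′ → f (Vec.map g F Vec.++ Vec.map g′ F′)))
    ≤ sum (finVec finB (i + i′)) f
  ∑-blocks finA finB inj inj′ zero zero f = ≤-reflexive (+-identityʳ _)
  ∑-blocks finA finB {g} {g′} inj inj′ zero (suc i′) f = begin
    sum (finVec finA (suc i′)) (λ F′ → f (Vec.map g′ F′)) + 0
      ≡⟨ trans (+-identityʳ _) (sum-vec finA i′ _) ⟩
    sum finA (λ a → sum (finVec finA i′) (λ F′ → f (g′ a ∷ Vec.map g′ F′)))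
      ≡⟨ ∑-cong (Finite.elems finA) (λ a → +-identityʳ _) ⟨
    sum finA (λ a → sum (finVec finA i′) (λ F′ → f (g′ a ∷ Vec.map g′ F′)) + 0)
      ≤⟨ ∑-mono (Finite.elems finA) (λ a → ∑-blocks finA finB inj inj′ zero i′ (λ G → f (g′ a ∷ G))) ⟩
    sum finA (λ a → sum (finVec finB i′) (λ G → f (g′ a ∷ G)))
      ≤⟨ ∑-injection finA finB inj′ (λ b → sum (finVec finB i′) (λ G → f (b ∷ G))) ⟩
    sum finB (λ b → sum (finVec finB i′) (λ G → f (b ∷ G)))
      ≡⟨ sum-vec finB i′ f ⟨
    sum (finVec finB (suc i′)) f ∎
    where open ≤-Reasoning
  ∑-blocks finA finB {g} {g′} inj inj′ (suc i) i′ f = begin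
    sum (finVec finA (suc i)) (λ F → sum (finVec finA i′) (λ F′ → f (Vec.map g F Vec.++ Vec.map g′ F′)))
      ≡⟨ sum-vec finA i _ ⟩
    sum finA (λ a → sum (finVec finA i) (λ F → sum (finVec finA i′) (λ F′ → f (g a ∷ Vec.map g F Vec.++ Vec.map g′ F′))))
      ≤⟨ ∑-mono (Finite.elems finA) (λ a → ∑-blocks finA finB inj inj′ i i′ (λ G → f (g a ∷ G))) ⟩
    sum finA (λ a → sum (finVec finB (i + i′)) (λ G → f (g a ∷ G)))
      ≤⟨ ∑-injection finA finB inj (λ b → sum (finVec finB (i + i′)) (λ G → f (b ∷ G))) ⟩
    sum finB (λ b → sum (finVec finB (i + i′)) (λ G → f (b ∷ G)))
      ≡⟨ sum-vec finB (i + i′) f ⟨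
    sum (finVec finB (suc i + i′)) f ∎
    where open ≤-Reasoning

  sublists : ∀ i → List A → List (Vec A i)
  sublists zero L = [] ∷ []
  sublists (suc i) [] = []
  sublists (suc i) (s ∷ L) = List.map (s ∷_) (sublists i L) ++ sublists (suc i) L

  ∑-sublists-∷ : ∀ i (s : A) L f → ∑ (sublists (suc i) (s ∷ L)) f ≡
                 ∑ (sublists i L) (λ F → f (s ∷ F)) + ∑ (sublists (suc i) L) f
  ∑-sublists-∷ i s L f = trans (∑-++ (List.map (s ∷_) (sublists i L)) (sublists (suc i) L) f)
    (cong (_+ ∑ (sublists (suc i) L) f) (∑-map (s ∷_) (sublists i L) f))

  ∑-sublists-extend : ∀ i (s : A) L f → ∑ (sublists i L) f ≤ ∑ (sublists i (s ∷ L)) f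
  ∑-sublists-extend zero s L f = ≤-refl
  ∑-sublists-extend (suc i) s L f =
    ≤-trans (m≤n+m _ _) (≤-reflexive (sym (∑-sublists-∷ i s L f)))

  ∑-sublists-head : ∀ i (L : List A) f →
    ∑ (sublists (suc i) L) f ≤ ∑ L (λ s → ∑ (sublists i L) (λ F → f (s ∷ F)))
  ∑-sublists-head i [] f = z≤n
  ∑-sublists-head i (s ∷ L) f = ≤-trans (≤-reflexive (∑-sublists-∷ i s L f))
    (+-mono-≤ (∑-sublists-extend i s L (λ F → f (s ∷ F)))
      (≤-trans (∑-sublists-head i L f) (∑-mono L (λ s′ → ∑-sublists-extend i s L (λ F → f (s′ ∷ F))))))

  -- Combinations are enlarged to all tuples of the same length. The loss, of order `i !`,
  -- disappears in the 2^(O(ℓ²)) of the final estimate.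
  ∑-sublists : ∀ i (L : List A) f → ∑ (sublists i L) f ≤ ∑ (vecs L i) f
  ∑-sublists zero L f = ≤-refl
  ∑-sublists (suc i) L f = ≤-trans (∑-sublists-head i L f)
    (≤-trans (∑-mono L (λ s → ∑-sublists i L (λ F → f (s ∷ F)))) (≤-reflexive (sym (∑-vecs L i f))))

  sublists-All : ∀ {P : A → Set} i {L} → ListAll.All P L → ListAll.All (VecAll.All P) (sublists i L)
  sublists-All zero ps = VecAll.[] ListAll.∷ ListAll.[]
  sublists-All (suc i) ListAll.[] = ListAll.[]
  sublists-All (suc i) (p ListAll.∷ ps) = Listₚ.++⁺
    (Listₚ.map⁺ (ListAll.map (p VecAll.∷_) (sublists-All i ps))) (sublists-All (suc i) ps)

  sublists-Unique : ∀ i {L : List A} → UniqueList L → ListAll.All Unique (sublists i L)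
  sublists-Unique zero _ = [] ListAll.∷ ListAll.[]
  sublists-Unique (suc i) [] = ListAll.[]
  sublists-Unique (suc i) (s∉ ∷ u) = Listₚ.++⁺
    (Listₚ.map⁺ (ListAll.zipWith (λ (a , b) → a ∷ b) (sublists-All i s∉ , sublists-Unique i u)))
    (sublists-Unique (suc i) u)

  elems-Unique : (fin : Finite A) → UniqueList (Finite.elems fin)
  elems-Unique {A} fin = unique elems (λ t → ≤-reflexive (once t))
    where
    open Finite fin
    unique : ∀ xs → (∀ t → ∑ xs (λ x → 𝟙 (x ≟ t)) ≤ 1) → UniqueList xs
    unique [] h = []
    unique (x ∷ xs) h = ListAll.tabulate distinct ∷ unique xs (λ t → ≤-trans (m≤n+m _ _) (h t))
      where
      distinct : ∀ {y} → y ∈ xs → x ≢ y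
      distinct y∈ refl = contradiction (h x) (<⇒≱ (≤-trans
        (+-mono-≤ (≤-reflexive (sym (𝟙-yes (x ≟ x) refl)))
                  (≤-reflexive (sym (𝟙-yes (x ≟ x) refl))))
        (+-monoʳ-≤ (𝟙 (x ≟ x)) (∑-term (λ y → 𝟙 (y ≟ x)) y∈))))

  module UniqueRows (field′ : FiniteField) where
    open FiniteField field′
    open Finite finite using (_≟_)
    open LinearAlgebra field′
    open RelationCounting field′
    open Subspace

    private variable K n : ℕ

    nonzeros≡0 : ∀ (c : Vec F n) → nonzeros c ≡ 0 → c ≡ 0V
    nonzeros≡0 [] _ = refl
    nonzeros≡0 (c ∷ cs) eq with c ≟ 0F
    ... | yes refl = cong (0F ∷_) (nonzeros≡0 cs eq)

    ⊞-identityˡ : ∀ (v : Vec F n) → 0V ⊞ v ≡ v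
    ⊞-identityˡ [] = refl
    ⊞-identityˡ (v ∷ vs) = cong₂ _∷_ (R.+-identityˡ v) (⊞-identityˡ vs)

    ⊞-identityʳ : ∀ (v : Vec F n) → v ⊞ 0V ≡ v
    ⊞-identityʳ [] = refl
    ⊞-identityʳ (v ∷ vs) = cong₂ _∷_ (R.+-identityʳ v) (⊞-identityʳ vs)

    scaled-0F : ∀ (S : Vec Bool K) → scaled 0F S ≡ 0V
    scaled-0F [] = refl
    scaled-0F (false ∷ S) = cong (0F ∷_) (scaled-0F S)
    scaled-0F (true ∷ S) = cong (0F ∷_) (scaled-0F S)

    combo-0∷ : ∀ (S : Vec Bool K) (rows : Vec (Vec Bool K) n) cs → combo (S ∷ rows) (0F ∷ cs) ≡ combo rows cs
    combo-0∷ S rows cs = trans (cong (_⊞ combo rows cs) (scaled-0F S)) (⊞-identityˡ _)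

    -- `P` carries what is known about the rows: being nonzero in one use, differing from an earlier
    -- row in the other.
    combo-single : ∀ {P : Vec Bool K → Set} {rows : Vec (Vec Bool K) n} → VecAll.All P rows → ∀ c → nonzeros c ≡ 1 →
      ∃ λ α → ∃ λ S → α ≢ 0F × P S × combo rows c ≡ scaled α S
    combo-single {rows = S ∷ rows} (p VecAll.∷ ps) (c ∷ cs) eq with c ≟ 0F
    ... | no c≢0 = c , S , c≢0 , p ,
      trans (cong (scaled c S ⊞_) (trans (cong (combo rows) (nonzeros≡0 cs (suc-injective eq))) (combo-0 rows)))
            (⊞-identityʳ _)
    ... | yes refl with combo-single ps cs eq
    ... | α , S′ , α≢0 , p′ , eq′ = α , S′ , α≢0 , p′ , trans (combo-0∷ S rows cs) eq′

    combo-pair : ∀ {rows : Vec (Vec Bool K) n} → Unique rows → ∀ c → nonzeros c ≡ 2 →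
      ∃ λ α → ∃ λ β → ∃ λ S → ∃ λ S′ → α ≢ 0F × β ≢ 0F × S ≢ S′ × combo rows c ≡ scaled α S ⊞ scaled β S′
    combo-pair {rows = S ∷ rows} (S∉ ∷ u) (c ∷ cs) eq with c ≟ 0F
    ... | no c≢0 with combo-single S∉ cs (suc-injective eq)
    ... | β , S′ , β≢0 , S≢S′ , eq′ = c , β , S , S′ , c≢0 , β≢0 , S≢S′ , cong (scaled c S ⊞_) eq′
    combo-pair {rows = S ∷ rows} (S∉ ∷ u) (c ∷ cs) eq | yes refl with combo-pair u cs eq
    ... | α , β , S₁ , S₂ , α≢0 , β≢0 , ≢ , eq′ = α , β , S₁ , S₂ , α≢0 , β≢0 , ≢ , trans (combo-0∷ S rows cs) eq′

    scaled≡0 : ∀ {α} → α ≢ 0F → ∀ (S : Vec Bool K) → scaled α S ≡ 0V → S ≡ Vec.replicate _ false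
    scaled≡0 α≢0 [] eq = refl
    scaled≡0 α≢0 (false ∷ S) eq = cong (false ∷_) (scaled≡0 α≢0 S (cong Vec.tail eq))
    scaled≡0 α≢0 (true ∷ S) eq = contradiction (cong Vec.head eq) α≢0

    scaled-pair≡0 : ∀ {α β} → α ≢ 0F → β ≢ 0F → ∀ (S S′ : Vec Bool K) → scaled α S ⊞ scaled β S′ ≡ 0V → S ≡ S′
    scaled-pair≡0 α≢0 β≢0 [] [] eq = refl
    scaled-pair≡0 α≢0 β≢0 (false ∷ S) (false ∷ S′) eq = cong (false ∷_) (scaled-pair≡0 α≢0 β≢0 S S′ (cong Vec.tail eq))
    scaled-pair≡0 α≢0 β≢0 (true ∷ S) (true ∷ S′) eq = cong (true ∷_) (scaled-pair≡0 α≢0 β≢0 S S′ (cong Vec.tail eq))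
    scaled-pair≡0 α≢0 β≢0 (false ∷ S) (true ∷ S′) eq = contradiction (trans (sym (R.+-identityˡ _)) (cong Vec.head eq)) β≢0
    scaled-pair≡0 α≢0 β≢0 (true ∷ S) (false ∷ S′) eq = contradiction (trans (sym (R.+-identityʳ _)) (cong Vec.head eq)) α≢0

    -- A relation of weight one would make a row zero. One of weight two reads
    -- `scaled α S ⊞ scaled β S′ ≡ 0V` with nonzero coefficients, so `S` and `S′` have the same
    -- support and, being 0/1 vectors, coincide.
    unique⇒good : ∀ {rows : Vec (Vec Bool K) n} → Unique rows → VecAll.All (_≢ Vec.replicate _ false) rows →
                  Good (Mem (relations rows))
    unique⇒good u nz c d c≢0 with nonzeros c in eq
    ... | 0 = contradiction (nonzeros≡0 c eq) c≢0
    ... | 1 with combo-single nz c eq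
    ... | α , S , α≢0 , S≢0 , eq′ = contradiction (scaled≡0 α≢0 S (trans (sym eq′) d)) S≢0
    unique⇒good u nz c d c≢0 | 2 with combo-pair u c eq
    ... | α , β , S , S′ , α≢0 , β≢0 , S≢S′ , eq′ =
            contradiction (scaled-pair≡0 α≢0 β≢0 S S′ (trans (sym eq′) d)) S≢S′
    unique⇒good u nz c d c≢0 | suc (suc (suc _)) = s≤s (s≤s (s≤s z≤n))

-- Truncated inclusion-exclusion.

module Bonferroni where

  open import Defs
  open FiniteSums
  open Sublists
  open import Data.List.Base using (List; []; _∷_; _++_; map; length)
  open import Data.List.Relation.Unary.All using (All; []; _∷_)
  open import Data.List.Relation.Unary.Any using (Any; here; there)
  open import Data.Nat.Base as ℕ using (ℕ; zero; suc)
  import Data.Nat.Properties as ℕ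
  open import Data.Rational.Base using (ℚ; 0ℚ; 1ℚ; _+_; _*_; _-_; -_; _≤_)
  import Data.Rational.Properties as ℚ
  open import Data.Vec.Base using (Vec; []; _∷_)
  open import Data.Rational.Solver using (module +-*-Solver)
  open +-*-Solver using (solve; _:+_; _:*_; _:-_; :-_; con; _:=_)
  open RationalLemmas

  private variable A B : Set

  ∑ℚ : List A → (A → ℚ) → ℚ
  ∑ℚ [] f = 0ℚ
  ∑ℚ (x ∷ xs) f = f x + ∑ℚ xs f

  ∑ℚ-cong : ∀ (xs : List A) {f g : A → ℚ} → (∀ x → f x ≡ g x) → ∑ℚ xs f ≡ ∑ℚ xs g
  ∑ℚ-cong [] h = refl
  ∑ℚ-cong (x ∷ xs) h = cong₂ _+_ (h x) (∑ℚ-cong xs h)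

  ∑ℚ-mono-All : ∀ {xs : List A} {f g : A → ℚ} → All (λ x → f x ≤ g x) xs → ∑ℚ xs f ≤ ∑ℚ xs g
  ∑ℚ-mono-All [] = ℚ.≤-refl
  ∑ℚ-mono-All (h ∷ hs) = ℚ.+-mono-≤ h (∑ℚ-mono-All hs)

  ∑ℚ-mono : ∀ (xs : List A) {f g : A → ℚ} → (∀ x → f x ≤ g x) → ∑ℚ xs f ≤ ∑ℚ xs g
  ∑ℚ-mono [] h = ℚ.≤-refl
  ∑ℚ-mono (x ∷ xs) h = ℚ.+-mono-≤ (h x) (∑ℚ-mono xs h)

  ∑ℚ-++ : ∀ (xs ys : List A) (f : A → ℚ) → ∑ℚ (xs ++ ys) f ≡ ∑ℚ xs f + ∑ℚ ys f
  ∑ℚ-++ [] ys f = sym (ℚ.+-identityˡ _)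
  ∑ℚ-++ (x ∷ xs) ys f = trans (cong (f x +_) (∑ℚ-++ xs ys f)) (sym (ℚ.+-assoc (f x) _ _))

  ∑ℚ-map : ∀ (g : A → B) xs (f : B → ℚ) → ∑ℚ (map g xs) f ≡ ∑ℚ xs (λ x → f (g x))
  ∑ℚ-map g [] f = refl
  ∑ℚ-map g (x ∷ xs) f = cong (f (g x) +_) (∑ℚ-map g xs f)

  ∑ℚ-zero : ∀ (xs : List A) → ∑ℚ xs (λ _ → 0ℚ) ≡ 0ℚ
  ∑ℚ-zero [] = refl
  ∑ℚ-zero (x ∷ xs) = trans (ℚ.+-identityˡ _) (∑ℚ-zero xs)

  ∑ℚ-+ : ∀ (xs : List A) (f g : A → ℚ) → ∑ℚ xs (λ x → f x + g x) ≡ ∑ℚ xs f + ∑ℚ xs g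
  ∑ℚ-+ [] f g = refl
  ∑ℚ-+ (x ∷ xs) f g = trans (cong (f x + g x +_) (∑ℚ-+ xs f g))
    (solve 4 (λ a b c d → (a :+ b) :+ (c :+ d) := (a :+ c) :+ (b :+ d)) refl (f x) (g x) _ _)

  ∑ℚ-*ˡ : ∀ (xs : List A) c (f : A → ℚ) → ∑ℚ xs (λ x → c * f x) ≡ c * ∑ℚ xs f
  ∑ℚ-*ˡ [] c f = sym (ℚ.*-zeroʳ c)
  ∑ℚ-*ˡ (x ∷ xs) c f = trans (cong (c * f x +_) (∑ℚ-*ˡ xs c f)) (sym (ℚ.*-distribˡ-+ c (f x) _))

  ∑ℚ-*ʳ : ∀ (xs : List A) (f : A → ℚ) c → ∑ℚ xs (λ x → f x * c) ≡ ∑ℚ xs f * c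
  ∑ℚ-*ʳ xs f c = trans (∑ℚ-cong xs (λ x → ℚ.*-comm (f x) c)) (trans (∑ℚ-*ˡ xs c f) (ℚ.*-comm c _))

  ∑ℚ-swap : ∀ (xs : List A) (ys : List B) (f : A → B → ℚ) →
            ∑ℚ xs (λ x → ∑ℚ ys (f x)) ≡ ∑ℚ ys (λ y → ∑ℚ xs (λ x → f x y))
  ∑ℚ-swap [] ys f = sym (∑ℚ-zero ys)
  ∑ℚ-swap (x ∷ xs) ys f = trans (cong (∑ℚ ys (f x) +_) (∑ℚ-swap xs ys f)) (sym (∑ℚ-+ ys (f x) _))

  ∑ℚ-product : ∀ (xs : List A) (ys : List B) (f : A → ℚ) (g : B → ℚ) →
               ∑ℚ xs f * ∑ℚ ys g ≡ ∑ℚ xs (λ x → ∑ℚ ys (λ y → f x * g y))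
  ∑ℚ-product xs ys f g = trans (sym (∑ℚ-*ʳ xs f (∑ℚ ys g))) (∑ℚ-cong xs (λ x → sym (∑ℚ-*ˡ ys (f x) g)))

  ι-∑ : ∀ (xs : List A) f → ι (∑ xs f) ≡ ∑ℚ xs (λ x → ι (f x))
  ι-∑ [] f = refl
  ι-∑ (x ∷ xs) f = trans (ι-+ (f x) (∑ xs f)) (cong (ι (f x) +_) (ι-∑ xs f))

  ∑ℚ-const : ∀ (xs : List A) c → ∑ℚ xs (λ _ → c) ≡ ι (∑ xs (λ _ → 1)) * c
  ∑ℚ-const xs c = trans (∑ℚ-cong xs (λ _ → sym (ℚ.*-identityˡ c)))
    (trans (∑ℚ-*ʳ xs (λ _ → 1ℚ) c) (cong (_* c) (sym (ι-∑ xs (λ _ → 1)))))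

  infixr 8 _^^_
  _^^_ : ℚ → ℕ → ℚ
  x ^^ zero = 1ℚ
  x ^^ suc n = x * x ^^ n

  ^^-+ : ∀ x m n → x ^^ (m ℕ.+ n) ≡ x ^^ m * x ^^ n
  ^^-+ x zero n = sym (ℚ.*-identityˡ _)
  ^^-+ x (suc m) n = trans (cong (x *_) (^^-+ x m n)) (sym (ℚ.*-assoc x _ _))

  ι-^ : ∀ m n → ι (m ℕ.^ n) ≡ ι m ^^ n
  ι-^ m zero = refl
  ι-^ m (suc n) = trans (ι-* m (m ℕ.^ n)) (cong (ι m *_) (ι-^ m n))

  ^^-distrib-* : ∀ x y n → (x * y) ^^ n ≡ x ^^ n * y ^^ n
  ^^-distrib-* x y zero = refl
  ^^-distrib-* x y (suc n) = trans (cong (x * y *_) (^^-distrib-* x y n))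
    (solve 4 (λ a b c d → (a :* b) :* (c :* d) := (a :* c) :* (b :* d)) refl x y (x ^^ n) (y ^^ n))

  1^^ : ∀ n → 1ℚ ^^ n ≡ 1ℚ
  1^^ zero = refl
  1^^ (suc n) = trans (ℚ.*-identityˡ _) (1^^ n)

  0≤^^ : ∀ {x} → 0ℚ ≤ x → ∀ n → 0ℚ ≤ x ^^ n
  0≤^^ 0≤x zero = ℚ.<⇒≤ 0<1
  0≤^^ 0≤x (suc n) = *-nonneg 0≤x (0≤^^ 0≤x n)

  ^^≤1 : ∀ {x} → 0ℚ ≤ x → x ≤ 1ℚ → ∀ n → x ^^ n ≤ 1ℚ
  ^^≤1 0≤x x≤1 zero = ℚ.≤-refl
  ^^≤1 0≤x x≤1 (suc n) = *-mono 0≤x x≤1 (0≤^^ 0≤x n) (^^≤1 0≤x x≤1 n)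

  sgn : ℕ → ℚ
  sgn zero = 1ℚ
  sgn (suc i) = - sgn i

  sgn-even : ∀ i → sgn (2 ℕ.* i) ≡ 1ℚ
  sgn-even zero = refl
  sgn-even (suc i) = trans (cong (λ n → - sgn n) (ℕ.+-suc i (i ℕ.+ 0)))
    (trans (solve 1 (λ s → :- (:- s) := s) refl (sgn (2 ℕ.* i))) (sgn-even i))

  prod : ∀ {i} → (A → ℚ) → Vec A i → ℚ
  prod h [] = 1ℚ
  prod h (s ∷ F) = h s * prod h F

  prod-const : ∀ {i} x (F : Vec A i) → prod (λ _ → x) F ≡ x ^^ i
  prod-const x [] = refl
  prod-const x (_ ∷ F) = cong (x *_) (prod-const x F)

  -- The elementary symmetric polynomial; if `h` is 0/1-valued with N ones, it is N choose i.
  elementary : ℕ → (A → ℚ) → List A → ℚ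
  elementary i h L = ∑ℚ (sublists i L) (prod h)

  elementary-∷ : ∀ i h (s : A) L → elementary (suc i) h (s ∷ L) ≡ h s * elementary i h L + elementary (suc i) h L
  elementary-∷ i h s L = trans (∑ℚ-++ (map (s ∷_) (sublists i L)) (sublists (suc i) L) (prod h))
    (cong (_+ elementary (suc i) h L) (trans (∑ℚ-map (s ∷_) (sublists i L) (prod h))
      (∑ℚ-*ˡ (sublists i L) (h s) (prod h))))

  bonferroni : ℕ → (A → ℚ) → List A → ℚ
  bonferroni R h L = sumTo R (λ i → sgn i * elementary i h L)

  -- Without truncation the alternating sum is the product of the factors 1 - h s; this is
  -- multiplication by one more factor, truncated.
  bonferroni-∷ : ∀ R h (s : A) L →
    bonferroni (suc R) h (s ∷ L) ≡ bonferroni (suc R) h L - h s * bonferroni R h L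
  bonferroni-∷ zero h s L = solve 1 (λ a → con 0ℚ :+ con 1ℚ :* (con 1ℚ :+ con 0ℚ)
    := (con 0ℚ :+ con 1ℚ :* (con 1ℚ :+ con 0ℚ)) :- a :* con 0ℚ) refl (h s)
  bonferroni-∷ (suc R) h s L = trans
    (cong₂ (λ a b → a + - sgn R * b) (bonferroni-∷ R h s L) (elementary-∷ R h s L))
    (solve 6 (λ a b h s e e′ → (a :- h :* b) :+ (:- s) :* (h :* e :+ e′)
       := (a :+ (:- s) :* e′) :- h :* (b :+ s :* e)) refl
       (bonferroni (suc R) h L) (bonferroni R h L) (h s) (sgn R) (elementary R h L) (elementary (suc R) h L))

  bonferroni-[] : ∀ R (h : A → ℚ) → bonferroni (suc R) h [] ≡ 1ℚ
  bonferroni-[] zero h = refl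
  bonferroni-[] (suc R) h = trans (cong₂ _+_ (bonferroni-[] R h) (ℚ.*-zeroʳ (- sgn R))) (ℚ.+-identityʳ 1ℚ)

  module _ {P : A → Set} (P? : ∀ s → Dec (P s)) where
    private
      h : A → ℚ
      h s = ι (𝟙 (P? s))

    bonferroni-none : ∀ R {L} → All (λ s → ¬ P s) L → bonferroni (suc R) h L ≡ 1ℚ
    bonferroni-none R [] = bonferroni-[] R h
    bonferroni-none R {s ∷ L} (¬p ∷ none) = trans (bonferroni-∷ R h s L)
      (trans (cong₂ (λ a b → a - ι b * bonferroni R h L) (bonferroni-none R none) (𝟙-no (P? s) ¬p))
        (solve 1 (λ b → con 1ℚ :- con 0ℚ :* b := con 1ℚ) refl (bonferroni R h L)))

    none⊎some : ∀ L → All (λ s → ¬ P s) L ⊎ Any P L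
    none⊎some [] = inj₁ []
    none⊎some (s ∷ L) with P? s | none⊎some L
    ... | yes p | _ = inj₂ (here p)
    ... | no ¬p | inj₁ none = inj₁ (¬p ∷ none)
    ... | no ¬p | inj₂ some = inj₂ (there some)

    -- If `s` satisfies `P`, order R+1 on `s ∷ L` is the difference of two consecutive orders on
    -- `L`. Both have the right sign by induction when `P` occurs in `L`; otherwise both equal 1,
    -- except that order 0 is the empty sum.
    bonferroni-some : ∀ R {L} → Any P L → sgn R * bonferroni R h L ≤ 0ℚ
    bonferroni-some zero _ = ℚ.≤-refl
    bonferroni-some (suc R) {s ∷ L} some = by-case (P? s) refl
      where
      expand : ∀ {d} → P? s ≡ d → - sgn R * bonferroni (suc R) h (s ∷ L) ≡
               - sgn R * (bonferroni (suc R) h L - ι (𝟙 d) * bonferroni R h L)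
      expand refl = cong (- sgn R *_) (bonferroni-∷ R h s L)
      tail-case : ∀ R → All (λ s → ¬ P s) L ⊎ Any P L →
        - sgn R * (bonferroni (suc R) h L - 1ℚ * bonferroni R h L) ≤ 0ℚ
      tail-case R (inj₂ p∈) = ℚ.≤-trans (ℚ.≤-reflexive
        (solve 3 (λ s a b → (:- s) :* (a :- con 1ℚ :* b) := (:- s) :* a :+ s :* b) refl
          (sgn R) (bonferroni (suc R) h L) (bonferroni R h L)))
        (ℚ.+-mono-≤ (bonferroni-some (suc R) p∈) (bonferroni-some R p∈))
      tail-case zero (inj₁ none) = ℚ.≤-trans (ℚ.≤-reflexive
        (cong (λ a → - 1ℚ * (a - 1ℚ * 0ℚ)) (bonferroni-none 0 none))) (ℚ.<⇒≤ (ℚ.negative⁻¹ (- 1ℚ)))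
      tail-case (suc R) (inj₁ none) = ℚ.≤-reflexive (trans
        (cong₂ (λ a b → - sgn (suc R) * (a - 1ℚ * b)) (bonferroni-none (suc R) none) (bonferroni-none R none))
        (solve 1 (λ s → (:- s) :* (con 1ℚ :- con 1ℚ :* con 1ℚ) := con 0ℚ) refl (sgn (suc R))))
      by-case : (d : Dec (P s)) → P? s ≡ d → - sgn R * bonferroni (suc R) h (s ∷ L) ≤ 0ℚ
      by-case (yes p) eq = ℚ.≤-trans (ℚ.≤-reflexive (expand eq)) (tail-case R (none⊎some L))
      by-case (no ¬p) eq = ℚ.≤-trans (ℚ.≤-reflexive (trans (expand eq) (cong (- sgn R *_)
          (solve 2 (λ a b → a :- con 0ℚ :* b := a) refl (bonferroni (suc R) h L) (bonferroni R h L)))))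
        (bonferroni-some (suc R) (in-tail some))
        where
        in-tail : Any P (s ∷ L) → Any P L
        in-tail (here p) = contradiction p ¬p
        in-tail (there p∈) = p∈

  -- B choose R, by Pascal's rule, which is the recursion that `remainder` produces.
  tailCoefficient : ℕ → ℕ → ℕ
  tailCoefficient zero B = 1
  tailCoefficient (suc R) zero = 0
  tailCoefficient (suc R) (suc B) = tailCoefficient (suc R) B ℕ.+ tailCoefficient R B

  module _ {x : ℚ} (0≤x : 0ℚ ≤ x) (x≤1 : x ≤ 1ℚ) where
    private
      y : ℚ
      y = 1ℚ - x
      0≤y : 0ℚ ≤ y
      0≤y = ℚ.≤-trans (ℚ.≤-reflexive (sym (ℚ.+-inverseʳ x))) (ℚ.+-monoˡ-≤ (- x) x≤1)
      y≤1 : y ≤ 1ℚ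
      y≤1 = ℚ.≤-trans (ℚ.+-monoʳ-≤ 1ℚ (ℚ.neg-antimono-≤ 0≤x)) (ℚ.≤-reflexive (ℚ.+-identityʳ 1ℚ))

    -- The truncation error of (1 - x)^N has the sign of the first omitted term and at most its
    -- size; its recursion in the list has nonnegative terms only.
    remainder : ∀ R (L : List A) →
      let r = sgn R * (y ^^ length L - bonferroni R (λ _ → x) L) in
      0ℚ ≤ r × r ≤ ι (tailCoefficient R (length L)) * x ^^ R
    remainder zero L =
        ℚ.≤-trans (0≤^^ 0≤y (length L)) (ℚ.≤-reflexive (sym eq))
      , ℚ.≤-trans (ℚ.≤-reflexive eq) (^^≤1 0≤y y≤1 (length L))
      where
      eq = solve 1 (λ a → con 1ℚ :* (a :- con 0ℚ) := a) refl (y ^^ length L)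
    remainder (suc R) [] = ℚ.≤-reflexive (sym eq) , ℚ.≤-reflexive (trans eq (sym (ℚ.*-zeroˡ (x * x ^^ R))))
      where
      eq : - sgn R * (1ℚ - bonferroni (suc R) (λ _ → x) []) ≡ 0ℚ
      eq = trans (cong (λ b → - sgn R * (1ℚ - b)) (bonferroni-[] R (λ _ → x))) (ℚ.*-zeroʳ (- sgn R))
    remainder (suc R) (s ∷ L) =
        ℚ.≤-trans (ℚ.+-mono-≤ (proj₁ r₁) (*-nonneg 0≤x (proj₁ r₂))) (ℚ.≤-reflexive (sym eq))
      , ℚ.≤-trans (ℚ.≤-reflexive eq) (ℚ.≤-trans (ℚ.+-mono-≤ (proj₂ r₁) (*-monoʳ 0≤x (proj₂ r₂))) (ℚ.≤-reflexive eq′))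
      where
      r₁ = remainder (suc R) L
      r₂ = remainder R L
      a = bonferroni (suc R) (λ _ → x) L
      b = bonferroni R (λ _ → x) L
      z = y ^^ length L
      eq : - sgn R * (y * z - bonferroni (suc R) (λ _ → x) (s ∷ L)) ≡
           - sgn R * (z - a) + x * (sgn R * (z - b))
      eq = trans (cong (λ t → - sgn R * (y * z - t)) (bonferroni-∷ R (λ _ → x) s L))
        (solve 5 (λ s x z a b → (:- s) :* ((con 1ℚ :- x) :* z :- (a :- x :* b))
          := (:- s) :* (z :- a) :+ x :* (s :* (z :- b))) refl (sgn R) x z a b)
      t₁ = tailCoefficient (suc R) (length L)
      t₂ = tailCoefficient R (length L)
      eq′ : ι t₁ * (x * x ^^ R) + x * (ι t₂ * x ^^ R) ≡ ι (t₁ ℕ.+ t₂) * (x * x ^^ R)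
      eq′ = trans (solve 4 (λ a b x p → a :* (x :* p) :+ x :* (b :* p) := (a :+ b) :* (x :* p)) refl
        (ι t₁) (ι t₂) x (x ^^ R)) (cong (_* (x * x ^^ R)) (sym (ι-+ t₁ t₂)))

-- The second moment of the truncated sum.

module SecondMoment where

  open import Defs
  open FiniteSums
  open LinAlg
  open Counting
  open Sublists
  open Bonferroni
  open import Data.Bool.Base using (Bool; true; false)
  open import Data.List.Base using (List; []; _∷_)
  import Data.List.Base as List
  import Data.List.Relation.Unary.All as ListAll
  import Data.List.Relation.Unary.All.Properties as Listₚ
  open import Data.List.Membership.Propositional using (lose)
  open import Data.Nat.Base as ℕ using (ℕ; zero; suc)
  import Data.Nat.Properties as ℕ
  open import Data.Rational.Base using (ℚ; 0ℚ; 1ℚ; _+_; _*_; _-_; -_; _≤_; _<_)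
  import Data.Rational.Properties as ℚ
  open import Data.Vec.Base as Vec using (Vec; []; _∷_)
  import Data.Vec.Properties as Vecₚ
  import Data.Vec.Relation.Unary.All as VecAll
  import Data.Vec.Relation.Unary.All.Properties as VecAllₚ
  import Data.Vec.Relation.Unary.AllPairs as AllPairs
  import Data.Vec.Relation.Unary.AllPairs.Properties as AllPairsₚ
  open import Data.Vec.Relation.Unary.Unique.Propositional using (Unique)
  open import Data.Rational.Solver using (module +-*-Solver)
  open +-*-Solver using (solve; _:+_; _:*_; _:-_; :-_; con; _:=_)
  open RationalLemmas

  private variable A : Set

  -- Sublists of all sizes below R, tagged with their size: the truncated sum becomes one signed sum
  -- and its square a sum over pairs.
  family : ℕ → List A → List (∃ λ i → Vec A i)
  family zero L = []
  family (suc R) L = family R L List.++ List.map (R ,_) (sublists R L)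

  ∑ℚ-family : ∀ R (L : List A) f → ∑ℚ (family R L) f ≡ sumTo R (λ i → ∑ℚ (sublists i L) (λ F → f (i , F)))
  ∑ℚ-family zero L f = refl
  ∑ℚ-family (suc R) L f = trans (∑ℚ-++ (family R L) _ f)
    (cong₂ _+_ (∑ℚ-family R L f) (∑ℚ-map (R ,_) (sublists R L) f))

  bonferroni-family : ∀ R h (L : List A) →
    bonferroni R h L ≡ ∑ℚ (family R L) (λ (i , F) → sgn i * prod h F)
  bonferroni-family R h L = trans
    (sumTo-cong R (λ i → sym (∑ℚ-*ˡ (sublists i L) (sgn i) (prod h))))
    (sym (∑ℚ-family R L (λ (i , F) → sgn i * prod h F)))

  family-All : ∀ {P : ∀ {i} → Vec A i → Set} R {L : List A} → (∀ i → ListAll.All (P {i}) (sublists i L)) →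
               ListAll.All (λ (i , F) → P F) (family R L)
  family-All zero h = ListAll.[]
  family-All (suc R) h = Listₚ.++⁺ (family-All R h) (Listₚ.map⁺ (h R))

  sumTo-upper : ∀ n {f : ℕ → ℚ} {B} → (∀ i → i ℕ.< n → f i ≤ B) → sumTo n f ≤ ι n * B
  sumTo-upper zero {B = B} h = ℚ.≤-reflexive (sym (ℚ.*-zeroˡ B))
  sumTo-upper (suc n) {B = B} h = ℚ.≤-trans
    (ℚ.+-mono-≤ (sumTo-upper n (λ i i<n → h i (ℕ.m<n⇒m<1+n i<n))) (h n ℕ.≤-refl))
    (ℚ.≤-reflexive (sym (ι-suc-* n B)))

  sgn-bound : ∀ i {z B} → z ≤ B → - z ≤ B → sgn i * z ≤ B × - (sgn i * z) ≤ B
  sgn-bound zero {z} u l = ℚ.≤-trans (ℚ.≤-reflexive (ℚ.*-identityˡ z)) u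
                            , ℚ.≤-trans (ℚ.≤-reflexive (cong -_ (ℚ.*-identityˡ z))) l
  sgn-bound (suc i) {z} {B} u l = flip (sgn-bound i u l)
    where
    flip : sgn i * z ≤ B × - (sgn i * z) ≤ B → - sgn i * z ≤ B × - (- sgn i * z) ≤ B
    flip (u′ , l′) = ℚ.≤-trans (ℚ.≤-reflexive (solve 2 (λ s z → (:- s) :* z := :- (s :* z)) refl (sgn i) z)) l′
                , ℚ.≤-trans (ℚ.≤-reflexive (solve 2 (λ s z → :- ((:- s) :* z) := s :* z) refl (sgn i) z)) u′

  square-nonneg : ∀ z → 0ℚ ≤ z * z
  square-nonneg z = by-sign (ℚ.≤-total 0ℚ z)
    where
    by-sign : 0ℚ ≤ z ⊎ z ≤ 0ℚ → 0ℚ ≤ z * z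
    by-sign (inj₁ 0≤z) = *-nonneg 0≤z 0≤z
    by-sign (inj₂ z≤0) = ℚ.≤-trans (*-nonneg (ℚ.neg-antimono-≤ z≤0) (ℚ.neg-antimono-≤ z≤0))
      (ℚ.≤-reflexive (solve 1 (λ z → (:- z) :* (:- z) := z :* z) refl z))

  module Covering (field′ : FiniteField) (k : ℕ) where
    open FiniteField field′
    open Finite finite using (_≟_)
    open LinearAlgebra field′

    -- Asking for -y as a subset sum makes the equation homogeneous in (y, a); over all y this is
    -- the same as covering.
    Covers : Vec F k → Set
    Covers a = ∀ y → ∃ λ S → y ⊕ bdot S a ≡ 0F

    covers? : ∀ a → Dec (Covers a)
    covers? a with Finite.∃⊎∀ finite (λ y → uncovered? y)
      where
      uncovered? : ∀ y → Dec (∀ S → y ⊕ bdot S a ≢ 0F)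
      uncovered? y with Finite.∃⊎∀ (cube k) (λ S → y ⊕ bdot S a ≟ 0F)
      ... | inj₁ (S , eq) = no λ none → none S eq
      ... | inj₂ none = yes none
    ... | inj₁ (y , none) = no λ cov → none (proj₁ (cov y)) (proj₂ (cov y))
    ... | inj₂ h = yes cov
      where
      cov : Covers a
      cov y with Finite.∃⊎∀ (cube k) (λ S → y ⊕ bdot S a ≟ 0F)
      ... | inj₁ found = found
      ... | inj₂ none = contradiction none (h y)

    coverCount : ℕ
    coverCount = sum (finFⁿ k) (λ a → 𝟙 (covers? a))

  module SecondMoments (field′ : FiniteField) (k R : ℕ) where
    open FiniteField field′
    open Finite finite using (_≟_)
    open LinearAlgebra field′
    open RelationCounting field′
    open UniqueRows field′
    open Covering field′ k

    K : ℕ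
    K = suc (suc k)

    relationCount : ∀ {t n} → Vec (Vec Bool t) n → ℕ
    relationCount rows = ∣ relations rows ∣

    private
      L = Finite.elems (cube k)
      ys = Finite.elems finite
      as = Finite.elems (finFⁿ k)
      fam = family R L

      x : ℚ
      x = inv (ι q)

      0<q : 0ℚ < ι q
      0<q = 0<ι (ℕ.<⇒≤ 1<card)

      0≤x : 0ℚ ≤ x
      0≤x = ℚ.<⇒≤ (0<inv 0<q)

      x^q^ : ∀ n → x ^^ n * ι (q ℕ.^ n) ≡ 1ℚ
      x^q^ n = trans (cong (x ^^ n *_) (ι-^ q n)) (trans (sym (^^-distrib-* x (ι q) n))
        (trans (cong (_^^ n) (trans (ℚ.*-comm x (ι q)) (inv-right 0<q))) (1^^ n)))

    main : ℚ
    main = bonferroni R (λ _ → x) L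

    hit : F → Vec F k → Vec Bool k → ℚ
    hit y a S = ι (𝟙 (y ⊕ bdot S a ≟ 0F))

    private
      -- The two extra coordinates carry the targets: with b = (y , y′ , a) the equations
      -- y + a·S = 0 and y′ + a·S′ = 0 become homogeneous, and rows belonging to different
      -- targets are distinct.
      ext₁ ext₂ : Vec Bool k → Vec Bool K
      ext₁ S = true ∷ false ∷ S
      ext₂ S = false ∷ true ∷ S

      solutions : ∀ {n} → Vec (Vec Bool K) n → ℕ
      solutions rows = sum (finFⁿ K) (λ b → 𝟙 (eval rows b ≟ⱽ 0V))

      -- The centre `x ^^ i` is the probability that `i` independent uniform sums all hit. It need
      -- not be the true mean, which is why `d₁` and `d₂` appear in `inner-value`.
      deviation : (∃ λ i → Vec (Vec Bool k) i) → F → Vec F k → ℚ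
      deviation (i , S) y a = prod (hit y a) S - x ^^ i

      X : Vec F k → ℚ
      X a = ∑ℚ ys (λ y → bonferroni R (hit y a) L - main)

      G : (∃ λ i → Vec (Vec Bool k) i) → Vec F k → ℚ
      G φ a = ∑ℚ ys (λ y → deviation φ y a)

      inner : (φ φ′ : ∃ λ i → Vec (Vec Bool k) i) → ℚ
      inner φ φ′ = ∑ℚ ys (λ y → ∑ℚ ys (λ y′ → ∑ℚ as (λ a → deviation φ y a * deviation φ′ y′ a)))

      variance : ℚ
      variance = ∑ℚ as (λ a → X a * X a)

      X-expand : ∀ a → X a ≡ ∑ℚ fam (λ φ → sgn (proj₁ φ) * G φ a)
      X-expand a = trans (∑ℚ-cong ys (λ y → trans
          (cong₂ _-_ (bonferroni-family R (hit y a) L) (bonferroni-family R (λ _ → x) L))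
          (trans (trans (cong (∑ℚ fam (λ (i , S) → sgn i * prod (hit y a) S) +_) (neg-∑ fam _))
                        (sym (∑ℚ-+ fam _ _)))
            (∑ℚ-cong fam (λ (i , S) → trans
              (solve 3 (λ s a b → s :* a :+ (:- (s :* b)) := s :* (a :- b)) refl (sgn i) (prod (hit y a) S) (prod (λ _ → x) S))
              (cong (λ t → sgn i * (prod (hit y a) S - t)) (prod-const x S)))))))
        (trans (∑ℚ-swap ys fam _) (∑ℚ-cong fam (λ φ → ∑ℚ-*ˡ ys (sgn (proj₁ φ)) _)))
        where
        neg-∑ : ∀ {A : Set} (xs : List A) f → - ∑ℚ xs f ≡ ∑ℚ xs (λ x → - f x)
        neg-∑ [] f = refl
        neg-∑ (x ∷ xs) f = trans (ℚ.neg-distrib-+ (f x) (∑ℚ xs f)) (cong (- f x +_) (neg-∑ xs f))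

      G-product : ∀ φ φ′ → ∑ℚ as (λ a → G φ a * G φ′ a) ≡ inner φ φ′
      G-product φ φ′ = trans
        (∑ℚ-cong as (λ a → ∑ℚ-product ys ys (λ y → deviation φ y a) (λ y → deviation φ′ y a)))
        (trans (∑ℚ-swap as ys _) (∑ℚ-cong ys (λ y → ∑ℚ-swap as ys _)))

      variance-expand : variance ≡ ∑ℚ fam (λ φ → ∑ℚ fam (λ φ′ → sgn (proj₁ φ) * (sgn (proj₁ φ′) * inner φ φ′)))
      variance-expand = trans
        (∑ℚ-cong as (λ a → trans (cong₂ _*_ (X-expand a) (X-expand a)) (∑ℚ-product fam fam _ _)))
        (trans (∑ℚ-swap as fam _) (∑ℚ-cong fam (λ φ → trans (∑ℚ-swap as fam _) (∑ℚ-cong fam (λ φ′ →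
          trans (∑ℚ-cong as (λ a → solve 4 (λ s g s′ g′ → (s :* g) :* (s′ :* g′) := (s :* s′) :* (g :* g′)) refl
                  (sgn (proj₁ φ)) (G φ a) (sgn (proj₁ φ′)) (G φ′ a)))
            (trans (∑ℚ-*ˡ as (sgn (proj₁ φ) * sgn (proj₁ φ′)) _)
              (trans (cong (sgn (proj₁ φ) * sgn (proj₁ φ′) *_) (G-product φ φ′))
                     (ℚ.*-assoc (sgn (proj₁ φ)) (sgn (proj₁ φ′)) (inner φ φ′)))))))))

      𝟙-∷ : ∀ {n} u (v : Vec F n) → 𝟙 ((u ∷ v) ≟ⱽ 0V) ≡ 𝟙 (u ≟ 0F) ℕ.* 𝟙 (v ≟ⱽ 0V)
      𝟙-∷ u v = trans (𝟙-⇔ ((u ∷ v) ≟ⱽ 0V) ((u ≟ 0F) ×-dec (v ≟ⱽ 0V)) Vecₚ.∷-injective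
        (λ (p , q) → cong₂ _∷_ p q)) (𝟙-× (u ≟ 0F) (v ≟ⱽ 0V))

      prod-hit₂ : ∀ {i} (S : Vec (Vec Bool k) i) y y′ a →
        prod (hit y′ a) S ≡ ι (𝟙 (eval (Vec.map ext₂ S) (y ∷ y′ ∷ a) ≟ⱽ 0V))
      prod-hit₂ [] y y′ a = refl
      prod-hit₂ (S ∷ F) y y′ a = trans (cong (hit y′ a S *_) (prod-hit₂ F y y′ a))
        (trans (sym (ι-* (𝟙 (y′ ⊕ bdot S a ≟ 0F)) _)) (cong ι (sym (𝟙-∷ (y′ ⊕ bdot S a) _))))

      prod-hit : ∀ {i i′} (S : Vec (Vec Bool k) i) (S′ : Vec (Vec Bool k) i′) y y′ a →
        prod (hit y a) S * prod (hit y′ a) S′ ≡ ι (𝟙 (eval (Vec.map ext₁ S Vec.++ Vec.map ext₂ S′) (y ∷ y′ ∷ a) ≟ⱽ 0V))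
      prod-hit [] F′ y y′ a = trans (ℚ.*-identityˡ _) (prod-hit₂ F′ y y′ a)
      prod-hit (S ∷ F) F′ y y′ a = trans (ℚ.*-assoc (hit y a S) _ _)
        (trans (cong (hit y a S *_) (prod-hit F F′ y y′ a))
          (trans (sym (ι-* (𝟙 (y ⊕ bdot S a ≟ 0F)) _)) (cong ι (sym (𝟙-∷ (y ⊕ bdot S a) _)))))

      prod-hit₁ : ∀ {i} (S : Vec (Vec Bool k) i) y y′ a →
        prod (hit y a) S ≡ ι (𝟙 (eval (Vec.map ext₁ S) (y ∷ y′ ∷ a) ≟ⱽ 0V))
      prod-hit₁ [] y y′ a = refl
      prod-hit₁ (S ∷ F) y y′ a = trans (cong (hit y a S *_) (prod-hit₁ F y y′ a))
        (trans (sym (ι-* (𝟙 (y ⊕ bdot S a ≟ 0F)) _)) (cong ι (sym (𝟙-∷ (y ⊕ bdot S a) _))))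

      ∑³ : (F → F → Vec F k → ℚ) → ℚ
      ∑³ f = ∑ℚ ys (λ y → ∑ℚ ys (λ y′ → ∑ℚ as (λ a → f y y′ a)))

      ∑³-cong : ∀ {f g : F → F → Vec F k → ℚ} → (∀ y y′ a → f y y′ a ≡ g y y′ a) → ∑³ f ≡ ∑³ g
      ∑³-cong h = ∑ℚ-cong ys (λ y → ∑ℚ-cong ys (λ y′ → ∑ℚ-cong as (λ a → h y y′ a)))

      ∑³-+ : ∀ f g → ∑³ (λ y y′ a → f y y′ a + g y y′ a) ≡ ∑³ f + ∑³ g
      ∑³-+ f g = trans (∑ℚ-cong ys (λ y → trans (∑ℚ-cong ys (λ y′ → ∑ℚ-+ as _ _)) (∑ℚ-+ ys _ _))) (∑ℚ-+ ys _ _)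

      ∑³-*ˡ : ∀ c f → ∑³ (λ y y′ a → c * f y y′ a) ≡ c * ∑³ f
      ∑³-*ˡ c f = trans (∑ℚ-cong ys (λ y → trans (∑ℚ-cong ys (λ y′ → ∑ℚ-*ˡ as c _)) (∑ℚ-*ˡ ys c _))) (∑ℚ-*ˡ ys c _)

      ∑³-ι : ∀ (f : Vec F K → ℕ) → ∑³ (λ y y′ a → ι (f (y ∷ y′ ∷ a))) ≡ ι (sum (finFⁿ K) f)
      ∑³-ι f = sym (trans (cong ι (trans (sum-vec finite (suc k) f) (∑-cong ys (λ y → sum-vec finite k _))))
        (trans (ι-∑ ys _) (∑ℚ-cong ys (λ y → trans (ι-∑ ys _) (∑ℚ-cong ys (λ y′ → ι-∑ as _))))))

      c : ℚ
      c = ι (q ℕ.^ K)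

      -- By `rank-nullity`, the number of relations is the factor by which the solutions exceed
      -- their independent number.
      ι-solutions : ∀ {n} (rows : Vec (Vec Bool K) n) → ι (solutions rows) ≡ x ^^ n * c * ι (relationCount rows)
      ι-solutions {n} rows = begin
        s ≡⟨ ℚ.*-identityˡ s ⟨
        1ℚ * s ≡⟨ cong (_* s) (x^q^ n) ⟨
        x ^^ n * ι (q ℕ.^ n) * s ≡⟨ ℚ.*-assoc (x ^^ n) _ _ ⟩
        x ^^ n * (ι (q ℕ.^ n) * s) ≡⟨ cong (x ^^ n *_) (trans (sym (ι-* (q ℕ.^ n) (solutions rows)))
                                              (trans (cong ι (rank-nullity rows)) (ι-* (q ℕ.^ K) (relationCount rows)))) ⟩
        x ^^ n * (c * ι (relationCount rows)) ≡⟨ ℚ.*-assoc (x ^^ n) _ _ ⟨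
        x ^^ n * c * ι (relationCount rows) ∎
        where
        open ≡-Reasoning
        s = ι (solutions rows)

      combined : ∀ {i i′} → Vec (Vec Bool k) i → Vec (Vec Bool k) i′ → Vec (Vec Bool K) (i ℕ.+ i′)
      combined S S′ = Vec.map ext₁ S Vec.++ Vec.map ext₂ S′

      inner-value : ∀ {i i′} (S : Vec (Vec Bool k) i) (S′ : Vec (Vec Bool k) i′) →
        inner (i , S) (i′ , S′) ≡ x ^^ (i ℕ.+ i′) * c *
          (ι (relationCount (combined S S′)) - ι (relationCount (Vec.map ext₁ S)) - ι (relationCount (Vec.map ext₂ S′)) + 1ℚ)
      inner-value {i} {i′} S S′ = begin
        ∑³ (λ y y′ a → (u y y′ a - α) * (v y y′ a - β))
          ≡⟨ ∑³-cong (λ y y′ a → trans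
               (solve 4 (λ u v α β → (u :- α) :* (v :- β) := u :* v :+ ((:- β) :* u :+ ((:- α) :* v :+ (α :* β) :* con 1ℚ))) refl
                 (u y y′ a) (v y y′ a) α β)
               (cong₂ _+_ (prod-hit S S′ y y′ a)
                 (cong₂ (λ u v → - β * u + (- α * v + α * β * 1ℚ)) (prod-hit₁ S y y′ a) (prod-hit₂ S′ y y′ a)))) ⟩
        ∑³ (λ y y′ a → ι (f₁₂ (y ∷ y′ ∷ a)) + (- β * ι (f₁ (y ∷ y′ ∷ a)) + (- α * ι (f₂ (y ∷ y′ ∷ a)) + α * β * ι 1)))
          ≡⟨ trans (∑³-+ g₁₂ (λ y y′ a → g₁ y y′ a + (g₂ y y′ a + g₀ y y′ a)))
               (cong (∑³ g₁₂ +_) (trans (∑³-+ g₁ (λ y y′ a → g₂ y y′ a + g₀ y y′ a)) (cong (∑³ g₁ +_) (∑³-+ g₂ g₀)))) ⟩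
        ∑³ (λ y y′ a → ι (f₁₂ (y ∷ y′ ∷ a))) + (∑³ (λ y y′ a → - β * ι (f₁ (y ∷ y′ ∷ a))) +
          (∑³ (λ y y′ a → - α * ι (f₂ (y ∷ y′ ∷ a))) + ∑³ (λ y y′ a → α * β * ι 1)))
          ≡⟨ cong₂ _+_ (∑³-ι f₁₂) (cong₂ _+_ (trans (∑³-*ˡ (- β) _) (cong (- β *_) (∑³-ι f₁)))
               (cong₂ _+_ (trans (∑³-*ˡ (- α) _) (cong (- α *_) (∑³-ι f₂)))
                 (trans (∑³-*ˡ (α * β) _) (cong (α * β *_) (trans (∑³-ι (λ _ → 1)) (cong ι (card-Vec finite K))))))) ⟩
        ι (solutions (combined S S′)) + (- β * ι (solutions (Vec.map ext₁ S)) + (- α * ι (solutions (Vec.map ext₂ S′)) + α * β * c))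
          ≡⟨ cong₂ _+_ (trans (ι-solutions (combined S S′)) (cong (λ t → t * c * ι d₁₂) (^^-+ x i i′)))
               (cong₂ (λ s t → - β * s + (- α * t + α * β * c)) (ι-solutions (Vec.map ext₁ S)) (ι-solutions (Vec.map ext₂ S′))) ⟩
        α * β * c * ι d₁₂ + (- β * (α * c * ι d₁) + (- α * (β * c * ι d₂) + α * β * c))
          ≡⟨ solve 6 (λ α β c d₁₂ d₁ d₂ → α :* β :* c :* d₁₂ :+ ((:- β) :* (α :* c :* d₁) :+ ((:- α) :* (β :* c :* d₂) :+ α :* β :* c))
               := α :* β :* c :* (d₁₂ :- d₁ :- d₂ :+ con 1ℚ)) refl α β c (ι d₁₂) (ι d₁) (ι d₂) ⟩
        α * β * c * (ι d₁₂ - ι d₁ - ι d₂ + 1ℚ)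
          ≡⟨ cong (λ t → t * c * (ι d₁₂ - ι d₁ - ι d₂ + 1ℚ)) (^^-+ x i i′) ⟨
        x ^^ (i ℕ.+ i′) * c * (ι d₁₂ - ι d₁ - ι d₂ + 1ℚ) ∎
        where
        open ≡-Reasoning
        α = x ^^ i
        β = x ^^ i′
        u v : F → F → Vec F k → ℚ
        u y y′ a = prod (hit y a) S
        v y y′ a = prod (hit y′ a) S′
        f₁₂ f₁ f₂ : Vec F K → ℕ
        f₁₂ b = 𝟙 (eval (combined S S′) b ≟ⱽ 0V)
        f₁ b = 𝟙 (eval (Vec.map ext₁ S) b ≟ⱽ 0V)
        f₂ b = 𝟙 (eval (Vec.map ext₂ S′) b ≟ⱽ 0V)
        g₁₂ g₁ g₂ g₀ : F → F → Vec F k → ℚ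
        g₁₂ y y′ a = ι (f₁₂ (y ∷ y′ ∷ a))
        g₁ y y′ a = - β * ι (f₁ (y ∷ y′ ∷ a))
        g₂ y y′ a = - α * ι (f₂ (y ∷ y′ ∷ a))
        g₀ y y′ a = α * β * ι 1
        d₁₂ = (relationCount (combined S S′))
        d₁ = (relationCount (Vec.map ext₁ S))
        d₂ = (relationCount (Vec.map ext₂ S′))

      ∣relations∣-∷ : ∀ {n} S (rows : Vec (Vec Bool K) n) → (relationCount rows) ℕ.≤ (relationCount (S ∷ rows))
      ∣relations∣-∷ {n} S rows = ℕ.≤-trans
        (ℕ.≤-reflexive (∑-cong (Finite.elems (finFⁿ n)) (λ cs → cong (λ t → 𝟙 (t ≟ⱽ 0V)) (sym (combo-0∷ S rows cs)))))
        (ℕ.≤-trans (∑-term (λ α → ∑ (Finite.elems (finFⁿ n)) (λ cs → 𝟙 (combo (S ∷ rows) (α ∷ cs) ≟ⱽ 0V))) (Finite.∈-elems finite 0F))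
                   (ℕ.≤-reflexive (sym (sum-vec finite n _))))

      ∣relations∣-++ʳ : ∀ {m n} (F : Vec (Vec Bool K) m) (G : Vec (Vec Bool K) n) → (relationCount G) ℕ.≤ (relationCount (F Vec.++ G))
      ∣relations∣-++ʳ [] G = ℕ.≤-refl
      ∣relations∣-++ʳ (S ∷ F) G = ℕ.≤-trans (∣relations∣-++ʳ F G) (∣relations∣-∷ S (F Vec.++ G))

      solutions-++ : ∀ {m n} (F : Vec (Vec Bool K) m) (G : Vec (Vec Bool K) n) b →
        𝟙 (eval (F Vec.++ G) b ≟ⱽ 0V) ≡ 𝟙 (eval F b ≟ⱽ 0V) ℕ.* 𝟙 (eval G b ≟ⱽ 0V)
      solutions-++ [] G b = sym (ℕ.+-identityʳ _)
      solutions-++ (S ∷ F) G b = trans (𝟙-∷ (bdot S b) _) (trans (cong (𝟙 (bdot S b ≟ 0F) ℕ.*_) (solutions-++ F G b))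
        (trans (sym (ℕ.*-assoc (𝟙 (bdot S b ≟ 0F)) _ _)) (cong (ℕ._* 𝟙 (eval G b ≟ⱽ 0V)) (sym (𝟙-∷ (bdot S b) _)))))

      -- Solutions do not depend on the order of the equations, and `rank-nullity` transfers this to
      -- relations without permuting coefficients.
      ∣relations∣-comm : ∀ {m n} (F : Vec (Vec Bool K) m) (G : Vec (Vec Bool K) n) → (relationCount (F Vec.++ G)) ≡ (relationCount (G Vec.++ F))
      ∣relations∣-comm {m} {n} F G = ℕ.*-cancelˡ-≡ _ _ (q ℕ.^ K) {{ℕ.m^n≢0 q K}}
        (trans (sym (rank-nullity (F Vec.++ G))) (trans
          (cong₂ ℕ._*_ (cong (q ℕ.^_) (ℕ.+-comm m n)) (∑-cong (Finite.elems (finFⁿ K)) (λ b →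
            trans (solutions-++ F G b) (trans (ℕ.*-comm (𝟙 (eval F b ≟ⱽ 0V)) _) (sym (solutions-++ G F b))))))
          (rank-nullity (G Vec.++ F))))

      1≤∣relations∣ : ∀ {n} (rows : Vec (Vec Bool K) n) → 1 ℕ.≤ (relationCount rows)
      1≤∣relations∣ {n} rows = ℕ.≤-trans (ℕ.≤-reflexive (sym (𝟙-yes (Subspace.mem? (relations rows) 0V) (combo-0 rows))))
        (∑-term (λ c → 𝟙 (Subspace.mem? (relations rows) c)) (Finite.∈-elems (finFⁿ n) 0V))

      -- Since `d₁` and `d₂` lie between 1 and `d₁₂`, the number d₁₂ - d₁ - d₂ + 1 has absolute
      -- value at most d₁₂ - 1. The signs of inclusion-exclusion are given away here.
      inner-bound : ∀ {i i′} (S : Vec (Vec Bool k) i) (S′ : Vec (Vec Bool k) i′) →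
        let B = x ^^ (i ℕ.+ i′) * c * ι ((relationCount (combined S S′)) ℕ.∸ 1) in
        sgn i * (sgn i′ * inner (i , S) (i′ , S′)) ≤ B
      inner-bound {i} {i′} S S′ = proj₁ (sgn-bound i (proj₁ inner±) (proj₂ inner±))
        where
        d₁₂ = (relationCount (combined S S′))
        d₁ = (relationCount (Vec.map ext₁ S))
        d₂ = (relationCount (Vec.map ext₂ S′))
        0≤xc : 0ℚ ≤ x ^^ (i ℕ.+ i′) * c
        0≤xc = *-nonneg (0≤^^ 0≤x (i ℕ.+ i′)) (0≤ι (q ℕ.^ K))
        pred≡ : ι (d₁₂ ℕ.∸ 1) ≡ ι d₁₂ - 1ℚ
        pred≡ = trans (solve 1 (λ a → a := (con 1ℚ :+ a) :- con 1ℚ) refl (ι (d₁₂ ℕ.∸ 1)))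
          (cong (_- 1ℚ) (trans (sym (ι-suc (d₁₂ ℕ.∸ 1))) (cong ι (ℕ.m+[n∸m]≡n (1≤∣relations∣ (combined S S′))))))
        d₁≤ : ι d₁ ≤ ι d₁₂
        d₁≤ = ι-mono (ℕ.≤-trans (∣relations∣-++ʳ (Vec.map ext₂ S′) (Vec.map ext₁ S))
                                (ℕ.≤-reflexive (∣relations∣-comm (Vec.map ext₂ S′) (Vec.map ext₁ S))))
        d₂≤ : ι d₂ ≤ ι d₁₂
        d₂≤ = ι-mono (∣relations∣-++ʳ (Vec.map ext₁ S) (Vec.map ext₂ S′))
        1≤d₁ : 1ℚ ≤ ι d₁
        1≤d₁ = ι-mono (1≤∣relations∣ (Vec.map ext₁ S))
        1≤d₂ : 1ℚ ≤ ι d₂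
        1≤d₂ = ι-mono (1≤∣relations∣ (Vec.map ext₂ S′))
        z = ι d₁₂ - ι d₁ - ι d₂ + 1ℚ
        z≤ : z ≤ ι d₁₂ - 1ℚ
        z≤ = ℚ.≤-trans (ℚ.+-monoˡ-≤ 1ℚ (ℚ.+-mono-≤ (ℚ.+-monoʳ-≤ (ι d₁₂) (ℚ.neg-antimono-≤ 1≤d₁)) (ℚ.neg-antimono-≤ 1≤d₂)))
          (ℚ.≤-reflexive (solve 1 (λ d → d :- con 1ℚ :- con 1ℚ :+ con 1ℚ := d :- con 1ℚ) refl (ι d₁₂)))
        -z≤ : - z ≤ ι d₁₂ - 1ℚ
        -z≤ = ℚ.≤-trans (ℚ.≤-reflexive (solve 3 (λ d a b → :- (d :- a :- b :+ con 1ℚ) := (a :+ b) :- (d :+ con 1ℚ)) refl (ι d₁₂) (ι d₁) (ι d₂)))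
          (ℚ.≤-trans (ℚ.+-monoˡ-≤ (- (ι d₁₂ + 1ℚ)) (ℚ.+-mono-≤ d₁≤ d₂≤))
            (ℚ.≤-reflexive (solve 1 (λ d → (d :+ d) :- (d :+ con 1ℚ) := d :- con 1ℚ) refl (ι d₁₂))))
        B = x ^^ (i ℕ.+ i′) * c * ι (d₁₂ ℕ.∸ 1)
        inner≤ : inner (i , S) (i′ , S′) ≤ B
        inner≤ = ℚ.≤-trans (ℚ.≤-reflexive (inner-value S S′))
          (ℚ.≤-trans (*-monoʳ 0≤xc z≤) (ℚ.≤-reflexive (cong (x ^^ (i ℕ.+ i′) * c *_) (sym pred≡))))
        -inner≤ : - inner (i , S) (i′ , S′) ≤ B
        -inner≤ = ℚ.≤-trans (ℚ.≤-reflexive (trans (cong -_ (inner-value S S′))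
            (solve 2 (λ a z → :- (a :* z) := a :* (:- z)) refl (x ^^ (i ℕ.+ i′) * c) z)))
          (ℚ.≤-trans (*-monoʳ 0≤xc -z≤) (ℚ.≤-reflexive (cong (x ^^ (i ℕ.+ i′) * c *_) (sym pred≡))))
        inner± = sgn-bound i′ inner≤ -inner≤

      -- Rows of one block are distinct as sublists have no repetitions; rows of different blocks
      -- differ in the two extra coordinates, which also keep every row nonzero.
      combined-good : ∀ {i i′} {S : Vec (Vec Bool k) i} {S′ : Vec (Vec Bool k) i′} → Unique S → Unique S′ →
                      Good (Subspace.Mem (relations (combined S S′)))
      combined-good {S = S} {S′} u u′ = unique⇒good
        (AllPairsₚ.++⁺ (AllPairsₚ.map⁺ (AllPairs.map (λ ≢ eq → ≢ (cong (λ v → Vec.tail (Vec.tail v)) eq)) u))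
                       (AllPairsₚ.map⁺ (AllPairs.map (λ ≢ eq → ≢ (cong (λ v → Vec.tail (Vec.tail v)) eq)) u′))
                       (VecAllₚ.map⁺ (VecAll.universal (λ _ → VecAllₚ.map⁺ (VecAll.universal (λ _ ()) S′)) S)))
        (VecAllₚ.++⁺ (VecAllₚ.map⁺ (VecAll.universal (λ _ ()) S)) (VecAllₚ.map⁺ (VecAll.universal (λ _ ()) S′)))

      E : (φ φ′ : ∃ λ i → Vec (Vec Bool k) i) → ℚ
      E (i , S) (i′ , S′) = x ^^ (i ℕ.+ i′) * c * ι (excess (combined S S′))

      variance-bound : variance ≤ ∑ℚ fam (λ φ → ∑ℚ fam (E φ))
      variance-bound = ℚ.≤-trans (ℚ.≤-reflexive variance-expand)
        (∑ℚ-mono-All (ListAll.map (λ {φ} u → ∑ℚ-mono-All (ListAll.map (λ {φ′} u′ → bound φ φ′ u u′) unique)) unique))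
        where
        unique : ListAll.All (λ φ → Unique (proj₂ φ)) fam
        unique = family-All R (λ i → sublists-Unique i (elems-Unique (cube k)))
        bound : ∀ φ φ′ → Unique (proj₂ φ) → Unique (proj₂ φ′) →
                sgn (proj₁ φ) * (sgn (proj₁ φ′) * inner φ φ′) ≤ E φ φ′
        bound (i , S) (i′ , S′) u u′ = ℚ.≤-trans (inner-bound S S′)
          (*-monoʳ (*-nonneg (0≤^^ 0≤x (i ℕ.+ i′)) (0≤ι (q ℕ.^ K))) (ι-mono (ℕ.≤-reflexive (sym
            (trans (cong (ℕ._* ((relationCount (combined S S′)) ℕ.∸ 1)) (𝟙-yes (good? (Subspace.mem? (relations (combined S S′)))) (combined-good u u′)))
                   (ℕ.*-identityˡ _))))))

    module _ (Y : ℕ) (2^K≤ : 2 ℕ.^ K ℕ.≤ Y ℕ.* q) where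
      -- What `excess-sum` leaves beside q^n, at the largest number n = 2R of rows.
      errorWeight : ℕ
      errorWeight = 2 ℕ.* R ℕ.* (3 ℕ.^ K ℕ.* (K ℕ.* (4 ℕ.* 2 ℕ.^ (2 ℕ.* R)) ℕ.* Y) ℕ.^ (2 ℕ.* R))

      private
        weight : ℕ → ℕ
        weight n = n ℕ.* (3 ℕ.^ K ℕ.* (K ℕ.* (4 ℕ.* 2 ℕ.^ n) ℕ.* Y) ℕ.^ n)

        1≤Y : 1 ℕ.≤ Y
        1≤Y = positive 2^K≤
          where
          positive : ∀ {Y} → 2 ℕ.^ K ℕ.≤ Y ℕ.* q → 1 ℕ.≤ Y
          positive {zero} h = contradiction (ℕ.≤-trans (ℕ.m^n>0 2 K) h) λ ()
          positive {suc _} _ = ℕ.s≤s ℕ.z≤n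

        weight≤ : ∀ {n} → n ℕ.≤ 2 ℕ.* R → weight n ℕ.≤ errorWeight
        weight≤ {n} n≤ = ℕ.*-mono-≤ n≤ (ℕ.*-monoʳ-≤ (3 ℕ.^ K) (ℕ.≤-trans
          (ℕ.^-monoˡ-≤ n base≤) (ℕ.^-monoʳ-≤ _ {{ℕ.>-nonZero 1≤base}} n≤)))
          where
          base≤ : K ℕ.* (4 ℕ.* 2 ℕ.^ n) ℕ.* Y ℕ.≤ K ℕ.* (4 ℕ.* 2 ℕ.^ (2 ℕ.* R)) ℕ.* Y
          base≤ = ℕ.*-monoˡ-≤ Y (ℕ.*-monoʳ-≤ K (ℕ.*-monoʳ-≤ 4 (ℕ.^-monoʳ-≤ 2 n≤)))
          1≤base : 1 ℕ.≤ K ℕ.* (4 ℕ.* 2 ℕ.^ (2 ℕ.* R)) ℕ.* Y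
          1≤base = ℕ.*-mono-≤ {1} {K ℕ.* (4 ℕ.* 2 ℕ.^ (2 ℕ.* R))} (ℕ.*-mono-≤ {1} {K} (ℕ.s≤s ℕ.z≤n)
            (ℕ.*-mono-≤ {1} {4} (ℕ.s≤s ℕ.z≤n) (ℕ.m^n>0 2 (2 ℕ.* R)))) 1≤Y

        -- The normalisation `x ^^ n` cancels the q^n of `excess-sum`; only the size `c` of the
        -- sample space is left.
        pairs : ∀ i i′ → i ℕ.< R → i′ ℕ.< R →
          ι (4 ℕ.^ K) * ∑ℚ (sublists i′ L) (λ S′ → ∑ℚ (sublists i L) (λ S → E (i , S) (i′ , S′))) ≤ c * ι errorWeight
        pairs i i′ i<R i′<R = ℚ.≤-trans (ℚ.≤-reflexive eq) (ℚ.≤-trans (*-monoʳ 0≤xc (ι-mono scaled≤)) (ℚ.≤-trans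
            (ℚ.≤-reflexive eq′) (*-monoʳ (0≤ι (q ℕ.^ K)) (ι-mono (weight≤ n≤)))))
          where
          n = i ℕ.+ i′
          n≤ : n ℕ.≤ 2 ℕ.* R
          n≤ = ℕ.+-mono-≤ (ℕ.<⇒≤ i<R) (ℕ.≤-trans (ℕ.<⇒≤ i′<R) (ℕ.≤-reflexive (sym (ℕ.+-identityʳ R))))
          0≤xc : 0ℚ ≤ x ^^ n * c
          0≤xc = *-nonneg (0≤^^ 0≤x n) (0≤ι (q ℕ.^ K))
          total = ∑ (sublists i′ L) (λ S′ → ∑ (sublists i L) (λ S → excess (combined S S′)))
          eq : ι (4 ℕ.^ K) * ∑ℚ (sublists i′ L) (λ S′ → ∑ℚ (sublists i L) (λ S → E (i , S) (i′ , S′))) ≡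
               x ^^ n * c * ι (4 ℕ.^ K ℕ.* total)
          eq = trans (cong (ι (4 ℕ.^ K) *_) (trans
            (∑ℚ-cong (sublists i′ L) (λ S′ → trans (∑ℚ-*ˡ (sublists i L) (x ^^ n * c) _)
              (cong (x ^^ n * c *_) (sym (ι-∑ (sublists i L) (λ S → excess (combined S S′)))))))
            (trans (∑ℚ-*ˡ (sublists i′ L) (x ^^ n * c) _) (cong (x ^^ n * c *_) (sym (ι-∑ (sublists i′ L) _))))))
            (trans (solve 3 (λ f a t → f :* (a :* t) := a :* (f :* t)) refl (ι (4 ℕ.^ K)) (x ^^ n * c) (ι total))
                   (cong (x ^^ n * c *_) (sym (ι-* (4 ℕ.^ K) total))))
          total≤ : total ℕ.≤ sum (finVec (cube K) n) excess
          total≤ = ℕ.≤-trans (ℕ.≤-reflexive (∑-swap (sublists i′ L) (sublists i L) _))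
            (ℕ.≤-trans (∑-sublists i L _) (ℕ.≤-trans
              (∑-mono (vecs L i) (λ S → ∑-sublists i′ L _))
              (∑-blocks (cube k) (cube K) {ext₁} {ext₂} (λ eq → cong (λ v → Vec.tail (Vec.tail v)) eq)
                (λ eq → cong (λ v → Vec.tail (Vec.tail v)) eq) i i′ excess)))
          scaled≤ : 4 ℕ.^ K ℕ.* total ℕ.≤ q ℕ.^ n ℕ.* weight n
          scaled≤ = ℕ.≤-trans (ℕ.*-monoʳ-≤ (4 ℕ.^ K) total≤) (ℕ.≤-trans
            (excess-sum K n Y (ℕ.s≤s ℕ.z≤n) 2^K≤) (ℕ.≤-reflexive (swap n (q ℕ.^ n) _)))
            where
            swap : ∀ a b d → a ℕ.* (b ℕ.* d) ≡ b ℕ.* (a ℕ.* d)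
            swap a b d = trans (sym (ℕ.*-assoc a b d)) (trans (cong (ℕ._* d) (ℕ.*-comm a b)) (ℕ.*-assoc b a d))
          eq′ : x ^^ n * c * ι (q ℕ.^ n ℕ.* weight n) ≡ c * ι (weight n)
          eq′ = trans (cong (x ^^ n * c *_) (ι-* (q ℕ.^ n) (weight n)))
            (trans (solve 4 (λ a b d e → a :* b :* (d :* e) := (a :* d) :* (b :* e)) refl (x ^^ n) c (ι (q ℕ.^ n)) (ι (weight n)))
              (trans (cong (_* (c * ι (weight n))) (x^q^ n)) (ℚ.*-identityˡ _)))

        variance-total : ι (4 ℕ.^ K) * variance ≤ ι R * (ι R * (c * ι errorWeight))
        variance-total = ℚ.≤-trans (*-monoʳ (0≤ι (4 ℕ.^ K)) variance-bound) (ℚ.≤-trans (ℚ.≤-reflexive eq)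
          (sumTo-upper R (λ i i<R → ℚ.≤-trans (ℚ.≤-reflexive (eq′ i)) (sumTo-upper R (λ i′ i′<R → pairs i i′ i<R i′<R)))))
          where
          f = ι (4 ℕ.^ K)
          eq : f * ∑ℚ fam (λ φ → ∑ℚ fam (E φ)) ≡ sumTo R (λ i → ∑ℚ (sublists i L) (λ S → f * ∑ℚ fam (E (i , S))))
          eq = trans (sym (∑ℚ-*ˡ fam f _)) (∑ℚ-family R L (λ φ → f * ∑ℚ fam (E φ)))
          eq′ : ∀ i → ∑ℚ (sublists i L) (λ S → f * ∑ℚ fam (E (i , S))) ≡
                sumTo R (λ i′ → f * ∑ℚ (sublists i′ L) (λ S′ → ∑ℚ (sublists i L) (λ S → E (i , S) (i′ , S′))))
          eq′ i = trans (∑ℚ-*ˡ (sublists i L) f _) (trans (cong (f *_) (∑ℚ-swap (sublists i L) fam _))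
            (trans (sym (∑ℚ-*ˡ fam f _)) (trans (∑ℚ-family R L _)
              (sumTo-cong R (λ i′ → ∑ℚ-*ˡ (sublists i′ L) f _)))))

      module _ (sgnR : sgn R ≡ 1ℚ) (0≤main : 0ℚ ≤ main) where
        private
          Covers⇒hit : ∀ {a} → Covers a → ∀ y → bonferroni R (hit y a) L ≤ 0ℚ
          Covers⇒hit {a} cov y = ℚ.≤-trans (ℚ.≤-reflexive (trans (sym (ℚ.*-identityˡ _)) (cong (_* bonferroni R (hit y a) L) (sym sgnR))))
            (bonferroni-some (λ S → y ⊕ bdot S a ≟ 0F) R (lose (Finite.∈-elems (cube k) (proj₁ (cov y))) (proj₂ (cov y))))

          X≤ : ∀ {a} → Covers a → X a ≤ - (ι q * main)
          X≤ {a} cov = ℚ.≤-trans (∑ℚ-mono ys (λ y → ℚ.+-monoˡ-≤ (- main) (Covers⇒hit cov y)))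
            (ℚ.≤-reflexive (trans (∑ℚ-const ys (0ℚ - main)) (solve 2 (λ q m → q :* (con 0ℚ :- m) := :- (q :* m)) refl (ι q) main)))

          term : ∀ a → ι (𝟙 (covers? a)) * (ι q * main * (ι q * main)) ≤ X a * X a
          term a = by-case (covers? a)
            where
            by-case : (d : Dec (Covers a)) → ι (𝟙 d) * (ι q * main * (ι q * main)) ≤ X a * X a
            by-case (no _) = ℚ.≤-trans (ℚ.≤-reflexive (ℚ.*-zeroˡ (ι q * main * (ι q * main)))) (square-nonneg (X a))
            by-case (yes cov) = ℚ.≤-trans (ℚ.≤-reflexive (ℚ.*-identityˡ (ι q * main * (ι q * main)))) (ℚ.≤-trans (*-mono 0≤qm qm≤ 0≤qm qm≤)
              (ℚ.≤-reflexive (solve 1 (λ z → (:- z) :* (:- z) := z :* z) refl (X a))))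
              where
              0≤qm = *-nonneg (0≤ι q) 0≤main
              qm≤ : ι q * main ≤ - X a
              qm≤ = ℚ.≤-trans (ℚ.≤-reflexive (solve 1 (λ z → z := :- (:- z)) refl (ι q * main))) (ℚ.neg-antimono-≤ (X≤ cov))

          -- Chebyshev's inequality: for a covering tuple every truncated sum is at most 0, so `X`
          -- is at most - q · main and its square at least (q · main)².
          chebyshev : ι coverCount * (ι q * main * (ι q * main)) ≤ variance
          chebyshev = ℚ.≤-trans (ℚ.≤-reflexive (trans (cong (_* (ι q * main * (ι q * main))) (ι-∑ as _)) (sym (∑ℚ-*ʳ as _ _))))
            (∑ℚ-mono as term)

        -- The q² in the squared main term cancels the two extra coordinates in c = q^(k+2).
        cover-bound : ι (4 ℕ.^ K) * (ι coverCount * (main * main)) ≤ ι (R ℕ.* (R ℕ.* errorWeight)) * ι (q ℕ.^ k)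
        cover-bound = ℚ.≤-trans (ℚ.≤-reflexive (sym lhs)) (ℚ.≤-trans (*-monoʳ (*-nonneg 0≤x 0≤x)
            (ℚ.≤-trans (*-monoʳ (0≤ι (4 ℕ.^ K)) chebyshev) variance-total)) (ℚ.≤-reflexive rhs))
          where
          xq≡1 : x * ι q ≡ 1ℚ
          xq≡1 = trans (ℚ.*-comm x (ι q)) (inv-right 0<q)
          lhs : x * x * (ι (4 ℕ.^ K) * (ι coverCount * (ι q * main * (ι q * main)))) ≡ ι (4 ℕ.^ K) * (ι coverCount * (main * main))
          lhs = trans (solve 5 (λ x f n q m → x :* x :* (f :* (n :* (q :* m :* (q :* m)))) := (x :* q) :* ((x :* q) :* (f :* (n :* (m :* m))))) refl
                  x (ι (4 ℕ.^ K)) (ι coverCount) (ι q) main)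
            (trans (cong₂ (λ a b → a * (b * (ι (4 ℕ.^ K) * (ι coverCount * (main * main))))) xq≡1 xq≡1)
              (trans (ℚ.*-identityˡ _) (ℚ.*-identityˡ _)))
          rhs : x * x * (ι R * (ι R * (c * ι errorWeight))) ≡ ι (R ℕ.* (R ℕ.* errorWeight)) * ι (q ℕ.^ k)
          rhs = trans (cong (λ t → x * x * (ι R * (ι R * (t * ι errorWeight)))) (trans (ι-* q (q ℕ.* q ℕ.^ k)) (cong (ι q *_) (ι-* q (q ℕ.^ k)))))
            (trans (solve 5 (λ x r q Q w → x :* x :* (r :* (r :* ((q :* (q :* Q)) :* w))) := (x :* q) :* ((x :* q) :* ((r :* (r :* w)) :* Q))) refl
                  x (ι R) (ι q) (ι (q ℕ.^ k)) (ι errorWeight))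
            (trans (cong₂ (λ a b → a * (b * ((ι R * (ι R * ι errorWeight)) * ι (q ℕ.^ k)))) xq≡1 xq≡1)
            (trans (ℚ.*-identityˡ _) (trans (ℚ.*-identityˡ _) (cong (_* ι (q ℕ.^ k))
              (sym (trans (ι-* R (R ℕ.* errorWeight)) (cong (ι R *_) (ι-* R errorWeight)))))))))

-- Numerical estimates for the main term and the error.

module Estimate where

  open import Defs
  open FiniteSums
  open LinAlg
  open Counting using (^-distribʳ-*)
  open Bonferroni
  open SecondMoment
  open import Data.List.Base using (length)
  open import Data.Nat.Base
  open import Data.Nat.Properties
  open import Data.Nat.Tactic.RingSolver using (solve-∀)
  open import Data.Rational.Base as ℚ using (ℚ; 0ℚ; 1ℚ)
  import Data.Rational.Properties as ℚ
  open import Data.Rational.Solver using (module +-*-Solver)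
  open +-*-Solver using (solve; _:+_; _:*_; _:-_; :-_; con; _:=_)
  open RationalLemmas

  ι-reflect : ∀ {m n} → ι m ℚ.≤ ι n → m ≤ n
  ι-reflect {m} {n} h = decidable-stable (m ≤? n) λ m≰n → ℚ.<-irrefl refl (ℚ.<-≤-trans (n<m m≰n) h)
    where
    n<m : ¬ m ≤ n → ι n ℚ.< ι m
    n<m m≰n = ℚ.<-≤-trans (ℚ.<-≤-trans (subst (ℚ._< 1ℚ ℚ.+ ι n) (ℚ.+-identityˡ (ι n)) (ℚ.+-monoˡ-< (ι n) 0<1))
      (ℚ.≤-reflexive (sym (ι-suc n)))) (ι-mono (≰⇒> m≰n))

  -- Bernoulli's inequality (1 - 1/(j+1))^h ≥ 1 - h/(j+1), with denominators cleared.
  bernoulli : ∀ j h → suc j * suc j ^ h ≤ suc j * j ^ h + h * suc j ^ h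
  bernoulli j zero = ≤-reflexive (sym (+-identityʳ _))
  bernoulli j (suc h) = begin
    N * (N * N ^ h) ≤⟨ *-monoʳ-≤ N (bernoulli j h) ⟩
    N * (N * j ^ h + h * N ^ h) ≡⟨ e₁ j (j ^ h) (h * N ^ h) ⟩
    N * (j * j ^ h) + (N * j ^ h + N * (h * N ^ h))
                                               ≤⟨ +-monoʳ-≤ (N * (j * j ^ h)) (+-monoˡ-≤ (N * (h * N ^ h)) (*-monoʳ-≤ N (^-monoˡ-≤ h (n≤1+n j)))) ⟩
    N * (j * j ^ h) + (N * N ^ h + N * (h * N ^ h)) ≡⟨ cong (N * (j * j ^ h) +_) (e₂ N h (N ^ h)) ⟩
    N * (j * j ^ h) + suc h * (N * N ^ h) ∎
    where
    open ≤-Reasoning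
    N = suc j
    e₁ : ∀ j a b → (1 + j) * ((1 + j) * a + b) ≡ (1 + j) * (j * a) + ((1 + j) * a + (1 + j) * b)
    e₁ = solve-∀
    e₂ : ∀ N h a → N * a + N * (h * a) ≡ (1 + h) * (N * a)
    e₂ = solve-∀

  half-power : ∀ j h → h + h ≤ suc j → suc j ^ h ≤ 2 * j ^ h
  half-power j h 2h≤ = *-cancelˡ-≤ N (+-cancelʳ-≤ (N * N ^ h) _ _ (begin
    N * N ^ h + N * N ^ h ≤⟨ +-mono-≤ (bernoulli j h) (bernoulli j h) ⟩
    (N * j ^ h + h * N ^ h) + (N * j ^ h + h * N ^ h) ≡⟨ e N (j ^ h) h (N ^ h) ⟩
    N * (2 * j ^ h) + (h + h) * N ^ h ≤⟨ +-monoʳ-≤ (N * (2 * j ^ h)) (*-monoˡ-≤ (N ^ h) 2h≤) ⟩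
    N * (2 * j ^ h) + N * N ^ h ∎))
    where
    open ≤-Reasoning
    N = suc j
    e : ∀ N a h b → (N * a + h * b) + (N * a + h * b) ≡ N * (2 * a) + (h + h) * b
    e = solve-∀

  -- (1 + 1/j)^j is below e; a factor 2 for each half of the exponent gives 4 without analysis.
  suc-power≤ : ∀ j → suc j ^ j ≤ 4 * j ^ j
  suc-power≤ j = begin
    suc j ^ j ≡⟨ split (suc j) ⟩
    suc j ^ ⌊ j /2⌋ * suc j ^ ⌈ j /2⌉ ≤⟨ *-mono-≤ (half-power j ⌊ j /2⌋ (m≤n⇒m≤1+n low)) (half-power j ⌈ j /2⌉ high) ⟩
    2 * j ^ ⌊ j /2⌋ * (2 * j ^ ⌈ j /2⌉) ≡⟨ e (j ^ ⌊ j /2⌋) (j ^ ⌈ j /2⌉) ⟩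
    4 * (j ^ ⌊ j /2⌋ * j ^ ⌈ j /2⌉) ≡⟨ cong (4 *_) (split j) ⟨
    4 * j ^ j ∎
    where
    open ≤-Reasoning
    split : ∀ m → m ^ j ≡ m ^ ⌊ j /2⌋ * m ^ ⌈ j /2⌉
    split m = trans (cong (m ^_) (sym (⌊n/2⌋+⌈n/2⌉≡n j))) (^-distribˡ-+-* m ⌊ j /2⌋ ⌈ j /2⌉)
    double : ∀ n → ⌊ n /2⌋ + ⌊ n /2⌋ ≤ n
    double n = ≤-trans (+-monoʳ-≤ ⌊ n /2⌋ (⌊n/2⌋≤⌈n/2⌉ n)) (≤-reflexive (⌊n/2⌋+⌈n/2⌉≡n n))
    low = double j
    high = double (suc j)
    e : ∀ a b → 2 * a * (2 * b) ≡ 4 * (a * b)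
    e = solve-∀

  -- A crude Stirling bound, with 4 in place of e.
  power≤factorial : ∀ n → n ^ n ≤ n ! * 4 ^ n
  power≤factorial zero = ≤-refl
  power≤factorial (suc n) = begin
    suc n * suc n ^ n ≤⟨ *-monoʳ-≤ (suc n) (≤-trans (suc-power≤ n) (*-monoʳ-≤ 4 (power≤factorial n))) ⟩
    suc n * (4 * (n ! * 4 ^ n)) ≡⟨ e (suc n) (n !) (4 ^ n) ⟩
    suc n * n ! * (4 * 4 ^ n) ∎
    where
    open ≤-Reasoning
    e : ∀ a b c → a * (4 * (b * c)) ≡ a * b * (4 * c)
    e = solve-∀

  power-suc≥ : ∀ B n → B * B ^ n + suc n * B ^ n ≤ suc B ^ suc n
  power-suc≥ B zero = ≤-reflexive (+-comm (B * 1) 1)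
  power-suc≥ B (suc n) = begin
    B * (B * B ^ n) + suc (suc n) * (B * B ^ n) ≤⟨ m≤m+n _ (suc n * B ^ n) ⟩
    B * (B * B ^ n) + suc (suc n) * (B * B ^ n) + suc n * B ^ n ≡⟨ e B n (B ^ n) ⟩
    suc B * (B * B ^ n + suc n * B ^ n) ≤⟨ *-monoʳ-≤ (suc B) (power-suc≥ B n) ⟩
    suc B * suc B ^ suc n ∎
    where
    open ≤-Reasoning
    e : ∀ B n a → B * (B * a) + (2 + n) * (B * a) + (1 + n) * a ≡ (1 + B) * (B * a + (1 + n) * a)
    e = solve-∀

  tailCoefficient≤ : ∀ R B → R ! * tailCoefficient R B ≤ B ^ R
  tailCoefficient≤ zero B = ≤-refl
  tailCoefficient≤ (suc R) zero = ≤-trans (≤-reflexive (*-zeroʳ (suc R !))) z≤n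
  tailCoefficient≤ (suc R) (suc B) = begin
    suc R ! * (tailCoefficient (suc R) B + tailCoefficient R B)
      ≡⟨ e (suc R) (R !) (tailCoefficient (suc R) B) (tailCoefficient R B) ⟩
    suc R ! * tailCoefficient (suc R) B + suc R * (R ! * tailCoefficient R B)
      ≤⟨ +-mono-≤ (tailCoefficient≤ (suc R) B) (*-monoʳ-≤ (suc R) (tailCoefficient≤ R B)) ⟩
    B ^ suc R + suc R * B ^ R
      ≤⟨ power-suc≥ B R ⟩
    suc B ^ suc R ∎
    where
    open ≤-Reasoning
    e : ∀ r f s t → r * f * (s + t) ≡ r * f * s + r * (f * t)
    e = solve-∀

  m≤2^m : ∀ m → m ≤ 2 ^ m
  m≤2^m zero = z≤n
  m≤2^m (suc m) = +-mono-≤ (m^n>0 2 m) (≤-trans (m≤2^m m) (≤-reflexive (sym (+-identityʳ _))))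

  suc≤2^ : ∀ {m} → 1 ≤ m → suc m ≤ 2 ^ m
  suc≤2^ {suc zero} _ = ≤-refl
  suc≤2^ {suc (suc m)} _ = ≤-trans (+-mono-≤ (m^n>0 2 (suc m)) (suc≤2^ {suc m} (s≤s z≤n)))
    (≤-reflexive (cong (2 ^ suc m +_) (sym (+-identityʳ _))))

  2^-dominates : ∀ (m ℓ : ℕ) → 1 ≤ ℓ → 2 ^ m ≤ 2 ^ (m * ℓ)
  2^-dominates m ℓ h = ^-monoʳ-≤ 2 (m≤m*n m ℓ {{>-nonZero h}})

  module MainTerm (field′ : FiniteField) (k ℓ : ℕ) (1≤ℓ : 1 ≤ ℓ) where
    open FiniteField field′
    open LinearAlgebra field′ using (q; card-cube; cube)

    -- The constant is 8 = 4 · 2: `power≤factorial` gives (R/4)^R = (2ℓ)^R ≤ R!, so the first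
    -- omitted term, at most (ℓ q)^R / (R! q^R), is at most 2^(-R).
    R : ℕ
    R = 8 * ℓ

    open SecondMoments field′ k R
    open Covering field′ k using (coverCount)

    module _ (2^k≤ : 2 ^ k ≤ ℓ * q) where
      private
        x y : ℚ
        x = inv (ι q)
        y = 1ℚ ℚ.- x
        L = Finite.elems (cube k)

        0<q : 0ℚ ℚ.< ι q
        0<q = 0<ι (<⇒≤ 1<card)

        qx≡1 : ι q ℚ.* x ≡ 1ℚ
        qx≡1 = inv-right 0<q

        0≤x : 0ℚ ℚ.≤ x
        0≤x = ℚ.<⇒≤ (0<inv 0<q)

        x≤1 : x ℚ.≤ 1ℚ
        x≤1 = inv-anti 0<1 (ι-mono (<⇒≤ 1<card))

        0≤y : 0ℚ ℚ.≤ y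
        0≤y = ℚ.≤-trans (ℚ.≤-reflexive (sym (ℚ.+-inverseʳ x))) (ℚ.+-monoˡ-≤ (ℚ.- x) x≤1)

        y≤1 : y ℚ.≤ 1ℚ
        y≤1 = ℚ.≤-trans (ℚ.+-monoʳ-≤ 1ℚ (ℚ.neg-antimono-≤ 0≤x)) (ℚ.≤-reflexive (ℚ.+-identityʳ 1ℚ))

        ∣L∣ : length L ≡ 2 ^ k
        ∣L∣ = trans (sym (∑-one L)) (card-cube k)

        ^^-anti : ∀ {m n} → m ≤ n → y ^^ n ℚ.≤ y ^^ m
        ^^-anti {m} {n} m≤n = ℚ.≤-trans (ℚ.≤-reflexive (trans (cong (y ^^_) (sym (m+[n∸m]≡n m≤n))) (^^-+ y m (n ∸ m))))
          (ℚ.≤-trans (*-monoʳ (0≤^^ 0≤y m) (^^≤1 0≤y y≤1 (n ∸ m))) (ℚ.≤-reflexive (ℚ.*-identityʳ _)))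

        ^^-mono : ∀ {a b} → 0ℚ ℚ.≤ a → a ℚ.≤ b → ∀ n → a ^^ n ℚ.≤ b ^^ n
        ^^-mono 0≤a a≤b zero = ℚ.≤-refl
        ^^-mono 0≤a a≤b (suc n) = *-mono 0≤a a≤b (0≤^^ 0≤a n) (^^-mono 0≤a a≤b n)

        ^^-* : ∀ z m n → z ^^ (m * n) ≡ (z ^^ n) ^^ m
        ^^-* z zero n = refl
        ^^-* z (suc m) n = trans (^^-+ z n (m * n)) (cong (z ^^ n ℚ.*_) (^^-* z m n))

        -- For q = j + 1 the claim is (j+1)^(j+1) ≤ 8 j^(j+1), from (j+1)^j ≤ 4 j^j and j + 1 ≤ 2j.
        8y^q : 1ℚ ℚ.≤ ι 8 ℚ.* y ^^ q
        8y^q = from-nat q 1<card refl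
          where
          x^n : ∀ n → x ^^ n ℚ.* ι (q ^ n) ≡ 1ℚ
          x^n n = trans (cong (x ^^ n ℚ.*_) (ι-^ q n)) (trans (sym (^^-distrib-* x (ι q) n))
            (trans (cong (_^^ n) (trans (ℚ.*-comm x (ι q)) qx≡1)) (1^^ n)))
          from-nat : ∀ Q → 1 < Q → Q ≡ q → 1ℚ ℚ.≤ ι 8 ℚ.* y ^^ q
          from-nat (suc j) 1<Q Q≡q = ℚ.≤-trans (ℚ.≤-reflexive (sym (x^n q)))
            (ℚ.≤-trans (*-monoʳ (0≤^^ 0≤x q) (ι-mono bound)) (ℚ.≤-reflexive eq))
            where
            bound : q ^ q ≤ 8 * j ^ q
            bound = subst (λ Q → Q ^ Q ≤ 8 * j ^ Q) Q≡q (begin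
              suc j * suc j ^ j ≤⟨ *-mono-≤ (≤-trans (+-monoˡ-≤ j (s≤s⁻¹ 1<Q)) (≤-reflexive (cong (j +_) (sym (+-identityʳ j))))) (suc-power≤ j) ⟩
              2 * j * (4 * j ^ j) ≡⟨ e j (j ^ j) ⟩
              8 * (j * j ^ j) ∎)
              where
              open ≤-Reasoning
              e : ∀ a b → 2 * a * (4 * b) ≡ 8 * (a * b)
              e = solve-∀
            xj≡y : x ℚ.* ι j ≡ y
            xj≡y = trans (solve 2 (λ x j → x :* j := x :* (con 1ℚ :+ j) :- x) refl x (ι j))
              (cong (ℚ._- x) (trans (cong (x ℚ.*_) (trans (sym (ι-suc j)) (cong ι Q≡q))) (trans (ℚ.*-comm x (ι q)) qx≡1)))
            eq : x ^^ q ℚ.* ι (8 * j ^ q) ≡ ι 8 ℚ.* y ^^ q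
            eq = trans (cong (x ^^ q ℚ.*_) (ι-* 8 (j ^ q)))
              (trans (solve 3 (λ a b c → a :* (b :* c) := b :* (a :* c)) refl (x ^^ q) (ι 8) (ι (j ^ q)))
                (cong (ι 8 ℚ.*_) (trans (cong (x ^^ q ℚ.*_) (ι-^ j q)) (trans (sym (^^-distrib-* x (ι j) q)) (cong (_^^ q) xj≡y)))))

        8y^ : 1ℚ ℚ.≤ ι (8 ^ ℓ) ℚ.* y ^^ (2 ^ k)
        8y^ = ℚ.≤-trans (ℚ.≤-reflexive (sym (1^^ ℓ))) (ℚ.≤-trans (^^-mono (ℚ.<⇒≤ 0<1) 8y^q ℓ) (ℚ.≤-trans
          (ℚ.≤-reflexive (trans (^^-distrib-* (ι 8) (y ^^ q) ℓ) (cong₂ ℚ._*_ (sym (ι-^ 8 ℓ)) (sym (^^-* y ℓ q)))))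
          (*-monoʳ (0≤ι (8 ^ ℓ)) (^^-anti 2^k≤))))

        T : ℕ
        T = tailCoefficient R (2 ^ k)

        tail-nat : 2 ^ R * T ≤ q ^ R
        tail-nat = *-cancelˡ-≤ (ℓ ^ R) {{m^n≢0 ℓ R {{>-nonZero 1≤ℓ}}}} (*-cancelˡ-≤ (4 ^ R) {{m^n≢0 4 R}} (begin
          4 ^ R * (ℓ ^ R * (2 ^ R * T)) ≡⟨ e₁ (4 ^ R) (ℓ ^ R) (2 ^ R) T ⟩
          4 ^ R * 2 ^ R * ℓ ^ R * T ≡⟨ cong (λ t → t * T) (trans (cong (_* ℓ ^ R) (sym (^-distribʳ-* R 4 2))) (sym (^-distribʳ-* R 8 ℓ))) ⟩
          R ^ R * T ≤⟨ *-monoˡ-≤ T (power≤factorial R) ⟩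
          R ! * 4 ^ R * T ≡⟨ e₂ (R !) (4 ^ R) T ⟩
          4 ^ R * (R ! * T) ≤⟨ *-monoʳ-≤ (4 ^ R) (≤-trans (tailCoefficient≤ R (2 ^ k)) (^-monoˡ-≤ R 2^k≤)) ⟩
          4 ^ R * (ℓ * q) ^ R ≡⟨ cong (4 ^ R *_) (^-distribʳ-* R ℓ q) ⟩
          4 ^ R * (ℓ ^ R * q ^ R) ∎))
          where
          open ≤-Reasoning
          e₁ : ∀ a b c d → a * (b * (c * d)) ≡ a * c * b * d
          e₁ = solve-∀
          e₂ : ∀ a b c → a * b * c ≡ b * (a * c)
          e₂ = solve-∀

        tail≤ : ι (2 ^ R) ℚ.* (ι T ℚ.* x ^^ R) ℚ.≤ 1ℚ
        tail≤ = ℚ.≤-trans (ℚ.≤-reflexive (trans (sym (ℚ.*-assoc (ι (2 ^ R)) (ι T) (x ^^ R))) (cong (ℚ._* x ^^ R) (sym (ι-* (2 ^ R) T)))))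
          (ℚ.≤-trans (*-monoˡ (0≤^^ 0≤x R) (ι-mono tail-nat))
            (ℚ.≤-reflexive (trans (cong (ℚ._* x ^^ R) (ι-^ q R)) (trans (sym (^^-distrib-* (ι q) x R)) (trans (cong (_^^ R) qx≡1) (1^^ R))))))

        0≤tail : 0ℚ ℚ.≤ ι T ℚ.* x ^^ R
        0≤tail = *-nonneg (0≤ι T) (0≤^^ 0≤x R)

        16^ℓ≤2^R : 16 ^ ℓ ≤ 2 ^ R
        16^ℓ≤2^R = ≤-trans (≤-reflexive (^-*-assoc 2 4 ℓ)) (^-monoʳ-≤ 2 (*-monoˡ-≤ ℓ (m≤m+n 4 4)))

      sgn-R : sgn R ≡ 1ℚ
      sgn-R = trans (cong sgn (e ℓ)) (sgn-even (4 * ℓ))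
        where
        e : ∀ ℓ → 8 * ℓ ≡ 2 * (4 * ℓ)
        e = solve-∀

      -- Multiplied by 16^ℓ, the full product is at least 2^ℓ ≥ 2, since it is at least 8^(-ℓ); the
      -- truncation error becomes at most 1, since 16^ℓ ≤ 2^R.
      main-lower : 1ℚ ℚ.≤ ι (16 ^ ℓ) ℚ.* main
      main-lower = ℚ.≤-trans (ℚ.≤-reflexive (sym 2-1)) (ℚ.≤-trans
        (ℚ.+-mono-≤ first (ℚ.neg-antimono-≤ (ℚ.≤-trans (*-monoˡ 0≤tail (ι-mono 16^ℓ≤2^R)) tail≤)))
        (ℚ.≤-trans (ℚ.≤-reflexive (solve 3 (λ a b t → a :* b :- a :* t := a :* (b :- t)) refl (ι (16 ^ ℓ)) (y ^^ (2 ^ k)) (ι T ℚ.* x ^^ R)))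
          (*-monoʳ (0≤ι (16 ^ ℓ)) gap)))
        where
        2-1 : ι 2 ℚ.- 1ℚ ≡ 1ℚ
        2-1 = refl
        first : ι 2 ℚ.≤ ι (16 ^ ℓ) ℚ.* y ^^ (2 ^ k)
        first = ℚ.≤-trans (ℚ.≤-trans (ι-mono (≤-trans (≤-reflexive (sym (^-identityʳ 2))) (^-monoʳ-≤ 2 1≤ℓ))) (ℚ.≤-reflexive (sym (ℚ.*-identityʳ (ι (2 ^ ℓ))))))
          (ℚ.≤-trans (*-monoʳ (0≤ι (2 ^ ℓ)) 8y^) (ℚ.≤-reflexive (trans (sym (ℚ.*-assoc (ι (2 ^ ℓ)) (ι (8 ^ ℓ)) _))
            (cong (ℚ._* y ^^ (2 ^ k)) (trans (sym (ι-* (2 ^ ℓ) (8 ^ ℓ))) (cong ι (sym (^-distribʳ-* ℓ 2 8))))))))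
        gap : y ^^ (2 ^ k) ℚ.- ι T ℚ.* x ^^ R ℚ.≤ main
        gap = ℚ.≤-trans (ℚ.+-monoʳ-≤ (y ^^ (2 ^ k)) (ℚ.neg-antimono-≤ rem))
          (ℚ.≤-reflexive (solve 2 (λ a m → a :- (a :- m) := m) refl (y ^^ (2 ^ k)) main))
          where
          rem : y ^^ (2 ^ k) ℚ.- main ℚ.≤ ι T ℚ.* x ^^ R
          rem = subst (λ n → y ^^ n ℚ.- main ℚ.≤ ι (tailCoefficient R n) ℚ.* x ^^ R) ∣L∣
            (ℚ.≤-trans (ℚ.≤-reflexive (sym (trans (cong (ℚ._* D) sgn-R) (ℚ.*-identityˡ D)))) (proj₂ (remainder 0≤x x≤1 R L)))
            where D = y ^^ length L ℚ.- main

      private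
        2^K≤ : 2 ^ K ≤ 4 * ℓ * q
        2^K≤ = ≤-trans (≤-reflexive (e (2 ^ k))) (≤-trans (*-monoʳ-≤ 4 2^k≤) (≤-reflexive (sym (*-assoc 4 ℓ q))))
          where
          e : ∀ a → 2 * (2 * a) ≡ 4 * a
          e = solve-∀

        W : ℕ
        W = R * (R * errorWeight (4 * ℓ) 2^K≤)

        0≤main : 0ℚ ℚ.≤ main
        0≤main = by-sign (ℚ.≤-total 0ℚ main)
          where
          by-sign : 0ℚ ℚ.≤ main ⊎ main ℚ.≤ 0ℚ → 0ℚ ℚ.≤ main
          by-sign (inj₁ 0≤m) = 0≤m
          by-sign (inj₂ m≤0) = contradiction (ℚ.<-≤-trans 0<1 (ℚ.≤-trans main-lower
            (ℚ.≤-trans (*-monoʳ (0≤ι (16 ^ ℓ)) m≤0) (ℚ.≤-reflexive (ℚ.*-zeroʳ (ι (16 ^ ℓ))))))) (ℚ.<-irrefl refl)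

      coverCount-bound : 4 ^ K * coverCount ≤ 256 ^ ℓ * (W * q ^ k)
      coverCount-bound = ι-reflect (ℚ.≤-trans (ℚ.≤-reflexive (sym (ℚ.*-identityʳ _))) (ℚ.≤-trans
        (*-monoʳ (0≤ι (4 ^ K * coverCount)) one) (ℚ.≤-trans (ℚ.≤-reflexive eq) (ℚ.≤-trans
        (*-monoʳ (0≤ι (256 ^ ℓ)) (cover-bound (4 * ℓ) 2^K≤ sgn-R 0≤main)) (ℚ.≤-reflexive
          (trans (cong (ι (256 ^ ℓ) ℚ.*_) (sym (ι-* W (q ^ k)))) (sym (ι-* (256 ^ ℓ) (W * q ^ k)))))))))
        where
        m = ι (16 ^ ℓ) ℚ.* main
        one : 1ℚ ℚ.≤ m ℚ.* m
        one = *-mono (ℚ.<⇒≤ 0<1) main-lower (ℚ.<⇒≤ 0<1) main-lower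
        eq : ι (4 ^ K * coverCount) ℚ.* (m ℚ.* m) ≡ ι (256 ^ ℓ) ℚ.* (ι (4 ^ K) ℚ.* (ι coverCount ℚ.* (main ℚ.* main)))
        eq = trans (cong (ℚ._* (m ℚ.* m)) (ι-* (4 ^ K) coverCount))
          (trans (solve 4 (λ a b s t → a :* b :* (s :* t :* (s :* t)) := (s :* s) :* (a :* (b :* (t :* t)))) refl
              (ι (4 ^ K)) (ι coverCount) (ι (16 ^ ℓ)) main)
            (cong (ℚ._* (ι (4 ^ K) ℚ.* (ι coverCount ℚ.* (main ℚ.* main))))
              (trans (sym (ι-* (16 ^ ℓ) (16 ^ ℓ))) (cong ι (sym (^-distribʳ-* ℓ 16 16))))))

      private
        module Exponents (k≤ : k ≤ 4096 * (suc ℓ * suc ℓ)) where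
          K≤ : K ≤ 2 ^ (15 * ℓ)
          K≤ = begin
            2 + k ≤⟨ +-mono-≤ {2} {2 * (suc ℓ * suc ℓ)} (*-monoʳ-≤ 2 {1} (s≤s z≤n)) k≤ ⟩
            2 * (suc ℓ * suc ℓ) + 4096 * (suc ℓ * suc ℓ) ≡⟨ *-distribʳ-+ (suc ℓ * suc ℓ) 2 4096 ⟨
            4098 * (suc ℓ * suc ℓ) ≤⟨ *-mono-≤ (≤ᵇ⇒≤ 4098 (2 ^ 13) _) (*-mono-≤ (suc≤2^ 1≤ℓ) (suc≤2^ 1≤ℓ)) ⟩
            2 ^ 13 * (2 ^ ℓ * 2 ^ ℓ) ≤⟨ *-monoˡ-≤ (2 ^ ℓ * 2 ^ ℓ) (2^-dominates 13 ℓ 1≤ℓ) ⟩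
            2 ^ (13 * ℓ) * (2 ^ ℓ * 2 ^ ℓ) ≡⟨ cong (2 ^ (13 * ℓ) *_) (^-distribˡ-+-* 2 ℓ ℓ) ⟨
            2 ^ (13 * ℓ) * 2 ^ (ℓ + ℓ) ≡⟨ ^-distribˡ-+-* 2 (13 * ℓ) (ℓ + ℓ) ⟨
            2 ^ (13 * ℓ + (ℓ + ℓ)) ≡⟨ cong (2 ^_) (e ℓ) ⟩
            2 ^ (15 * ℓ) ∎
            where
            open ≤-Reasoning
            e : ∀ ℓ → 13 * ℓ + (ℓ + ℓ) ≡ 15 * ℓ
            e = solve-∀

          base : ℕ
          base = K * (4 * 2 ^ (2 * R)) * (4 * ℓ)

          -- The exponent 36 is 4 + 15 + 16 + 1, from 16 ≤ 2^(4ℓ), `K≤`, 2R = 16ℓ and ℓ ≤ 2^ℓ.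
          base≤ : base ≤ 2 ^ (36 * ℓ)
          base≤ = begin
            K * (4 * 2 ^ (2 * R)) * (4 * ℓ) ≡⟨ e₁ K (2 ^ (2 * R)) ℓ ⟩
            2 ^ 4 * (K * (2 ^ (2 * R) * ℓ)) ≤⟨ *-mono-≤ (2^-dominates 4 ℓ 1≤ℓ) (*-mono-≤ K≤ (*-monoʳ-≤ (2 ^ (2 * R)) (m≤2^m ℓ))) ⟩
            2 ^ (4 * ℓ) * (2 ^ (15 * ℓ) * (2 ^ (2 * R) * 2 ^ ℓ))
              ≡⟨ trans (cong (λ t → 2 ^ (4 * ℓ) * (2 ^ (15 * ℓ) * t)) (sym (^-distribˡ-+-* 2 (2 * R) ℓ)))
                   (trans (cong (2 ^ (4 * ℓ) *_) (sym (^-distribˡ-+-* 2 (15 * ℓ) (2 * R + ℓ)))) (sym (^-distribˡ-+-* 2 (4 * ℓ) _))) ⟩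
            2 ^ (4 * ℓ + (15 * ℓ + (2 * R + ℓ))) ≡⟨ cong (2 ^_) (e₂ ℓ) ⟩
            2 ^ (36 * ℓ) ∎
            where
            open ≤-Reasoning
            e₁ : ∀ a b c → a * (4 * b) * (4 * c) ≡ 16 * (a * (b * c))
            e₁ = solve-∀
            e₂ : ∀ ℓ → 4 * ℓ + (15 * ℓ + (2 * (8 * ℓ) + ℓ)) ≡ 36 * ℓ
            e₂ = solve-∀

          polynomial≤ : R * (R * (2 * R)) ≤ 2 ^ (13 * ℓ)
          polynomial≤ = begin
            R * (R * (2 * R)) ≡⟨ e₁ ℓ ⟩
            2 ^ 10 * (ℓ * (ℓ * ℓ)) ≤⟨ *-mono-≤ (2^-dominates 10 ℓ 1≤ℓ) (*-mono-≤ (m≤2^m ℓ) (*-mono-≤ (m≤2^m ℓ) (m≤2^m ℓ))) ⟩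
            2 ^ (10 * ℓ) * (2 ^ ℓ * (2 ^ ℓ * 2 ^ ℓ))
              ≡⟨ trans (cong (λ t → 2 ^ (10 * ℓ) * (2 ^ ℓ * t)) (sym (^-distribˡ-+-* 2 ℓ ℓ)))
                   (trans (cong (2 ^ (10 * ℓ) *_) (sym (^-distribˡ-+-* 2 ℓ (ℓ + ℓ)))) (sym (^-distribˡ-+-* 2 (10 * ℓ) _))) ⟩
            2 ^ (10 * ℓ + (ℓ + (ℓ + ℓ))) ≡⟨ cong (2 ^_) (e₂ ℓ) ⟩
            2 ^ (13 * ℓ) ∎
            where
            open ≤-Reasoning
            e₁ : ∀ ℓ → 8 * ℓ * (8 * ℓ * (2 * (8 * ℓ))) ≡ 1024 * (ℓ * (ℓ * ℓ))
            e₁ = solve-∀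
            e₂ : ∀ ℓ → 10 * ℓ + (ℓ + (ℓ + ℓ)) ≡ 13 * ℓ
            e₂ = solve-∀

          -- The dominant exponent is 36ℓ · 2R = 576ℓ²; the linear terms 2ℓ + 8ℓ + 13ℓ fit into the
          -- other 24ℓ².
          W≤ : 2 ^ suc ℓ * (256 ^ ℓ * W) ≤ 2 ^ (600 * (ℓ * ℓ)) * 3 ^ K
          W≤ = begin
            2 ^ suc ℓ * (256 ^ ℓ * (R * (R * (2 * R * (3 ^ K * base ^ (2 * R))))))
              ≡⟨ e₁ (2 ^ suc ℓ) (256 ^ ℓ) R (3 ^ K) (base ^ (2 * R)) ⟩
            2 ^ suc ℓ * (256 ^ ℓ * (R * (R * (2 * R)) * base ^ (2 * R))) * 3 ^ K
              ≤⟨ *-monoˡ-≤ (3 ^ K) (*-mono-≤ (^-monoʳ-≤ 2 (+-monoˡ-≤ ℓ 1≤ℓ)) (*-mono-≤ (≤-reflexive (^-*-assoc 2 8 ℓ)) (*-mono-≤ polynomial≤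
                   (≤-trans (^-monoˡ-≤ (2 * R) base≤) (≤-reflexive (^-*-assoc 2 (36 * ℓ) (2 * R))))))) ⟩
            2 ^ (ℓ + ℓ) * (2 ^ (8 * ℓ) * (2 ^ (13 * ℓ) * 2 ^ (36 * ℓ * (2 * R)))) * 3 ^ K
              ≡⟨ cong (_* 3 ^ K) (trans (cong (λ t → 2 ^ (ℓ + ℓ) * (2 ^ (8 * ℓ) * t)) (sym (^-distribˡ-+-* 2 (13 * ℓ) _)))
                   (trans (cong (2 ^ (ℓ + ℓ) *_) (sym (^-distribˡ-+-* 2 (8 * ℓ) _))) (sym (^-distribˡ-+-* 2 (ℓ + ℓ) _)))) ⟩
            2 ^ (ℓ + ℓ + (8 * ℓ + (13 * ℓ + 36 * ℓ * (2 * R)))) * 3 ^ K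
              ≤⟨ *-monoˡ-≤ (3 ^ K) (^-monoʳ-≤ 2 exponent) ⟩
            2 ^ (600 * (ℓ * ℓ)) * 3 ^ K ∎
            where
            open ≤-Reasoning
            e₁ : ∀ a b r t s → a * (b * (r * (r * (2 * r * (t * s))))) ≡ a * (b * (r * (r * (2 * r)) * s)) * t
            e₁ = solve-∀
            e₂ : ∀ ℓ → ℓ + ℓ + (8 * ℓ + (13 * ℓ + 36 * ℓ * (2 * (8 * ℓ)))) ≡ 23 * ℓ + 576 * (ℓ * ℓ)
            e₂ = solve-∀
            e₃ : ∀ a → 24 * a + 576 * a ≡ 600 * a
            e₃ = solve-∀
            exponent : ℓ + ℓ + (8 * ℓ + (13 * ℓ + 36 * ℓ * (2 * R))) ≤ 600 * (ℓ * ℓ)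
            exponent = ≤-trans (≤-reflexive (e₂ ℓ)) (≤-trans
              (+-monoˡ-≤ (576 * (ℓ * ℓ)) (*-mono-≤ {23} {24} (n≤1+n 23) (m≤m*n ℓ ℓ {{>-nonZero 1≤ℓ}}))) (≤-reflexive (e₃ (ℓ * ℓ))))

      -- The two conditions place ℓ near sqrt(k)/64. The lower bound on `k` lets 4^K absorb
      -- 2^(600ℓ²) 3^K, and the upper bound keeps the factor `K` below 2^(15ℓ).
      cover-rare : 4096 * (ℓ * ℓ) ≤ k → k ≤ 4096 * (suc ℓ * suc ℓ) → 2 ^ suc ℓ * coverCount ≤ q ^ k
      cover-rare ≤k k≤ = *-cancelˡ-≤ (4 ^ K) {{m^n≢0 4 K}} (begin
        4 ^ K * (2 ^ suc ℓ * coverCount) ≡⟨ e₁ (4 ^ K) (2 ^ suc ℓ) coverCount ⟩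
        2 ^ suc ℓ * (4 ^ K * coverCount) ≤⟨ *-monoʳ-≤ (2 ^ suc ℓ) coverCount-bound ⟩
        2 ^ suc ℓ * (256 ^ ℓ * (W * q ^ k)) ≡⟨ e₂ (2 ^ suc ℓ) (256 ^ ℓ) W (q ^ k) ⟩
        2 ^ suc ℓ * (256 ^ ℓ * W) * q ^ k ≤⟨ *-monoˡ-≤ (q ^ k) (≤-trans (Exponents.W≤ k≤) absorb) ⟩
        4 ^ K * q ^ k ∎)
        where
        open ≤-Reasoning
        e₁ : ∀ a b c → a * (b * c) ≡ b * (a * c)
        e₁ = solve-∀
        e₂ : ∀ a b c d → a * (b * (c * d)) ≡ a * (b * c) * d
        e₂ = solve-∀
        e₃ : ∀ a → 5 * (300 * a) ≡ 1500 * a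
        e₃ = solve-∀
        e₄ : ∀ a → 2 * (300 * a) ≡ 600 * a
        e₄ = solve-∀
        -- Five columns pay for one factor 4, because 4 · 3^5 = 972 ≤ 1024 = 4^5; this takes 1500ℓ²
        -- columns.
        m = 300 * (ℓ * ℓ)
        5m≤K : 5 * m ≤ K
        5m≤K = ≤-trans (≤-reflexive (e₃ (ℓ * ℓ))) (≤-trans (*-monoˡ-≤ (ℓ * ℓ) (≤ᵇ⇒≤ 1500 4096 _)) (≤-trans ≤k (≤-trans (n≤1+n k) (n≤1+n (suc k)))))
        absorb : 2 ^ (600 * (ℓ * ℓ)) * 3 ^ K ≤ 4 ^ K
        absorb = begin
          2 ^ (600 * (ℓ * ℓ)) * 3 ^ K ≡⟨ cong₂ _*_ (trans (cong (2 ^_) (sym (e₄ (ℓ * ℓ)))) (sym (^-*-assoc 2 2 m)))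
                                                       (trans (cong (3 ^_) (sym (m+[n∸m]≡n 5m≤K))) (^-distribˡ-+-* 3 (5 * m) (K ∸ 5 * m))) ⟩
          4 ^ m * (3 ^ (5 * m) * 3 ^ (K ∸ 5 * m)) ≡⟨ trans (sym (*-assoc (4 ^ m) _ _)) (cong (λ t → 4 ^ m * t * 3 ^ (K ∸ 5 * m)) (sym (^-*-assoc 3 5 m))) ⟩
          4 ^ m * 243 ^ m * 3 ^ (K ∸ 5 * m) ≡⟨ cong (_* 3 ^ (K ∸ 5 * m)) (^-distribʳ-* m 4 243) ⟨
          972 ^ m * 3 ^ (K ∸ 5 * m) ≤⟨ *-mono-≤ (^-monoˡ-≤ m (≤ᵇ⇒≤ 972 1024 _)) (^-monoˡ-≤ (K ∸ 5 * m) (n≤1+n 3)) ⟩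
          1024 ^ m * 4 ^ (K ∸ 5 * m) ≡⟨ cong (_* 4 ^ (K ∸ 5 * m)) (^-*-assoc 4 5 m) ⟩
          4 ^ (5 * m) * 4 ^ (K ∸ 5 * m) ≡⟨ trans (cong (4 ^_) (sym (m+[n∸m]≡n 5m≤K))) (^-distribˡ-+-* 4 (5 * m) (K ∸ 5 * m)) ⟨
          4 ^ K ∎

-- The field of residues modulo an odd prime.

module PrimeField where

  open FiniteSums
  open LinAlg
  open import Algebra.Structures using (IsCommutativeRing)
  open import Data.Fin.Base using (Fin; toℕ)
  import Data.Fin.Properties as Fin
  open import Data.Nat.Base
  open import Data.Nat.Properties
  open import Data.Nat.Coprimality using (prime⇒coprime; coprime-Bézout)
  open import Data.Nat.DivMod
  open import Data.Nat.GCD using (module Bézout)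
  open import Data.Nat.Primality using (Prime; prime⇒nonZero)

  module _ (p : ℕ) (pr : Prime p) (3≤p : 3 ≤ p) where
    private
      instance
        p≢0 : NonZero p
        p≢0 = prime⇒nonZero pr

      [_] : ℕ → Fin p
      [ n ] = n mod p

      infixl 6 _⊕_
      infixl 7 _⊗_

      _⊕_ _⊗_ : Fin p → Fin p → Fin p
      i ⊕ j = [ toℕ i + toℕ j ]
      i ⊗ j = [ toℕ i * toℕ j ]

      ⊖_ : Fin p → Fin p
      ⊖ i = [ p ∸ toℕ i ]

      toℕ-[] : ∀ n → toℕ [ n ] ≡ n % p
      toℕ-[] n = Fin.toℕ-fromℕ< (m%n<n n p)

      []-cong : ∀ {m n} → m % p ≡ n % p → [ m ] ≡ [ n ]
      []-cong {m} {n} eq = Fin.toℕ-injective (trans (toℕ-[] m) (trans eq (sym (toℕ-[] n))))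

      [toℕ] : ∀ i → [ toℕ i ] ≡ i
      [toℕ] i = Fin.toℕ-injective (trans (toℕ-[] (toℕ i)) (m<n⇒m%n≡m (Fin.toℕ<n i)))

      []-+ : ∀ m n → [ m ] ⊕ [ n ] ≡ [ m + n ]
      []-+ m n = []-cong (trans (cong₂ (λ a b → (a + b) % p) (toℕ-[] m) (toℕ-[] n)) (sym (%-distribˡ-+ m n p)))

      []-* : ∀ m n → [ m ] ⊗ [ n ] ≡ [ m * n ]
      []-* m n = []-cong (trans (cong₂ (λ a b → (a * b) % p) (toℕ-[] m) (toℕ-[] n)) (sym (%-distribˡ-* m n p)))

      +-left : ∀ m k → [ m ] ⊕ k ≡ [ m + toℕ k ]
      +-left m k = trans (cong ([ m ] ⊕_) (sym ([toℕ] k))) ([]-+ m (toℕ k))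

      +-right : ∀ i n → i ⊕ [ n ] ≡ [ toℕ i + n ]
      +-right i n = trans (cong (_⊕ [ n ]) (sym ([toℕ] i))) ([]-+ (toℕ i) n)

      *-left : ∀ m k → [ m ] ⊗ k ≡ [ m * toℕ k ]
      *-left m k = trans (cong ([ m ] ⊗_) (sym ([toℕ] k))) ([]-* m (toℕ k))

      *-right : ∀ i n → i ⊗ [ n ] ≡ [ toℕ i * n ]
      *-right i n = trans (cong (_⊗ [ n ]) (sym ([toℕ] i))) ([]-* (toℕ i) n)

      ⊕-assoc : ∀ i j k → (i ⊕ j) ⊕ k ≡ i ⊕ (j ⊕ k)
      ⊕-assoc i j k = trans (+-left _ k) (trans (cong [_] (+-assoc (toℕ i) (toℕ j) (toℕ k))) (sym (+-right i _)))

      ⊕-comm : ∀ i j → i ⊕ j ≡ j ⊕ i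
      ⊕-comm i j = cong [_] (+-comm (toℕ i) (toℕ j))

      ⊕-identityˡ : ∀ i → [ 0 ] ⊕ i ≡ i
      ⊕-identityˡ i = trans (+-left 0 i) ([toℕ] i)

      ⊕-inverseʳ : ∀ i → i ⊕ ⊖ i ≡ [ 0 ]
      ⊕-inverseʳ i = trans (+-right i _) (trans (cong [_] (m+[n∸m]≡n (<⇒≤ (Fin.toℕ<n i)))) ([]-cong (trans (n%n≡0 p) (sym (m<n⇒m%n≡m (>-nonZero⁻¹ p))))))

      ⊗-assoc : ∀ i j k → (i ⊗ j) ⊗ k ≡ i ⊗ (j ⊗ k)
      ⊗-assoc i j k = trans (*-left _ k) (trans (cong [_] (*-assoc (toℕ i) (toℕ j) (toℕ k))) (sym (*-right i _)))

      ⊗-comm : ∀ i j → i ⊗ j ≡ j ⊗ i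
      ⊗-comm i j = cong [_] (*-comm (toℕ i) (toℕ j))

      ⊗-identityˡ : ∀ i → [ 1 ] ⊗ i ≡ i
      ⊗-identityˡ i = trans (*-left 1 i) (trans (cong [_] (*-identityˡ (toℕ i))) ([toℕ] i))

      distribˡ : ∀ i j k → i ⊗ (j ⊕ k) ≡ (i ⊗ j) ⊕ (i ⊗ k)
      distribˡ i j k = trans (*-right i _) (trans (cong [_] (*-distribˡ-+ (toℕ i) (toℕ j) (toℕ k))) (sym ([]-+ _ _)))

      isCommutativeRing : IsCommutativeRing _≡_ _⊕_ _⊗_ ⊖_ [ 0 ] [ 1 ]
      isCommutativeRing = record
        { isRing = record
          { +-isAbelianGroup = record
            { isGroup = record
              { isMonoid = record
                { isSemigroup = record
                  { isMagma = record { isEquivalence = isEquivalence ; ∙-cong = cong₂ _⊕_ }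
                  ; assoc = ⊕-assoc }
                ; identity = ⊕-identityˡ , λ i → trans (⊕-comm i [ 0 ]) (⊕-identityˡ i) }
              ; inverse = (λ i → trans (⊕-comm (⊖ i) i) (⊕-inverseʳ i)) , ⊕-inverseʳ
              ; ⁻¹-cong = cong ⊖_ }
            ; comm = ⊕-comm }
          ; *-cong = cong₂ _⊗_
          ; *-assoc = ⊗-assoc
          ; *-identity = ⊗-identityˡ , λ i → trans (⊗-comm i [ 1 ]) (⊗-identityˡ i)
          ; distrib = distribˡ , λ i j k → trans (⊗-comm (j ⊕ k) i)
              (trans (distribˡ i j k) (cong₂ _⊕_ (⊗-comm i j) (⊗-comm i k))) }
        ; *-comm = ⊗-comm }

      nonzero : ∀ {n} → n < p → n ≢ 0 → [ n ] ≢ [ 0 ]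
      nonzero {n} n<p n≢0 eq = n≢0 (trans (sym (m<n⇒m%n≡m n<p)) (trans (sym (toℕ-[] n)) (trans (cong toℕ eq)
        (trans (toℕ-[] 0) (m<n⇒m%n≡m (>-nonZero⁻¹ p))))))

      inverse : ∀ a → a ≢ [ 0 ] → ∃ λ b → b ⊗ a ≡ [ 1 ]
      inverse a a≢0 with coprime-Bézout (prime⇒coprime pr {{a-nonZero}} (Fin.toℕ<n a))
        where
        a-nonZero : NonZero (toℕ a)
        a-nonZero = ≢-nonZero (λ eq → a≢0 (trans (sym ([toℕ] a)) (cong [_] eq)))
      ... | Bézout.-+ x y eq = [ y ] , trans (*-left y a) ([]-cong (trans (cong (_% p) (sym eq)) ([m+kn]%n≡m%n 1 x p)))
      -- Here 1 + y a = x p, so y a = -1 and the sign has to be corrected; (-1)(-1) = 1 is derived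
      -- from the ring laws.
      ... | Bézout.+- x y eq = [ y ] ⊗ ⊖ [ 1 ] , trans (cong (_⊗ a) (⊗-comm [ y ] (⊖ [ 1 ]))) (trans (⊗-assoc (⊖ [ 1 ]) [ y ] a)
          (trans (cong ((⊖ [ 1 ]) ⊗_) ya≡-1) (trans (sym (+-cancel (⊖ [ 1 ]))) 1+1-1)))
        where
        open IsCommutativeRing isCommutativeRing using (zeroʳ)
        ya≡-1 : [ y ] ⊗ a ≡ ⊖ [ 1 ]
        ya≡-1 = trans (sym (⊕-identityˡ _)) (trans (cong (_⊕ ([ y ] ⊗ a)) (sym (trans (⊕-comm (⊖ [ 1 ]) [ 1 ]) (⊕-inverseʳ [ 1 ]))))
          (trans (⊕-assoc (⊖ [ 1 ]) [ 1 ] ([ y ] ⊗ a)) (trans (cong (⊖ [ 1 ] ⊕_)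
            (trans (cong ([ 1 ] ⊕_) (*-left y a)) (trans ([]-+ 1 _) (trans (cong [_] eq) ([]-cong (trans (m*n%n≡0 x p) (sym (m<n⇒m%n≡m (>-nonZero⁻¹ p)))))))))
            (trans (⊕-comm (⊖ [ 1 ]) [ 0 ]) (⊕-identityˡ _)))))
        +-cancel : ∀ b → (b ⊗ b ⊕ b) ⊕ ⊖ b ≡ b ⊗ b
        +-cancel b = trans (⊕-assoc (b ⊗ b) b (⊖ b)) (trans (cong (b ⊗ b ⊕_) (⊕-inverseʳ b)) (trans (⊕-comm (b ⊗ b) [ 0 ]) (⊕-identityˡ _)))
        u = ⊖ [ 1 ]
        uu+u≡0 : u ⊗ u ⊕ u ≡ [ 0 ]
        uu+u≡0 = trans (cong (u ⊗ u ⊕_) (sym (trans (⊗-comm u [ 1 ]) (⊗-identityˡ u))))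
          (trans (sym (distribˡ u u [ 1 ])) (trans (cong (u ⊗_) (trans (⊕-comm u [ 1 ]) (⊕-inverseʳ [ 1 ]))) (zeroʳ u)))
        1+1-1 : (u ⊗ u ⊕ u) ⊕ ⊖ u ≡ [ 1 ]
        1+1-1 = trans (cong (_⊕ ⊖ u) (trans uu+u≡0 (sym (⊕-inverseʳ [ 1 ])))) (trans (⊕-assoc [ 1 ] u (⊖ u))
          (trans (cong ([ 1 ] ⊕_) (⊕-inverseʳ u)) (trans (⊕-comm [ 1 ] [ 0 ]) (⊕-identityˡ _))))

    primeField : FiniteField
    primeField = record
      { F = Fin p ; _⊕_ = _⊕_ ; _⊗_ = _⊗_ ; ⊖_ = ⊖_ ; 0F = [ 0 ] ; 1F = [ 1 ]
      ; isCommutativeRing = isCommutativeRing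
      ; finite = finFin p
      ; 1<card = subst (1 <_) (sym (card-Fin p)) (≤-trans (n≤1+n 2) 3≤p)
      ; inverse = inverse
      ; 2≢0 = λ eq → nonzero {2} 3≤p (λ ()) (trans (sym ([]-+ 1 1)) eq)
      }

-- From random subsets to independent tuples.

module Tuples where

  open import Defs using (sumOf; Complete; complete?; allSubsets; kSubsets)
  open FiniteSums
  open LinAlg
  open SecondMoment
  open PrimeField
  open import Data.Bool.Base using (Bool; true; false; not)
  import Data.Bool.Properties as Bool
  open import Data.Fin.Base using (Fin; zero; suc; toℕ)
  import Data.Fin.Properties as Fin
  open import Data.Fin.Subset using (Subset; outside; _∈_; _∉_; _⊆_; ∣_∣; ⊥)
  open import Data.Fin.Subset.Properties using (_∈?_; ∉⊥; ∣⊥∣≡0)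
  open import Data.List.Base as List using (List; []; _∷_; filter; length; allFin)
  import Data.List.Properties as List
  open import Data.Nat.Base
  open import Data.Nat.DivMod using (_mod_; _%_; %-distribˡ-+; m%n%n≡m%n; m%n<n)
  import Data.Nat.ListAction as ListAction
  open import Data.Nat.Primality using (Prime; prime⇒nonZero)
  open import Data.Nat.Properties
  open import Data.Nat.Tactic.RingSolver using (solve-∀)
  open import Data.Unit.Base using (⊤; tt)
  open import Data.Vec.Base as Vec using (Vec; []; _∷_; updateAt)
  import Data.Vec.Properties as Vec
  open import Relation.Unary using (Decidable)

  -- Insertion and removal in a single involution, as `reindex` requires.
  toggle : ∀ {n} → Fin n → Subset n → Subset n
  toggle i S = updateAt S i not

  toggle-involutive : ∀ {n} (i : Fin n) S → toggle i (toggle i S) ≡ S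
  toggle-involutive zero (s ∷ S) = cong (_∷ S) (Bool.not-involutive s)
  toggle-involutive (suc i) (s ∷ S) = cong (s ∷_) (toggle-involutive i S)

  module _ {n : ℕ} {i : Fin n} {S : Subset n} where
    toggle-in : i ∉ S → i ∈ toggle i S
    toggle-in i∉ = Vec.lookup⇒[]= i _ (trans (Vec.lookup∘updateAt i S) (cong not (Bool.¬-not (λ eq → i∉ (Vec.lookup⇒[]= i S eq)))))

    toggle-out : i ∈ S → i ∉ toggle i S
    toggle-out i∈ i∈′ with trans (sym (Vec.[]=⇒lookup i∈′)) (trans (Vec.lookup∘updateAt i S) (cong not (Vec.[]=⇒lookup i∈)))
    ... | ()

    toggle-other⁺ : ∀ {j} → j ≢ i → j ∈ S → j ∈ toggle i S
    toggle-other⁺ {j} j≢i j∈ = Vec.lookup⇒[]= j _ (trans (Vec.lookup∘updateAt′ j i j≢i S) (Vec.[]=⇒lookup j∈))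

    toggle-other⁻ : ∀ {j} → j ≢ i → j ∈ toggle i S → j ∈ S
    toggle-other⁻ {j} j≢i j∈ = Vec.lookup⇒[]= j _ (trans (sym (Vec.lookup∘updateAt′ j i j≢i S)) (Vec.[]=⇒lookup j∈))

    𝟙-toggle : i ∉ S → ∀ j → 𝟙 (j ∈? toggle i S) ≡ 𝟙 (j Fin.≟ i) + 𝟙 (j ∈? S)
    𝟙-toggle i∉ j with j Fin.≟ i
    ... | yes refl = trans (𝟙-yes (j ∈? toggle i S) (toggle-in i∉)) (cong suc (sym (𝟙-no (j ∈? S) i∉)))
    ... | no j≢i = 𝟙-⇔ (j ∈? toggle i S) (j ∈? S) (toggle-other⁻ j≢i) (toggle-other⁺ j≢i)

  ∣∣-sum : ∀ {n} (S : Subset n) → ∣ S ∣ ≡ ∑ (allFin n) (λ i → 𝟙 (i ∈? S))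
  ∣∣-sum [] = refl
  ∣∣-sum {suc n} (s ∷ S) = sym (trans (∑-allFin n (λ i → 𝟙 (i ∈? (s ∷ S)))) (step s))
    where
    shift : ∀ s i → 𝟙 (suc i ∈? (s ∷ S)) ≡ 𝟙 (i ∈? S)
    shift s i = 𝟙-⇔ (suc i ∈? (s ∷ S)) (i ∈? S) (λ { (Vec.there h) → h }) Vec.there
    step : ∀ s → 𝟙 (zero ∈? (s ∷ S)) + ∑ (allFin n) (λ i → 𝟙 (suc i ∈? (s ∷ S))) ≡ ∣ s ∷ S ∣
    step true = cong suc (trans (∑-cong (allFin n) (shift true)) (sym (∣∣-sum S)))
    step false = trans (∑-cong (allFin n) (shift false)) (sym (∣∣-sum S))

  ∣toggle∣ : ∀ {n} {i : Fin n} {S} → i ∉ S → ∣ toggle i S ∣ ≡ suc ∣ S ∣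
  ∣toggle∣ {n} {i} {S} i∉ = trans (∣∣-sum (toggle i S)) (trans (∑-cong (allFin n) (𝟙-toggle i∉))
    (trans (∑-+ (allFin n) _ _) (cong₂ _+_ (Finite.once (finFin n) i) (sym (∣∣-sum S)))))

  ∣∣≡0 : ∀ {n} (S : Subset n) → ∣ S ∣ ≡ 0 → S ≡ ⊥
  ∣∣≡0 [] _ = refl
  ∣∣≡0 (false ∷ S) eq = cong (false ∷_) (∣∣≡0 S eq)

  finSubset : ∀ n → Finite (Subset n)
  finSubset = finVec finBool

  ∑-allSubsets : ∀ n f → ∑ (allSubsets n) f ≡ sum (finSubset n) f
  ∑-allSubsets zero f = refl
  ∑-allSubsets (suc n) f = trans (∑-++ (List.map (outside ∷_) (allSubsets n)) _ f)
    (trans (cong₂ _+_ (trans (∑-map _ (allSubsets n) f) (∑-allSubsets n _))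
                      (trans (∑-map _ (allSubsets n) f) (trans (∑-allSubsets n _) (sym (+-identityʳ _)))))
           (sym (sum-vec finBool n f)))

  ∑-filter : ∀ {A : Set} {P : A → Set} (P? : Decidable P) xs f → ∑ (filter P? xs) f ≡ ∑ xs (λ x → 𝟙 (P? x) * f x)
  ∑-filter P? [] f = refl
  ∑-filter P? (x ∷ xs) f with P? x
  ... | yes _ = cong₂ _+_ (sym (+-identityʳ (f x))) (∑-filter P? xs f)
  ... | no _ = ∑-filter P? xs f

  length-filter : ∀ {A : Set} {P : A → Set} (P? : Decidable P) xs → length (filter P? xs) ≡ ∑ xs (λ x → 𝟙 (P? x))
  length-filter P? xs = trans (sym (∑-one (filter P? xs))) (trans (∑-filter P? xs _) (∑-cong xs (λ x → *-identityʳ _)))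

  module _ {n : ℕ} where
    sumOver : ℕ → (Subset n → ℕ) → ℕ
    sumOver k f = sum (finSubset n) (λ A → 𝟙 (∣ A ∣ ≟ k) * f A)

    -- Double counting of the pairs of a (k+1)-set and one of its elements; removing the element
    -- matches them with the pairs of a k-set and a new element.
    insertions : ∀ k f → ∑ (allFin n) (λ i → sumOver k (λ B → 𝟙 (¬? (i ∈? B)) * f (toggle i B))) ≡ suc k * sumOver (suc k) f
    insertions k f = begin
      ∑ is (λ i → sumOver k (λ B → 𝟙 (¬? (i ∈? B)) * f (toggle i B)))
        ≡⟨ ∑-cong is (λ i → trans (∑-cong As (move i))
             (reindex (finSubset n) (finSubset n) (toggle i) (toggle i) (toggle-involutive i) (toggle-involutive i)
               (λ A → 𝟙 (∣ A ∣ ≟ suc k) * (𝟙 (i ∈? A) * f A)))) ⟩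
      ∑ is (λ i → ∑ As (λ A → 𝟙 (∣ A ∣ ≟ suc k) * (𝟙 (i ∈? A) * f A)))
        ≡⟨ ∑-swap is As _ ⟩
      ∑ As (λ A → ∑ is (λ i → 𝟙 (∣ A ∣ ≟ suc k) * (𝟙 (i ∈? A) * f A)))
        ≡⟨ ∑-cong As (λ A → trans (∑-*ˡ is (𝟙 (∣ A ∣ ≟ suc k)) _) (trans
             (cong (𝟙 (∣ A ∣ ≟ suc k) *_) (trans (∑-*ʳ is _ (f A)) (cong (_* f A) (sym (∣∣-sum A))))) (size A))) ⟩
      ∑ As (λ A → suc k * (𝟙 (∣ A ∣ ≟ suc k) * f A))
        ≡⟨ ∑-*ˡ As (suc k) _ ⟩
      suc k * sumOver (suc k) f ∎
      where
      open ≡-Reasoning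
      is = allFin n
      As = Finite.elems (finSubset n)
      move : ∀ i B → 𝟙 (∣ B ∣ ≟ k) * (𝟙 (¬? (i ∈? B)) * f (toggle i B)) ≡
                     𝟙 (∣ toggle i B ∣ ≟ suc k) * (𝟙 (i ∈? toggle i B) * f (toggle i B))
      move i B with i ∈? B
      ... | yes i∈ = trans (*-zeroʳ (𝟙 (∣ B ∣ ≟ k))) (sym (trans
        (cong (λ t → 𝟙 (∣ toggle i B ∣ ≟ suc k) * (t * f (toggle i B))) (𝟙-no (i ∈? toggle i B) (toggle-out i∈)))
        (*-zeroʳ (𝟙 (∣ toggle i B ∣ ≟ suc k)))))
      ... | no i∉ = cong₂ (λ s t → s * (t * f (toggle i B)))
        (𝟙-⇔ (∣ B ∣ ≟ k) (∣ toggle i B ∣ ≟ suc k) (λ eq → trans (∣toggle∣ i∉) (cong suc eq))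
          (λ eq → suc-injective (trans (sym (∣toggle∣ i∉)) eq)))
        (sym (𝟙-yes (i ∈? toggle i B) (toggle-in i∉)))
      size : ∀ A → 𝟙 (∣ A ∣ ≟ suc k) * (∣ A ∣ * f A) ≡ suc k * (𝟙 (∣ A ∣ ≟ suc k) * f A)
      size A with ∣ A ∣ ≟ suc k
      ... | yes eq = trans (+-identityʳ _) (trans (cong (_* f A) eq) (cong (suc k *_) (sym (+-identityʳ (f A)))))
      ... | no _ = sym (*-zeroʳ (suc k))

    -- Repeated entries would cancel; under `Fresh` every toggle is an insertion, so the entries are
    -- distinct and the set has `k` elements.
    build : ∀ {k} → Vec (Fin n) k → Subset n
    build [] = ⊥
    build (i ∷ a) = toggle i (build a)

    Fresh : ∀ {k} → Vec (Fin n) k → Set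
    Fresh [] = ⊤
    Fresh (i ∷ a) = i ∉ build a × Fresh a

    fresh? : ∀ {k} (a : Vec (Fin n) k) → Dec (Fresh a)
    fresh? [] = yes tt
    fresh? (i ∷ a) = ¬? (i ∈? build a) ×-dec fresh? a

    finTuple : ∀ k → Finite (Vec (Fin n) k)
    finTuple = finVec (finFin n)

    freshSum : ℕ → (Subset n → ℕ) → ℕ
    freshSum k f = sum (finTuple k) (λ a → 𝟙 (fresh? a) * f (build a))

    freshSum≡ : ∀ k f → freshSum k f ≡ k ! * sumOver k f
    freshSum≡ zero f = cong (_+ 0) (trans (*-identityˡ (f ⊥)) (sym (trans
      (∑-cong (Finite.elems (finSubset n)) (λ A → cong (_* f A)
        (𝟙-⇔ (∣ A ∣ ≟ 0) (Finite._≟_ (finSubset n) A ⊥) (∣∣≡0 A) (λ { refl → ∣⊥∣≡0 n }))))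
      (Finite.sift (finSubset n) ⊥ f))))
    freshSum≡ (suc k) f = begin
      freshSum (suc k) f
        ≡⟨ sum-vec (finFin n) k _ ⟩
      ∑ is (λ i → ∑ as (λ a → 𝟙 (fresh? (i ∷ a)) * f (toggle i (build a))))
        ≡⟨ ∑-cong is (λ i → ∑-cong as (λ a → trans (cong (_* f (toggle i (build a))) (𝟙-× (¬? (i ∈? build a)) (fresh? a)))
             (e (𝟙 (¬? (i ∈? build a))) (𝟙 (fresh? a)) (f (toggle i (build a)))))) ⟩
      ∑ is (λ i → freshSum k (λ B → 𝟙 (¬? (i ∈? B)) * f (toggle i B)))
        ≡⟨ ∑-cong is (λ i → freshSum≡ k _) ⟩
      ∑ is (λ i → k ! * sumOver k (λ B → 𝟙 (¬? (i ∈? B)) * f (toggle i B)))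
        ≡⟨ trans (∑-*ˡ is (k !) _) (cong (k ! *_) (insertions k f)) ⟩
      k ! * (suc k * sumOver (suc k) f)
        ≡⟨ trans (sym (*-assoc (k !) (suc k) _)) (cong (_* sumOver (suc k) f) (*-comm (k !) (suc k))) ⟩
      suc k ! * sumOver (suc k) f ∎
      where
      open ≡-Reasoning
      is = allFin n
      as = Finite.elems (finTuple k)
      e : ∀ a b c → a * b * c ≡ b * (a * c)
      e = solve-∀

    ∣build∣ : ∀ {k} (a : Vec (Fin n) k) → Fresh a → ∣ build a ∣ ≡ k
    ∣build∣ [] _ = ∣⊥∣≡0 n
    ∣build∣ (i ∷ a) (i∉ , fr) = trans (∣toggle∣ i∉) (cong suc (∣build∣ a fr))

    freshCount : ℕ → ℕ
    freshCount k = sum (finTuple k) (λ a → 𝟙 (fresh? a))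

    -- A fresh tuple of length `k` has n - k fresh extensions; the subtraction is moved to the left
    -- side.
    freshCount-suc : ∀ k → freshCount (suc k) + k * freshCount k ≡ n * freshCount k
    freshCount-suc k = begin
      freshCount (suc k) + k * freshCount k
        ≡⟨ cong₂ _+_ (trans (sum-vec (finFin n) k _) (trans (∑-swap is as _) (∑-cong as (λ a →
             trans (∑-cong is (λ i → 𝟙-× (¬? (i ∈? build a)) (fresh? a))) (∑-*ʳ is _ _)))))
           (sym (∑-*ˡ as k _)) ⟩
      ∑ as (λ a → ∑ is (λ i → 𝟙 (¬? (i ∈? build a))) * 𝟙 (fresh? a)) + ∑ as (λ a → k * 𝟙 (fresh? a))
        ≡⟨ ∑-+ as _ _ ⟨
      ∑ as (λ a → ∑ is (λ i → 𝟙 (¬? (i ∈? build a))) * 𝟙 (fresh? a) + k * 𝟙 (fresh? a))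
        ≡⟨ ∑-cong as total ⟩
      ∑ as (λ a → n * 𝟙 (fresh? a))
        ≡⟨ ∑-*ˡ as n _ ⟩
      n * freshCount k ∎
      where
      open ≡-Reasoning
      is = allFin n
      as = Finite.elems (finTuple k)
      either : ∀ (B : Subset n) i → 𝟙 (¬? (i ∈? B)) + 𝟙 (i ∈? B) ≡ 1
      either B i with i ∈? B
      ... | yes _ = refl
      ... | no _ = refl
      total : ∀ a → ∑ is (λ i → 𝟙 (¬? (i ∈? build a))) * 𝟙 (fresh? a) + k * 𝟙 (fresh? a) ≡ n * 𝟙 (fresh? a)
      total a with fresh? a
      ... | no _ = trans (cong₂ _+_ (*-zeroʳ (∑ is (λ i → 𝟙 (¬? (i ∈? build a))))) (*-zeroʳ k)) (sym (*-zeroʳ n))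
      ... | yes fr = trans (sym (*-distribʳ-+ 1 (∑ is (λ i → 𝟙 (¬? (i ∈? build a)))) k)) (cong (_* 1) (trans
        (cong (∑ is (λ i → 𝟙 (¬? (i ∈? build a))) +_) (trans (sym (∣build∣ a fr)) (∣∣-sum (build a))))
        (trans (sym (∑-+ is _ _)) (trans (∑-cong is (either (build a))) (card-Fin n)))))

    freshCount≤ : ∀ k → freshCount k ≤ n ^ k
    freshCount≤ k = ≤-trans (∑-mono (Finite.elems (finTuple k)) (λ a → 𝟙≤1 (fresh? a)))
      (≤-reflexive (trans (card-Vec (finFin n) k) (cong (_^ k) (card-Fin n))))

    -- The birthday estimate, with k² in place of k(k-1)/2.
    freshCount≥ : ∀ k → n * n ^ k ≤ n * freshCount k + k * k * n ^ k
    freshCount≥ zero = ≤-reflexive (sym (+-identityʳ _))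
    freshCount≥ (suc k) = +-cancelʳ-≤ (n * (k * c)) _ _ (begin
      n * (n * n ^ k) + n * (k * c) ≤⟨ +-monoˡ-≤ (n * (k * c)) (*-monoʳ-≤ n (freshCount≥ k)) ⟩
      n * (n * c + k * k * n ^ k) + n * (k * c) ≡⟨ cong (λ t → n * (t + k * k * n ^ k) + n * (k * c)) (freshCount-suc k) ⟨
      n * ((c′ + k * c) + k * k * n ^ k) + n * (k * c) ≤⟨ +-monoˡ-≤ (n * (k * c)) (*-monoʳ-≤ n (+-monoˡ-≤ (k * k * n ^ k) (+-monoʳ-≤ c′ (*-monoʳ-≤ k (freshCount≤ k))))) ⟩
      n * ((c′ + k * n ^ k) + k * k * n ^ k) + n * (k * c) ≤⟨ +-monoˡ-≤ (n * (k * c)) (≤-trans (m≤m+n _ ((1 + k) * (n * n ^ k))) (≤-reflexive (e n c′ k (n ^ k)))) ⟩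
      n * c′ + suc k * suc k * (n * n ^ k) + n * (k * c) ∎)
      where
      open ≤-Reasoning
      c = freshCount k
      c′ = freshCount (suc k)
      e : ∀ n c′ k m → n * ((c′ + k * m) + k * k * m) + (1 + k) * (n * m) ≡ n * c′ + (1 + k) * (1 + k) * (n * m)
      e = solve-∀

    freshCount-half : .{{_ : NonZero n}} → ∀ k → 2 * (k * k) ≤ n → n ^ k ≤ 2 * freshCount k
    freshCount-half k 2k²≤n = *-cancelˡ-≤ n (+-cancelʳ-≤ (n * n ^ k) _ _ (begin
      n * n ^ k + n * n ^ k ≤⟨ +-mono-≤ (freshCount≥ k) (freshCount≥ k) ⟩
      (n * c + k * k * n ^ k) + (n * c + k * k * n ^ k) ≡⟨ e n c (k * k) (n ^ k) ⟩
      n * (2 * c) + 2 * (k * k) * n ^ k ≤⟨ +-monoʳ-≤ (n * (2 * c)) (*-monoˡ-≤ (n ^ k) 2k²≤n) ⟩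
      n * (2 * c) + n * n ^ k ∎))
      where
      open ≤-Reasoning
      c = freshCount k
      e : ∀ n c k m → (n * c + k * m) + (n * c + k * m) ≡ n * (2 * c) + 2 * k * m
      e = solve-∀

    length-kSubsets : ∀ k → length (kSubsets n k) ≡ sumOver k (λ _ → 1)
    length-kSubsets k = trans (length-filter (λ A → ∣ A ∣ ≟ k) (allSubsets n))
      (trans (∑-allSubsets n _) (∑-cong (Finite.elems (finSubset n)) (λ A → sym (*-identityʳ _))))

    length-filter-kSubsets : ∀ {P : Subset n → Set} (P? : Decidable P) k →
      length (filter P? (kSubsets n k)) ≡ sumOver k (λ A → 𝟙 (P? A))
    length-filter-kSubsets P? k = trans (length-filter P? (kSubsets n k))
      (trans (∑-filter (λ A → ∣ A ∣ ≟ k) (allSubsets n) _) (∑-allSubsets n _))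

  module CompleteSubsets (p : ℕ) (pr : Prime p) (3≤p : 3 ≤ p) (k : ℕ) where
    private
      instance
        p≢0 : NonZero p
        p≢0 = prime⇒nonZero pr

    field′ : FiniteField
    field′ = primeField p pr 3≤p

    open FiniteField field′ using (_⊕_; ⊖_; 0F)
    open LinearAlgebra field′ using (bdot; q; module R; cube; card-cube; finFⁿ)
    open Covering field′ k using (Covers; covers?; coverCount)

    private
      weight : Subset p → ℕ
      weight S = ∑ (allFin p) (λ j → 𝟙 (j ∈? S) * toℕ j)

      sum-map : ∀ {A : Set} (f : A → ℕ) xs → ListAction.sum (List.map f xs) ≡ ∑ xs f
      sum-map f [] = refl
      sum-map f (x ∷ xs) = cong (f x +_) (sum-map f xs)

      sumOf-weight : ∀ S → sumOf S ≡ weight S mod p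
      sumOf-weight S = cong (_mod p) (trans (sum-map toℕ (filter (_∈? S) (allFin p))) (∑-filter (_∈? S) (allFin p) toℕ))

      mod-+ : ∀ i m → (toℕ i + m) mod p ≡ i ⊕ (m mod p)
      mod-+ i m = Fin.toℕ-injective (trans (Fin.toℕ-fromℕ< (m%n<n (toℕ i + m) p)) (trans
        (trans (%-distribˡ-+ (toℕ i) m p) (trans (cong (λ t → (toℕ i % p + t) % p) (trans (sym (m%n%n≡m%n m p)) (cong (_% p) (sym (Fin.toℕ-fromℕ< (m%n<n m p))))))
          (sym (%-distribˡ-+ (toℕ i) (toℕ (m mod p)) p))))
        (sym (Fin.toℕ-fromℕ< (m%n<n (toℕ i + toℕ (m mod p)) p)))))

      weight-toggle : ∀ {i S} → i ∈ S → weight S ≡ toℕ i + weight (toggle i S)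
      weight-toggle {i} {S} i∈ = trans (∑-cong (allFin p) (λ j → trans (cong (_* toℕ j) (split j)) (*-distribʳ-+ (toℕ j) (𝟙 (j Fin.≟ i)) _)))
        (trans (∑-+ (allFin p) _ _) (cong (_+ weight (toggle i S)) (Finite.sift (finFin p) i toℕ)))
        where
        split : ∀ j → 𝟙 (j ∈? S) ≡ 𝟙 (j Fin.≟ i) + 𝟙 (j ∈? toggle i S)
        split j = trans (cong (λ A → 𝟙 (j ∈? A)) (sym (toggle-involutive i S))) (𝟙-toggle (toggle-out i∈) j)

      -- Walks along the tuple: an entry lying in `S` is selected and removed from `S`, so that the
      -- rest is a subset of the shorter `build`.
      subsetSum⇒bdot : ∀ {m} (a : Vec (Fin p) m) → Fresh a → ∀ {S} → S ⊆ build a → ∃ λ T → bdot T a ≡ weight S mod p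
      subsetSum⇒bdot [] _ {S} S⊆ = [] , cong (_mod p) (sym (trans (∑-cong (allFin p) (λ j →
        cong (_* toℕ j) (𝟙-no (j ∈? S) (λ j∈ → ∉⊥ (S⊆ j∈))))) (∑-zero (allFin p))))
      subsetSum⇒bdot (i ∷ a) (i∉ , fr) {S} S⊆ with i ∈? S
      ... | yes i∈ with subsetSum⇒bdot a fr {toggle i S} smaller
        where
        smaller : toggle i S ⊆ build a
        smaller {j} j∈ with j Fin.≟ i
        ... | yes refl = contradiction j∈ (toggle-out i∈)
        ... | no j≢i = toggle-other⁻ j≢i (S⊆ (toggle-other⁻ j≢i j∈))
      ... | T , eq = true ∷ T , trans (cong (i ⊕_) eq) (trans (sym (mod-+ i (weight (toggle i S)))) (cong (_mod p) (sym (weight-toggle i∈))))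
      subsetSum⇒bdot (i ∷ a) (i∉ , fr) {S} S⊆ | no i∉S with subsetSum⇒bdot a fr {S} smaller
        where
        smaller : S ⊆ build a
        smaller {j} j∈ with j Fin.≟ i
        ... | yes refl = contradiction j∈ i∉S
        ... | no j≢i = toggle-other⁻ j≢i (S⊆ j∈)
      ... | T , eq = false ∷ T , eq

      complete⇒covers : ∀ (a : Vec (Fin p) k) → Fresh a → Complete p (build a) → Covers a
      complete⇒covers a fr comp y with comp (⊖ y)
      ... | S , S⊆ , eq with subsetSum⇒bdot a fr S⊆
      ... | T , eq′ = T , trans (cong (y ⊕_) (trans eq′ (trans (sym (sumOf-weight S)) eq))) (R.-‿inverseʳ y)

    completeCount subsetCount : ℕ
    completeCount = length (filter (complete? p) (kSubsets p k))
    subsetCount = length (kSubsets p k)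

    -- Each complete set comes from `k !` fresh tuples, all of them covering; tuples with
    -- repetitions only enlarge the right side.
    completeCount≤ : k ! * completeCount ≤ coverCount
    completeCount≤ = ≤-trans (≤-reflexive (trans (cong (k ! *_) (length-filter-kSubsets (complete? p) k)) (sym (freshSum≡ k _))))
      (∑-mono (Finite.elems (finTuple k)) (λ a → ≤-trans (≤-reflexive (sym (𝟙-× (fresh? a) (complete? p (build a)))))
        (𝟙-mono (fresh? a ×-dec complete? p (build a)) (covers? a) (λ (fr , comp) → complete⇒covers a fr comp))))

    subsetCount≥ : 2 * (k * k) ≤ p → p ^ k ≤ 2 * (k ! * subsetCount)
    subsetCount≥ h = ≤-trans (freshCount-half k h) (≤-reflexive (cong (2 *_) (trans
      (∑-cong (Finite.elems (finTuple k)) (λ a → sym (*-identityʳ (𝟙 (fresh? a)))))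
      (trans (freshSum≡ k (λ _ → 1)) (cong (k ! *_) (sym (length-kSubsets {p} k)))))))

    -- One of the `suc ℓ` factors 2 is spent on passing from all tuples to the fresh ones, which are
    -- at least half of them.
    completeCount-rare : ∀ ℓ → 2 * (k * k) ≤ p → 2 ^ suc ℓ * coverCount ≤ p ^ k → 2 ^ ℓ * completeCount ≤ subsetCount
    completeCount-rare ℓ h₁ h₂ = *-cancelˡ-≤ (2 * k !) {{m*n≢0 2 (k !) {{_}} {{>-nonZero (n!>0 k)}}}} (begin
      2 * k ! * (2 ^ ℓ * completeCount) ≡⟨ e (k !) (2 ^ ℓ) completeCount ⟩
      2 ^ suc ℓ * (k ! * completeCount) ≤⟨ *-monoʳ-≤ (2 ^ suc ℓ) completeCount≤ ⟩
      2 ^ suc ℓ * coverCount ≤⟨ h₂ ⟩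
      p ^ k ≤⟨ subsetCount≥ h₁ ⟩
      2 * (k ! * subsetCount) ≡⟨ *-assoc 2 (k !) subsetCount ⟨
      2 * k ! * subsetCount ∎)
      where
      open ≤-Reasoning
      n!>0 : ∀ n → 1 ≤ n !
      n!>0 zero = ≤-refl
      n!>0 (suc n) = *-mono-≤ {1} {suc n} (s≤s z≤n) (n!>0 n)
      e : ∀ a b c → 2 * a * (b * c) ≡ 2 * b * (a * c)
      e = solve-∀

    -- Pigeonhole: each of the 2^k subsets of positions serves exactly one target.
    completeCount-zero : 2 ^ k < p → completeCount ≡ 0
    completeCount-zero 2^k<p = trans (length-filter-kSubsets (complete? p) k) (n≤0⇒n≡0 (≤-trans
      (m≤n*m _ (k !) {{k!≢0 k}})
      (≤-trans (≤-reflexive (cong (k ! *_) (sym (length-filter-kSubsets (complete? p) k)))) (≤-trans completeCount≤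
        (≤-reflexive (trans (∑-cong (Finite.elems (finFⁿ k)) (λ a → 𝟙-no (covers? a) (none a))) (∑-zero (Finite.elems (finFⁿ k)))))))))
      where
      k!≢0 : ∀ n → NonZero (n !)
      k!≢0 zero = _
      k!≢0 (suc n) = m*n≢0 (suc n) (n !) {{_}} {{k!≢0 n}}
      none : ∀ a → ¬ Covers a
      none a cov = <⇒≱ 2^k<p (begin
        p ≡⟨ card-Fin p ⟨
        ∑ ys (λ y → 1) ≤⟨ ∑-mono ys (λ y → ≤-trans (≤-reflexive (sym (𝟙-yes (y ⊕ bdot (proj₁ (cov y)) a Fin.≟ 0F) (proj₂ (cov y)))))
                                                                  (∑-term (λ S → 𝟙 (y ⊕ bdot S a Fin.≟ 0F)) (Finite.∈-elems (cube k) (proj₁ (cov y))))) ⟩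
        ∑ ys (λ y → ∑ Ss (λ S → 𝟙 (y ⊕ bdot S a Fin.≟ 0F))) ≡⟨ ∑-swap ys Ss _ ⟩
        ∑ Ss (λ S → ∑ ys (λ y → 𝟙 (y ⊕ bdot S a Fin.≟ 0F))) ≡⟨ ∑-cong Ss (λ S → trans (∑-cong ys (λ y → 𝟙-⇔ (y ⊕ bdot S a Fin.≟ 0F) (y Fin.≟ ⊖ bdot S a)
                                                                  (λ eq → LinearAlgebra.sum≡0⇒neg field′ eq)
                                                                  (λ { refl → R.-‿inverseˡ (bdot S a) })))
                                                                  (Finite.once (finFin p) (⊖ bdot S a))) ⟩
        ∑ Ss (λ S → 1) ≡⟨ card-cube k ⟩
        2 ^ k ∎)
        where
        open ≤-Reasoning
        ys = allFin p
        Ss = Finite.elems (cube k)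

-- Logarithms of natural numbers through their Riemann sums.

module Logs where

  open import Defs
  open import Data.Nat.Base as ℕ using (ℕ; zero; suc)
  import Data.Nat.Properties as ℕ
  open import Data.Nat.Tactic.RingSolver using (solve-∀)
  open import Data.Rational.Base using (ℚ; 0ℚ; 1ℚ; _+_; _*_; _-_; -_; _≤_; _<_) renaming (∣_∣ to abs)
  import Data.Rational.Properties as ℚ
  open import Data.Rational.Solver using (module +-*-Solver)
  open +-*-Solver using (solve; _:+_; _:*_; _:-_; :-_; con; _:=_)
  open RationalLemmas
  open EventuallyLemmas
  open LogLemmas

  sumTo-cong-< : ∀ n {f g} → (∀ i → i ℕ.< n → f i ≡ g i) → sumTo n f ≡ sumTo n g
  sumTo-cong-< zero h = refl
  sumTo-cong-< (suc n) h = cong₂ _+_ (sumTo-cong-< n (λ i i<n → h i (ℕ.m<n⇒m<1+n i<n))) (h n ℕ.≤-refl)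

  sumTo-mono : ∀ n {f g} → (∀ i → i ℕ.< n → f i ≤ g i) → sumTo n f ≤ sumTo n g
  sumTo-mono zero h = ℚ.≤-refl
  sumTo-mono (suc n) h = ℚ.+-mono-≤ (sumTo-mono n (λ i i<n → h i (ℕ.m<n⇒m<1+n i<n))) (h n ℕ.≤-refl)

  *-cancelˡ-≤-pos : ∀ {r p q} → 0ℚ < r → r * p ≤ r * q → p ≤ q
  *-cancelˡ-≤-pos {r} {p} {q} 0<r h = subst₂ _≤_ (undo p) (undo q) (*-monoʳ (ℚ.<⇒≤ (0<inv 0<r)) h)
    where
    undo : ∀ t → inv r * (r * t) ≡ t
    undo t = trans (sym (ℚ.*-assoc (inv r) r t))
      (trans (cong (_* t) (trans (ℚ.*-comm (inv r) r) (inv-right 0<r))) (ℚ.*-identityˡ t))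

  -- g/(1 + t g) increases with g: after multiplication by both denominators the terms t g h agree.
  cell-mono : ∀ {t g h} → 0ℚ < 1ℚ + t * g → 0ℚ < 1ℚ + t * h → g ≤ h → g * inv (1ℚ + t * g) ≤ h * inv (1ℚ + t * h)
  cell-mono {t} {g} {h} 0<a 0<b g≤h = *-cancelˡ-≤-pos 0<a (*-cancelˡ-≤-pos 0<b (subst₂ _≤_ (sym left) (sym right)
    (subst₂ _≤_ (solve 3 (λ g h t → g :+ t :* g :* h := (con 1ℚ :+ t :* h) :* g) refl g h t)
                (solve 3 (λ g h t → h :+ t :* g :* h := (con 1ℚ :+ t :* g) :* h) refl g h t)
      (ℚ.+-monoˡ-≤ (t * g * h) g≤h))))
    where
    a = 1ℚ + t * g
    b = 1ℚ + t * h
    left : b * (a * (g * inv a)) ≡ b * g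
    left = cong (b *_) (trans (solve 3 (λ a g i → a :* (g :* i) := (a :* i) :* g) refl a g (inv a))
      (trans (cong (_* g) (inv-right 0<a)) (ℚ.*-identityˡ g)))
    right : b * (a * (h * inv b)) ≡ a * h
    right = trans (solve 4 (λ a b h i → b :* (a :* (h :* i)) := (b :* i) :* (a :* h)) refl a b h (inv b))
      (trans (cong (_* (a * h)) (inv-right 0<b)) (ℚ.*-identityˡ (a * h)))

  riemann-mono : ∀ {δ x y n} → 0ℚ < δ → δ ≤ 1ℚ → δ ≤ x → x ≤ y → 1 ℕ.≤ n → riemann n x ≤ riemann n y
  riemann-mono {δ} {x} {y} {n} 0<δ δ≤1 δ≤x x≤y 1≤n = sumTo-mono n λ i i<n →
    let open Sample {n} {i} 1≤n (ℕ.<⇒≤ i<n) in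
    cell-mono {ι i} {step n x} {step n y} (ℚ.<-≤-trans 0<δ (lower x δ≤1 δ≤x)) (ℚ.<-≤-trans 0<δ (lower y δ≤1 (ℚ.≤-trans δ≤x x≤y)))
      (*-monoˡ {inv (ι n)} {x - 1ℚ} {y - 1ℚ} (ℚ.<⇒≤ (0<inv-ι {n} 1≤n)) (ℚ.+-monoˡ-≤ (- 1ℚ) x≤y))

  -- With m cells per unit of length the step is 1/m and the sample points are (m + i)/m.
  riemann-suc : ∀ {m} a → 1 ℕ.≤ m → 1 ℕ.≤ a → riemann (m ℕ.* a) (ι (suc a)) ≡ sumTo (m ℕ.* a) (λ i → inv (ι (m ℕ.+ i)))
  riemann-suc {m} a 1≤m 1≤a = sumTo-cong-< (m ℕ.* a) λ i _ → inv-unique (0<ι (ℕ.≤-trans 1≤m (ℕ.m≤m+n m i))) (begin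
    ι (m ℕ.+ i) * (s * inv (1ℚ + ι i * s)) ≡⟨ cong₂ (λ u v → u * (v * inv (1ℚ + ι i * v))) (ι-+ m i) s≡ ⟩
    (ι m + ι i) * (w * inv (1ℚ + ι i * w)) ≡⟨ solve 4 (λ m i w v → (m :+ i) :* (w :* v) := (m :* w :+ i :* w) :* v) refl (ι m) (ι i) w _ ⟩
    (ι m * w + ι i * w) * inv (1ℚ + ι i * w) ≡⟨ cong (λ u → (u + ι i * w) * inv (1ℚ + ι i * w)) (ι*inv {m} 1≤m) ⟩
    (1ℚ + ι i * w) * inv (1ℚ + ι i * w) ≡⟨ inv-right (ℚ.<-≤-trans 0<1 (ℚ.≤-trans (ℚ.≤-reflexive (sym (ℚ.+-identityʳ 1ℚ)))
                                                            (ℚ.+-monoʳ-≤ 1ℚ (*-nonneg (0≤ι i) (ℚ.<⇒≤ (0<inv-ι {m} 1≤m)))))) ⟩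
    1ℚ ∎)
    where
    open ≡-Reasoning
    s w : ℚ
    s = step (m ℕ.* a) (ι (suc a))
    w = inv (ι m)
    s≡ : s ≡ w
    s≡ = inv-unique (0<ι {m} 1≤m) (trans
      (trans (cong (λ u → ι m * ((u - 1ℚ) * inv (ι (m ℕ.* a)))) (ι-suc a))
        (trans (solve 3 (λ m a i → m :* (((con 1ℚ :+ a) :- con 1ℚ) :* i) := (m :* a) :* i) refl (ι m) (ι a) (inv (ι (m ℕ.* a))))
          (cong (_* inv (ι (m ℕ.* a))) (sym (ι-* m a)))))
      (ι*inv {m ℕ.* a} (ℕ.*-mono-≤ 1≤m 1≤a)))

  -- With m a cells the Riemann sum for log (suc a) is Σ_{m ≤ j < m (suc a)} 1/j, so the
  -- functional equation is exact: the sum for a product splits.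
  riemann-* : ∀ {m} a b → 1 ℕ.≤ m → 1 ℕ.≤ a → 1 ℕ.≤ b →
    riemann (m ℕ.* (b ℕ.+ a ℕ.* suc b)) (ι (suc a ℕ.* suc b)) ≡
    riemann (m ℕ.* a) (ι (suc a)) + riemann (m ℕ.* suc a ℕ.* b) (ι (suc b))
  riemann-* {m} a b 1≤m 1≤a 1≤b = begin
    riemann (m ℕ.* ab) (ι (suc ab)) ≡⟨ riemann-suc ab 1≤m (ℕ.≤-trans 1≤b (ℕ.m≤m+n b _)) ⟩
    sumTo (m ℕ.* ab) f ≡⟨ cong (λ n → sumTo n f) (split m a b) ⟩
    sumTo (m ℕ.* a ℕ.+ m ℕ.* suc a ℕ.* b) f ≡⟨ sumTo-++ (m ℕ.* a) (m ℕ.* suc a ℕ.* b) f ⟩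
    sumTo (m ℕ.* a) f + sumTo (m ℕ.* suc a ℕ.* b) (λ j → f (m ℕ.* a ℕ.+ j))
      ≡⟨ cong₂ _+_ (sym (riemann-suc a 1≤m 1≤a)) (trans (sumTo-cong (m ℕ.* suc a ℕ.* b) (λ j → cong (λ n → inv (ι n)) (shift m a j)))
           (sym (riemann-suc b (ℕ.*-mono-≤ {1} {m} {1} {suc a} 1≤m (ℕ.s≤s ℕ.z≤n)) 1≤b))) ⟩
    riemann (m ℕ.* a) (ι (suc a)) + riemann (m ℕ.* suc a ℕ.* b) (ι (suc b)) ∎
    where
    open ≡-Reasoning
    ab = b ℕ.+ a ℕ.* suc b
    f = λ i → inv (ι (m ℕ.+ i))
    split : ∀ m a b → m ℕ.* (b ℕ.+ a ℕ.* (1 ℕ.+ b)) ≡ m ℕ.* a ℕ.+ m ℕ.* (1 ℕ.+ a) ℕ.* b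
    split = solve-∀
    shift : ∀ m a j → m ℕ.+ (m ℕ.* a ℕ.+ j) ≡ m ℕ.* (1 ℕ.+ a) ℕ.+ j
    shift = solve-∀

  infix 4 _~_
  record _~_ (x y : ℕ → ℚ) : Set where
    constructor close
    field
      near : ∀ ε → 0ℚ < ε → Eventually (λ n → abs (x n - y n) ≤ ε)

  open _~_

  half : ∀ {ε} → 0ℚ < ε → ∃ λ η → 0ℚ < η × η + η ≡ ε
  half {ε} 0<ε = inv (ι 2) * ε , *-pos (0<inv 0<2) 0<ε ,
    trans (solve 2 (λ h e → h :* e :+ h :* e := (con (ι 2) :* h) :* e) refl (inv (ι 2)) ε)
      (trans (cong (_* ε) (inv-right 0<2)) (ℚ.*-identityˡ ε))
    where 0<2 = 0<ι {2} (ℕ.s≤s ℕ.z≤n)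

  ~-pointwise : ∀ {x y} → (∀ n → 1 ℕ.≤ n → x n ≡ y n) → x ~ y
  near (~-pointwise {x} {y} h) ε 0<ε = 1 , λ n 1≤n → ℚ.≤-trans
    (ℚ.≤-reflexive (cong abs (trans (cong (_- y n) (h n 1≤n)) (ℚ.+-inverseʳ (y n))))) (ℚ.<⇒≤ 0<ε)

  ~-sym : ∀ {x y} → x ~ y → y ~ x
  near (~-sym {x} {y} f) ε 0<ε = mapE (λ n h → ℚ.≤-trans (ℚ.≤-reflexive (abs-swap (y n) (x n))) h) (near f ε 0<ε)

  ~-trans : ∀ {x y z} → x ~ y → y ~ z → x ~ z
  near (~-trans {x} {y} {z} f g) ε 0<ε =
    let η , 0<η , ηη = half 0<ε in
    mapE (λ n (p , q) → ℚ.≤-trans (abs-tri (x n) (y n) (z n)) (ℚ.≤-trans (ℚ.+-mono-≤ p q) (ℚ.≤-reflexive ηη)))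
         (near f η 0<η ⊗ near g η 0<η)

  ~-+ : ∀ {x y z w} → x ~ y → z ~ w → (λ n → x n + z n) ~ (λ n → y n + w n)
  near (~-+ {x} {y} {z} {w} f g) ε 0<ε =
    let η , 0<η , ηη = half 0<ε in
    mapE (λ n (p , q) → ℚ.≤-trans (ℚ.≤-reflexive (cong abs (solve 4 (λ x y z w → (x :+ z) :- (y :+ w) := (x :- y) :+ (z :- w)) refl (x n) (y n) (z n) (w n))))
      (ℚ.≤-trans (ℚ.∣p+q∣≤∣p∣+∣q∣ (x n - y n) (z n - w n)) (ℚ.≤-trans (ℚ.+-mono-≤ p q) (ℚ.≤-reflexive ηη))))
      (near f η 0<η ⊗ near g η 0<η)

  ~-upper : ∀ {x y} → x ~ y → ∀ {ε} → 0ℚ < ε → Eventually (λ n → x n ≤ y n + ε)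
  ~-upper {x} {y} f {ε} 0<ε = mapE (λ n h → subst (_≤ y n + ε) (solve 2 (λ x y → y :+ (x :- y) := x) refl (x n) (y n))
    (ℚ.+-monoʳ-≤ (y n) (ℚ.≤-trans (p≤abs (x n - y n)) h))) (near f ε 0<ε)

  logSeq : ℕ → ℕ → ℚ
  logSeq a n = riemann n (ι a)

  logSeq-mono : ∀ {a b n} → 1 ℕ.≤ a → a ℕ.≤ b → 1 ℕ.≤ n → logSeq a n ≤ logSeq b n
  logSeq-mono {a} {b} {n} 1≤a a≤b = riemann-mono {1ℚ} {ι a} {ι b} {n} 0<1 ℚ.≤-refl (ι-mono {1} {a} 1≤a) (ι-mono {a} {b} a≤b)

  -- By the Cauchy property the limit does not change when index n is replaced by some r n ≥ n; this
  -- supplies the special numbers of cells that `riemann-*` needs.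
  logSeq-refined : ∀ a (r : ℕ → ℕ) → 1 ℕ.≤ a → (∀ n → n ℕ.≤ r n) → logSeq a ~ (λ n → logSeq a (r n))
  near (logSeq-refined a r 1≤a n≤r) ε 0<ε = let N , h = log-cauchy (fromℕ a) (fromℕ-pos a 1≤a) ε 0<ε in
    N , λ n N≤n → ℚ.<⇒≤ (h n (r n) N≤n (ℕ.≤-trans N≤n (n≤r n)))

  logSeq-* : ∀ a b → 2 ℕ.≤ a → 2 ℕ.≤ b → logSeq (a ℕ.* b) ~ (λ n → logSeq a n + logSeq b n)
  logSeq-* (suc a) (suc b) (ℕ.s≤s 1≤a) (ℕ.s≤s 1≤b) = ~-trans
    (logSeq-refined (suc a ℕ.* suc b) (λ n → n ℕ.* ab) (ℕ.s≤s ℕ.z≤n) (λ n → ℕ.m≤m*n n ab {{ℕ.>-nonZero (ℕ.≤-trans 1≤b (ℕ.m≤m+n b _))}}))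
    (~-trans (~-pointwise (λ n 1≤n → riemann-* {n} a b 1≤n 1≤a 1≤b))
      (~-+ (~-sym (logSeq-refined (suc a) (λ n → n ℕ.* a) (ℕ.s≤s ℕ.z≤n) (λ n → ℕ.m≤m*n n a {{ℕ.>-nonZero 1≤a}})))
      (~-sym (logSeq-refined (suc b) (λ n → n ℕ.* suc a ℕ.* b) (ℕ.s≤s ℕ.z≤n)
        (λ n → ℕ.≤-trans (ℕ.m≤m*n n (suc a)) (ℕ.m≤m*n (n ℕ.* suc a) b {{ℕ.>-nonZero 1≤b}}))))))
    where
    -- By computation `suc ab` is the product `suc a ℕ.* suc b`.
    ab = b ℕ.+ a ℕ.* suc b

  logSeq-2^ : ∀ j → logSeq (2 ℕ.^ suc j) ~ (λ n → ι (suc j) * logSeq 2 n)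
  logSeq-2^ zero = ~-pointwise (λ n _ → sym (ℚ.*-identityˡ (logSeq 2 n)))
  logSeq-2^ (suc j) = ~-trans (logSeq-* 2 (2 ℕ.^ suc j) ℕ.≤-refl (ℕ.m≤m*n 2 (2 ℕ.^ j) {{ℕ.m^n≢0 2 j}}))
    (~-trans (~-+ (~-pointwise {logSeq 2} (λ _ _ → refl)) (logSeq-2^ j)) (~-pointwise (λ n _ →
      trans (solve 2 (λ l j → l :+ j :* l := (con 1ℚ :+ j) :* l) refl (logSeq 2 n) (ι (suc j))) (cong (_* logSeq 2 n) (sym (ι-suc (suc j)))))))

  -- All sample points lie between 1 and 2, so the bounds 1/2 and 1 for log 2 hold for every Riemann
  -- sum and not only in the limit.
  logSeq-2-upper : ∀ {n} → 1 ℕ.≤ n → logSeq 2 n ≤ 1ℚ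
  logSeq-2-upper {n} 1≤n = ℚ.≤-trans (sumTo-mono n cell) (ℚ.≤-reflexive (trans (sumTo-const n s) whole))
    where
    s = step n (ι 2)
    0≤s : 0ℚ ≤ s
    0≤s = *-nonneg (ℚ.<⇒≤ 0<1) (ℚ.<⇒≤ (0<inv-ι {n} 1≤n))
    whole : ι n * s ≡ 1ℚ
    whole = trans (solve 2 (λ n w → n :* ((con (ι 2) :- con 1ℚ) :* w) := n :* w) refl (ι n) (inv (ι n))) (ι*inv {n} 1≤n)
    cell : ∀ i → i ℕ.< n → s * inv (1ℚ + ι i * s) ≤ s
    cell i i<n = ℚ.≤-trans (*-monoʳ 0≤s (inv-anti 0<1 (Sample.lower {n} {i} 1≤n (ℕ.<⇒≤ i<n) (ι 2) ℚ.≤-refl (ι-mono {1} {2} (ℕ.s≤s ℕ.z≤n)))))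
      (ℚ.≤-reflexive (ℚ.*-identityʳ s))

  logSeq-2-lower : ∀ {n} → 1 ℕ.≤ n → 1ℚ ≤ ι 2 * logSeq 2 n
  logSeq-2-lower {n} 1≤n = ℚ.≤-trans (ℚ.≤-reflexive (sym whole)) (*-monoʳ (0≤ι 2) (sumTo-lower n cell))
    where
    s = step n (ι 2)
    0≤s : 0ℚ ≤ s
    0≤s = *-nonneg (ℚ.<⇒≤ 0<1) (ℚ.<⇒≤ (0<inv-ι {n} 1≤n))
    whole : ι 2 * (ι n * (s * inv (ι 2))) ≡ 1ℚ
    whole = trans (solve 3 (λ n w h → con (ι 2) :* (n :* (((con (ι 2) :- con 1ℚ) :* w) :* h)) := (n :* w) :* (con (ι 2) :* h)) refl (ι n) (inv (ι n)) (inv (ι 2)))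
      (trans (cong₂ _*_ (ι*inv {n} 1≤n) (inv-right (0<ι {2} (ℕ.s≤s ℕ.z≤n)))) (ℚ.*-identityˡ 1ℚ))
    cell : ∀ i → i ℕ.< n → s * inv (ι 2) ≤ s * inv (1ℚ + ι i * s)
    cell i i<n = *-monoʳ 0≤s (inv-anti (ℚ.<-≤-trans 0<1 (lower (ι 2) ℚ.≤-refl 1≤2)) (upper (ι 2) 1≤2 ℚ.≤-refl))
      where
      open Sample {n} {i} 1≤n (ℕ.<⇒≤ i<n)
      1≤2 : 1ℚ ≤ ι 2
      1≤2 = ι-mono {1} {2} (ℕ.s≤s ℕ.z≤n)

  ℕ-above : ∀ {X} → 0ℚ < X → ∃ λ J → X ≤ ι J
  ℕ-above {X} 0<X = suc N , ℚ.≤-trans (ℚ.≤-reflexive (sym inv-X)) (ℚ.≤-trans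
      (inv-anti (0<inv 0<N) (proj₂ (proj₂ (archimedean (0<inv 0<X)) (suc N) (ℕ.n≤1+n N)))) (ℚ.≤-reflexive inv-N))
    where
    N = proj₁ (archimedean (0<inv 0<X))
    0<N = 0<ι {suc N} (ℕ.s≤s ℕ.z≤n)
    inv-X : inv (inv X) ≡ X
    inv-X = sym (inv-unique (0<inv 0<X) (trans (ℚ.*-comm (inv X) X) (inv-right 0<X)))
    inv-N : inv (inv (ι (suc N))) ≡ ι (suc N)
    inv-N = sym (inv-unique (0<inv 0<N) (trans (ℚ.*-comm (inv (ι (suc N))) (ι (suc N))) (inv-right 0<N)))

-- The floor condition as an inequality between natural numbers.

module Threshold where

  open import Defs
  open Logs
  open import Data.Integer.Base using (+_)
  open import Data.Nat.Base as ℕ using (ℕ; suc)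
  import Data.Nat.Properties as ℕ
  open import Data.Rational.Base using (ℚ; 0ℚ; 1ℚ; _+_; _*_; _-_; -_; _≤_; _<_)
  import Data.Rational.Properties as ℚ
  open import Data.Rational.Solver using (module +-*-Solver)
  open +-*-Solver using (solve; _:+_; _:*_; _:-_; :-_; con; _:=_)
  open RationalLemmas
  open EventuallyLemmas
  open ArithmeticLemmas
  open LogLemmas

  -- `γ` is a gap between c and 1/(2 log 2). `J` is chosen so that log(k+1) ≥ J - 1 gives γ log(k+1)
  -- ≥ d + 2, which outweighs all bounded losses.
  module FloorBound (c : ℝ) (0<c : 0ᴿ <ᴿ c) (d : ℕ)
    {γ : ℚ} (0<γ : 0ℚ < γ) (c-gap : Eventually (λ n → seq c n + γ ≤ ι 1 * inv (ι 2 * logSeq 2 n)))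
    {J : ℕ} (J-large : inv γ * ι (2 ℕ.+ d) + 1ℚ ≤ ι J) where

    module _ (p k : ℕ) (2≤p : 2 ℕ.≤ p) (large : 2 ℕ.^ suc (2 ℕ.* J) ℕ.≤ k) (p≤2^k : p ℕ.≤ 2 ℕ.^ k) where
      private
        P = fromℕ p
        1<P = 1<fromℕ p 2≤p
        0<P = 1<⇒0< P 1<P

        X : ℝ
        X = log₂ P 0<P +ᴿ c *ᴿ log (log P 0<P) (log-pos P 1<P)

        l a b h : ℕ → ℚ
        l n = logSeq 2 n
        a n = logSeq p n
        b n = logSeq (suc k) n
        h n = inv (ι 2 * l n)

        1≤k : 1 ℕ.≤ k
        1≤k = ℕ.≤-trans (ℕ.m^n>0 2 (suc (2 ℕ.* J))) large

        Bounds : ℕ → Set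
        Bounds n = 1 ℕ.≤ n × (∃ λ δ → 0ℚ < δ × δ ≤ 1ℚ × δ ≤ a n) × a n ≤ ι (suc k) × 0ℚ ≤ seq c n × seq c n + γ ≤ h n
                 × ι 2 * a n + b n ≤ ι (d ℕ.+ 2 ℕ.* k) * l n + 1ℚ × ι (suc (2 ℕ.* J)) * l n ≤ b n + 1ℚ

        -- Write H = 1/(2 log 2). As log p ≤ k + 1, the real number `X` is at most 2H log p + (H -
        -- γ) log(k+1). If p²(k+1) ≤ 2^(d+2k), the part with H is at most k + d + 1, and γ log(k+1)
        -- ≥ d + 2 brings the total down to k - 1.
        conclusion : ∀ n → Bounds n → seq X n + 1ℚ ≤ ι k
        conclusion n (1≤n , (δ , 0<δ , δ≤1 , δ≤a) , a≤ , 0≤c , c+γ≤h , 2a+b≤ , b≥) = ℚ.≤-trans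
          (ℚ.+-monoˡ-≤ 1ℚ (ℚ.≤-trans (ℚ.+-mono-≤ (ℚ.≤-reflexive (cong (A *_) u≡)) (ℚ.≤-trans (*-monoʳ 0≤c rr≤b) (*-monoˡ 0≤b c≤))) first))
          (ℚ.≤-trans (ℚ.+-monoˡ-≤ 1ℚ (ℚ.+-mono-≤ second (ℚ.neg-antimono-≤ γb≥)))
            (ℚ.≤-reflexive (trans (cong (λ t → ι k + ι d + 1ℚ - t + 1ℚ) (ι-+ 2 d))
              (solve 2 (λ k d → k :+ d :+ con 1ℚ :- (con (ι 2) :+ d) :+ con 1ℚ := k) refl (ι k) (ι d)))))
          where
          A B H l′ : ℚ
          A = a n
          B = b n
          H = h n
          l′ = l n
          1≤2l : 1ℚ ≤ ι 2 * l′
          1≤2l = logSeq-2-lower {n} 1≤n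
          0<2l : 0ℚ < ι 2 * l′
          0<2l = ℚ.<-≤-trans 0<1 1≤2l
          2lH≡1 : (ι 2 * l′) * H ≡ 1ℚ
          2lH≡1 = inv-right 0<2l
          0<l : 0ℚ < l′
          0<l = ℚ.≰⇒> (λ l≤0 → ℚ.<-irrefl refl (ℚ.<-≤-trans 0<2l
            (ℚ.≤-trans (*-monoʳ (0≤ι 2) l≤0) (ℚ.≤-reflexive (ℚ.*-zeroʳ (ι 2))))))
          0≤l : 0ℚ ≤ l′
          0≤l = ℚ.<⇒≤ 0<l
          0≤H : 0ℚ ≤ H
          0≤H = ℚ.<⇒≤ (0<inv 0<2l)
          H≤1 : H ≤ 1ℚ
          H≤1 = inv-anti 0<1 1≤2l
          u≡ : inv l′ ≡ ι 2 * H
          u≡ = sym (inv-unique 0<l (trans (solve 2 (λ l h → l :* (con (ι 2) :* h) := (con (ι 2) :* l) :* h) refl l′ H) 2lH≡1))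
          rr≤b : riemann n A ≤ B
          rr≤b = riemann-mono {δ} {A} {ι (suc k)} {n} 0<δ δ≤1 δ≤a a≤ 1≤n
          2≤k+1 : 2 ℕ.≤ suc k
          2≤k+1 = ℕ.s≤s 1≤k
          0≤b : 0ℚ ≤ B
          0≤b = ℚ.≤-trans 0≤l (logSeq-mono {2} {suc k} {n} (ℕ.s≤s ℕ.z≤n) 2≤k+1 1≤n)
          c≤ : seq c n ≤ H - γ
          c≤ = ℚ.≤-trans (ℚ.≤-reflexive (solve 2 (λ c g → c := c :+ g :- g) refl (seq c n) γ)) (ℚ.+-monoˡ-≤ (- γ) c+γ≤h)
          first : A * (ι 2 * H) + (H - γ) * B ≤ H * (ι (d ℕ.+ 2 ℕ.* k) * l′ + 1ℚ) - γ * B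
          first = ℚ.≤-trans (ℚ.≤-reflexive (solve 4 (λ a b h g → a :* (con (ι 2) :* h) :+ (h :- g) :* b := h :* (con (ι 2) :* a :+ b) :- g :* b) refl A B H γ))
            (ℚ.+-monoˡ-≤ (- (γ * B)) (*-monoʳ 0≤H 2a+b≤))
          Hl≤1 : H * l′ ≤ 1ℚ
          Hl≤1 = *-cancelˡ-≤-pos (0<ι {2} (ℕ.s≤s ℕ.z≤n)) (ℚ.≤-trans
            (ℚ.≤-reflexive (trans (solve 2 (λ l h → con (ι 2) :* (h :* l) := (con (ι 2) :* l) :* h) refl l′ H) 2lH≡1)) (ι-mono {1} {2} (ℕ.s≤s ℕ.z≤n)))
          second : H * (ι (d ℕ.+ 2 ℕ.* k) * l′ + 1ℚ) ≤ ι k + ι d + 1ℚ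
          second = ℚ.≤-trans (ℚ.≤-reflexive (trans (cong (λ t → H * (t * l′ + 1ℚ)) (trans (ι-+ d (2 ℕ.* k)) (cong (_+_ (ι d)) (ι-* 2 k))))
            (solve 4 (λ h l d k → h :* ((d :+ con (ι 2) :* k) :* l :+ con 1ℚ) := k :* ((con (ι 2) :* l) :* h) :+ d :* (h :* l) :+ h) refl H l′ (ι d) (ι k))))
            (ℚ.+-mono-≤ (ℚ.+-mono-≤ (ℚ.≤-reflexive (trans (cong (ι k *_) 2lH≡1) (ℚ.*-identityʳ (ι k))))
              (ℚ.≤-trans (*-monoʳ (0≤ι d) Hl≤1) (ℚ.≤-reflexive (ℚ.*-identityʳ (ι d))))) H≤1)
          J≤ : ι J ≤ B + 1ℚ
          J≤ = ℚ.≤-trans (ℚ.≤-trans (ℚ.≤-reflexive (sym (ℚ.*-identityʳ (ι J)))) (*-monoʳ (0≤ι J) 1≤2l))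
            (ℚ.≤-trans (ℚ.≤-reflexive (trans (solve 2 (λ j l → j :* (con (ι 2) :* l) := (con (ι 2) :* j) :* l) refl (ι J) l′) (cong (_* l′) (sym (ι-* 2 J)))))
            (ℚ.≤-trans (*-monoˡ 0≤l (ι-mono {2 ℕ.* J} {suc (2 ℕ.* J)} (ℕ.n≤1+n (2 ℕ.* J)))) b≥))
          γb≥ : ι (2 ℕ.+ d) ≤ γ * B
          γb≥ = ℚ.≤-trans (ℚ.≤-reflexive (sym (trans (sym (ℚ.*-assoc γ (inv γ) (ι (2 ℕ.+ d)))) (trans (cong (_* ι (2 ℕ.+ d)) (inv-right 0<γ)) (ℚ.*-identityˡ _)))))
            (*-monoʳ (ℚ.<⇒≤ 0<γ) (subst₂ _≤_ (solve 1 (λ z → z :+ con 1ℚ :- con 1ℚ := z) refl (inv γ * ι (2 ℕ.+ d)))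
              (solve 1 (λ z → z :+ con 1ℚ :- con 1ℚ := z) refl B) (ℚ.+-monoˡ-≤ (- 1ℚ) (ℚ.≤-trans J-large J≤))))

        bounds : ∀ {δ} → 0ℚ < δ → δ ≤ 1ℚ → Eventually (λ n → δ ≤ a n) → ∀ {κ} → 0ℚ < κ → Eventually (λ n → κ ≤ seq c n) →
                 p ℕ.* p ℕ.* suc k ℕ.≤ 2 ℕ.^ (d ℕ.+ 2 ℕ.* k) → Eventually Bounds
        bounds {δ} 0<δ δ≤1 log-lower {κ} 0<κ c-bound small = mapE collect (atLeast1 ⊗ log-lower ⊗ c-bound ⊗ c-gap ⊗ p-upper ⊗ product-lower ⊗ power-upper ⊗ kMin-lower)
          where
          atLeast1 : Eventually (1 ℕ.≤_)
          atLeast1 = 1 , λ n h → h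
          -- The two convergence errors of ½ add up to the 1 that `Bounds` allows.
          ½ = proj₁ (half 0<1)
          0<½ : 0ℚ < ½
          0<½ = proj₁ (proj₂ (half 0<1))
          logSeq-power : ∀ {j} → 1 ℕ.≤ j → logSeq (2 ℕ.^ j) ~ (λ n → ι j * l n)
          logSeq-power {suc j} _ = logSeq-2^ j
          p-upper : Eventually (λ n → logSeq (2 ℕ.^ k) n ≤ ι k * l n + 1ℚ)
          p-upper = ~-upper (logSeq-power 1≤k) 0<1
          product~ : logSeq (p ℕ.* p ℕ.* suc k) ~ (λ n → (a n + a n) + b n)
          product~ = ~-trans (logSeq-* (p ℕ.* p) (suc k) (ℕ.≤-trans 2≤p (ℕ.m≤m*n p p {{ℕ.>-nonZero (ℕ.<⇒≤ 2≤p)}})) (ℕ.s≤s 1≤k))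
            (~-+ (logSeq-* p p 2≤p 2≤p) (~-pointwise {b} (λ _ _ → refl)))
          product-lower : Eventually (λ n → (a n + a n) + b n ≤ logSeq (p ℕ.* p ℕ.* suc k) n + ½)
          product-lower = ~-upper (~-sym product~) 0<½
          power-upper : Eventually (λ n → logSeq (2 ℕ.^ (d ℕ.+ 2 ℕ.* k)) n ≤ ι (d ℕ.+ 2 ℕ.* k) * l n + ½)
          power-upper = ~-upper (logSeq-power (ℕ.≤-trans 1≤k (ℕ.≤-trans (ℕ.m≤m+n k (k ℕ.+ 0)) (ℕ.m≤n+m (2 ℕ.* k) d)))) 0<½
          kMin-lower : Eventually (λ n → ι (suc (2 ℕ.* J)) * l n ≤ logSeq (2 ℕ.^ suc (2 ℕ.* J)) n + 1ℚ)
          kMin-lower = ~-upper (~-sym (logSeq-2^ (2 ℕ.* J))) 0<1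
          collect : ∀ n → 1 ℕ.≤ n × δ ≤ a n × κ ≤ seq c n
            × seq c n + γ ≤ ι 1 * h n × logSeq (2 ℕ.^ k) n ≤ ι k * l n + 1ℚ
            × (a n + a n) + b n ≤ logSeq (p ℕ.* p ℕ.* suc k) n + ½
            × logSeq (2 ℕ.^ (d ℕ.+ 2 ℕ.* k)) n ≤ ι (d ℕ.+ 2 ℕ.* k) * l n + ½
            × ι (suc (2 ℕ.* J)) * l n ≤ logSeq (2 ℕ.^ suc (2 ℕ.* J)) n + 1ℚ → Bounds n
          collect n (1≤n , δ≤a , c≥ , gap , pu , prod≈ , pow≈ , kmin≈) =
              1≤n
            , (δ , 0<δ , δ≤1 , δ≤a)
            -- log p ≤ k log 2 + 1 ≤ k + 1, because log 2 ≤ 1.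
            , ℚ.≤-trans (logSeq-mono {p} {2 ℕ.^ k} {n} (ℕ.<⇒≤ 2≤p) p≤2^k 1≤n) (ℚ.≤-trans pu
                (ℚ.≤-trans (ℚ.+-monoˡ-≤ 1ℚ (ℚ.≤-trans (*-monoʳ (0≤ι k) (logSeq-2-upper {n} 1≤n)) (ℚ.≤-reflexive (ℚ.*-identityʳ (ι k)))))
                  (ℚ.≤-reflexive (trans (ℚ.+-comm (ι k) 1ℚ) (sym (ι-suc k))))))
            , ℚ.≤-trans (ℚ.<⇒≤ 0<κ) c≥
            , ℚ.≤-trans gap (ℚ.≤-reflexive (ℚ.*-identityˡ (h n)))
            , ℚ.≤-trans (ℚ.≤-reflexive (solve 2 (λ a b → con (ι 2) :* a :+ b := (a :+ a) :+ b) refl (a n) (b n)))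
                (ℚ.≤-trans prod≈ (ℚ.≤-trans (ℚ.+-monoˡ-≤ ½ (ℚ.≤-trans
                  (logSeq-mono {p ℕ.* p ℕ.* suc k} {2 ℕ.^ (d ℕ.+ 2 ℕ.* k)} {n} (ℕ.*-mono-≤ {1} {p ℕ.* p} {1} {suc k} (ℕ.*-mono-≤ (ℕ.<⇒≤ 2≤p) (ℕ.<⇒≤ 2≤p)) (ℕ.s≤s ℕ.z≤n)) small 1≤n) pow≈))
                  (ℚ.≤-reflexive (trans (ℚ.+-assoc (ι (d ℕ.+ 2 ℕ.* k) * l n) ½ ½) (cong (_+_ (ι (d ℕ.+ 2 ℕ.* k) * l n)) (proj₂ (proj₂ (half 0<1))))))))
            , ℚ.≤-trans kmin≈ (ℚ.+-monoˡ-≤ 1ℚ (logSeq-mono {2 ℕ.^ suc (2 ℕ.* J)} {suc k} {n} (ℕ.m^n>0 2 (suc (2 ℕ.* J))) (ℕ.m≤n⇒m≤1+n large) 1≤n))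

      -- `_≤ᴿ_` is a negated strict inequality, so the opposite bound on `p` and `k` only has to
      -- produce a gap, here 1.
      floor-bound′ : fromℤ (+ k) ≤ᴿ X → 2 ℕ.^ (d ℕ.+ 2 ℕ.* k) ℕ.< p ℕ.* p ℕ.* suc k
      floor-bound′ k≤X = ℕ.≰⇒> λ small →
        let δ , 0<δ , δ≤1 , log-lower = small-bound (log P 0<P) (log-pos P 1<P)
            κ , 0<κ , c-lower = positive-bound c 0<c
        in k≤X (1ℚ , 0<1 , mapE conclusion (bounds 0<δ δ≤1 log-lower 0<κ c-lower small))

  -- Assuming p ≤ 2^k costs nothing, since `completeCount-zero` settles the other case.
  FewSumsFrom : ℝ → ℕ → ℕ → Set
  FewSumsFrom c d kMin = ∀ p k (2≤p : 2 ℕ.≤ p) → kMin ℕ.≤ k → p ℕ.≤ 2 ℕ.^ k →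
    let P = fromℕ p
        1<P = 1<fromℕ p 2≤p
        0<P = 1<⇒0< P 1<P
    in fromℤ (+ k) ≤ᴿ log₂ P 0<P +ᴿ c *ᴿ log (log P 0<P) (log-pos P 1<P) →
       2 ℕ.^ (d ℕ.+ 2 ℕ.* k) ℕ.< p ℕ.* p ℕ.* suc k

  floor-bound : ∀ c → 0ᴿ <ᴿ c → c <ᴿ 1ᴿ /ᴿ (fromℕ 2 *ᴿ log2) ⟨ 2log2-pos ⟩ → ∀ d → ∃ (FewSumsFrom c d)
  floor-bound c 0<c (γ , 0<γ , gap) d = from (ℕ-above (ℚ.+-mono-≤-< (*-nonneg (ℚ.<⇒≤ (0<inv 0<γ)) (0≤ι (2 ℕ.+ d))) 0<1))
    where
    from : (∃ λ J → inv γ * ι (2 ℕ.+ d) + 1ℚ ≤ ι J) → ∃ (FewSumsFrom c d)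
    from (J , J-large) = 2 ℕ.^ suc (2 ℕ.* J) , FloorBound.floor-bound′ c 0<c d 0<γ gap {J} J-large

-- Choice of the parameters and the limit.

open import Defs
open Estimate using (suc≤2^; module MainTerm)
open FiniteSums using (card-Fin)
open Tuples
open SecondMoment using (module Covering)
open Logs using (*-cancelˡ-≤-pos)
open Threshold
open import Data.Integer.Base using (+_)
import Data.Integer.Base as ℤ
import Data.Integer.Properties as ℤ
open import Data.List.Base using ([]; _∷_; filter; length)
open import Data.Nat.Base as ℕ using (ℕ; zero; suc; _≤_; nonTrivial⇒n>1)
import Data.Nat.Properties as ℕ
open import Data.Nat.Primality using (Prime; prime⇒nonZero; prime⇒nonTrivial)
open import Data.Nat.Tactic.RingSolver using (solve-∀)
open import Data.Rational.Base using (ℚ; 0ℚ; 1ℚ; _<_; _/_) renaming (_≤_ to _≤ℚ_; _*_ to _*ℚ_; _+_ to _+ℚ_)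
import Data.Rational.Properties as ℚ
import Data.Rational.Unnormalised.Base as ℚᵘ
import Data.Rational.Unnormalised.Properties as ℚᵘ
open import Relation.Unary using (Decidable)
open RationalLemmas

/-* : ∀ a m → + a / suc m *ℚ ι (suc m) ≡ ι a
/-* a m = ℚ.toℚᵘ-injective (ℚᵘ.≃-trans (ℚ.toℚᵘ-homo-* (+ a / suc m) (ι (suc m)))
  (ℚᵘ.≃-trans (ℚᵘ.*-cong (ℚ.toℚᵘ-fromℚᵘ (ℚᵘ.mkℚᵘ (+ a) m)) (toℚᵘ-ι (suc m)))
  (ℚᵘ.≃-trans (ℚᵘ.*≡* cross) (ℚᵘ.≃-sym (toℚᵘ-ι a)))))
  where
  cross : (+ a ℤ.* + suc m) ℤ.* + 1 ≡ + a ℤ.* + (suc m ℕ.* 1)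
  cross = trans (ℤ.*-identityʳ _) (cong (λ t → + a ℤ.* + t) (sym (ℕ.*-identityʳ (suc m))))

uniformProb-< : ∀ {A : Set} {P : A → Set} (P? : Decidable P) xs {ε M} → 0ℚ < ε → 1ℚ < ι M *ℚ ε →
  M ℕ.* length (filter P? xs) ≤ length xs → uniformProb P? xs < ε
uniformProb-< P? [] 0<ε _ _ = 0<ε
uniformProb-< {A} P? (x ∷ xs′) {ε} {M} 0<ε 1<Mε h = ℚ.≰⇒> λ large →
  ℚ.<-irrefl refl (ℚ.<-≤-trans 1<Mε (*-cancelˡ-≤-pos {ι t} {ι M *ℚ ε} {1ℚ} (0<ι {t} (ℕ.s≤s ℕ.z≤n)) (begin
    ι t *ℚ (ι M *ℚ ε) ≤⟨ *-monoʳ {ι t} (0≤ι t) (*-monoʳ {ι M} (0≤ι M) large) ⟩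
    ι t *ℚ (ι M *ℚ (+ a / t)) ≡⟨ trans (ℚ.*-comm (ι t) (ι M *ℚ (+ a / t))) (ℚ.*-assoc (ι M) (+ a / t) (ι t)) ⟩
    ι M *ℚ ((+ a / t) *ℚ ι t) ≡⟨ trans (cong (ι M *ℚ_) (/-* a (length xs′))) (sym (ι-* M a)) ⟩
    ι (M ℕ.* a) ≤⟨ ι-mono {M ℕ.* a} {t} h ⟩
    ι t ≡⟨ ℚ.*-identityʳ (ι t) ⟨
    ι t *ℚ 1ℚ ∎)))
  where
  open ℚ.≤-Reasoning
  a t : ℕ
  a = length (filter P? (x ∷ xs′))
  t = suc (length xs′)

square-root : ∀ C → 1 ≤ C → ∀ k → ∃ λ ℓ → C ℕ.* (ℓ ℕ.* ℓ) ≤ k × k ℕ.< C ℕ.* (suc ℓ ℕ.* suc ℓ)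
square-root C 1≤C zero = 0 , ℕ.≤-reflexive (ℕ.*-zeroʳ C) , ℕ.≤-trans 1≤C (ℕ.≤-reflexive (sym (ℕ.*-identityʳ C)))
square-root C 1≤C (suc k) with square-root C 1≤C k
... | ℓ , lo , hi with suc k ℕ.<? C ℕ.* (suc ℓ ℕ.* suc ℓ)
... | yes below = ℓ , ℕ.m≤n⇒m≤1+n lo , below
... | no above = suc ℓ , ℕ.≮⇒≥ above , ℕ.≤-<-trans hi (ℕ.*-monoʳ-< C {{ℕ.>-nonZero 1≤C}} (ℕ.*-mono-< (ℕ.n<1+n (suc ℓ)) (ℕ.n<1+n (suc ℓ))))

square-cancel-≤ : ∀ {m n} → m ℕ.* m ≤ n ℕ.* n → m ≤ n
square-cancel-≤ {m} {n} h with m ℕ.≤? n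
... | yes m≤n = m≤n
... | no m≰n = contradiction h (ℕ.<⇒≱ (ℕ.*-mono-< (ℕ.≰⇒> m≰n) (ℕ.≰⇒> m≰n)))

-- The induction works because (k+1)³ ≤ 2k³ for k ≥ 4; it starts at 16, where 8192 ≤ 65536.
cube≤2^ : ∀ {k} → 16 ℕ.≤′ k → 2 ℕ.* (k ℕ.* (k ℕ.* k)) ≤ 2 ℕ.^ k
cube≤2^ (ℕ.≤′-reflexive refl) = ℕ.≤ᵇ⇒≤ 8192 65536 _
cube≤2^ {suc k} (ℕ.≤′-step 16≤′k) = ℕ.*-monoʳ-≤ 2 (begin
  suc k ℕ.* (suc k ℕ.* suc k) ≡⟨ expand k ⟩
  k ℕ.* (k ℕ.* k) ℕ.+ (3 ℕ.* (k ℕ.* k) ℕ.+ (3 ℕ.* k ℕ.+ 1)) ≤⟨ ℕ.+-monoʳ-≤ (k ℕ.* (k ℕ.* k)) (ℕ.+-monoʳ-≤ (3 ℕ.* (k ℕ.* k)) (ℕ.+-monoʳ-≤ (3 ℕ.* k) 1≤k)) ⟩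
  k ℕ.* (k ℕ.* k) ℕ.+ (3 ℕ.* (k ℕ.* k) ℕ.+ (3 ℕ.* k ℕ.+ k)) ≡⟨ cong (λ t → k ℕ.* (k ℕ.* k) ℕ.+ (3 ℕ.* (k ℕ.* k) ℕ.+ t)) (ℕ.+-comm (3 ℕ.* k) k) ⟩
  k ℕ.* (k ℕ.* k) ℕ.+ (3 ℕ.* (k ℕ.* k) ℕ.+ 4 ℕ.* k) ≤⟨ ℕ.+-monoʳ-≤ (k ℕ.* (k ℕ.* k)) (ℕ.+-monoʳ-≤ (3 ℕ.* (k ℕ.* k)) (ℕ.*-monoˡ-≤ k 4≤k)) ⟩
  k ℕ.* (k ℕ.* k) ℕ.+ (3 ℕ.* (k ℕ.* k) ℕ.+ k ℕ.* k) ≡⟨ cong (k ℕ.* (k ℕ.* k) ℕ.+_) (ℕ.+-comm (3 ℕ.* (k ℕ.* k)) (k ℕ.* k)) ⟩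
  k ℕ.* (k ℕ.* k) ℕ.+ 4 ℕ.* (k ℕ.* k) ≤⟨ ℕ.+-monoʳ-≤ (k ℕ.* (k ℕ.* k)) (ℕ.*-monoˡ-≤ (k ℕ.* k) 4≤k) ⟩
  k ℕ.* (k ℕ.* k) ℕ.+ k ℕ.* (k ℕ.* k) ≡⟨ cong (k ℕ.* (k ℕ.* k) ℕ.+_) (ℕ.+-identityʳ _) ⟨
  2 ℕ.* (k ℕ.* (k ℕ.* k)) ≤⟨ cube≤2^ 16≤′k ⟩
  2 ℕ.^ k ∎)
  where
  open ℕ.≤-Reasoning
  4≤k = ℕ.≤-trans (ℕ.m≤m+n 4 12) (ℕ.≤′⇒≤ 16≤′k)
  1≤k = ℕ.≤-trans (ℕ.m≤m+n 1 3) 4≤k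
  expand : ∀ k → (1 ℕ.+ k) ℕ.* ((1 ℕ.+ k) ℕ.* (1 ℕ.+ k)) ≡ k ℕ.* (k ℕ.* k) ℕ.+ (3 ℕ.* (k ℕ.* k) ℕ.+ (3 ℕ.* k ℕ.+ 1))
  expand = solve-∀

2^-cancel-≤ : ∀ {m n} → 2 ℕ.^ m ≤ 2 ℕ.^ n → m ≤ n
2^-cancel-≤ {m} {n} h with m ℕ.≤? n
... | yes m≤n = m≤n
... | no m≰n = contradiction h (ℕ.<⇒≱ (ℕ.^-monoʳ-< 2 (ℕ.s≤s (ℕ.s≤s ℕ.z≤n)) (ℕ.≰⇒> m≰n)))

-- With 4096 ℓ² ≤ k < 4096 (ℓ + 1)² the hypothesis few-sums gives 4^k ≤ (ℓ p)², because
-- k < 16384 ℓ².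
module _ (p k ℓ₀ d : ℕ) (2^d≡ : 2 ℕ.^ d ≡ 16384) (pr : Prime p) (3≤p : 3 ≤ p) (1≤ℓ₀ : 1 ≤ ℓ₀)
         (k-large : 4096 ℕ.* (ℓ₀ ℕ.* ℓ₀) ≤ k) (p≤2^k : p ≤ 2 ℕ.^ k)
         (few-sums : 2 ℕ.^ (d ℕ.+ 2 ℕ.* k) ℕ.< p ℕ.* p ℕ.* suc k) where
  open CompleteSubsets p pr 3≤p k
  private
    root = square-root 4096 (ℕ.s≤s ℕ.z≤n) k
    ℓ = proj₁ root
    ℓ-lower = proj₁ (proj₂ root)
    ℓ-upper = proj₂ (proj₂ root)

    ℓ₀≤ℓ : ℓ₀ ≤ ℓ
    ℓ₀≤ℓ = ℕ.s≤s⁻¹ (ℕ.≰⇒> λ sucℓ≤ℓ₀ → ℕ.<⇒≱ ℓ-upper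
      (ℕ.≤-trans (ℕ.*-monoʳ-≤ 4096 (ℕ.*-mono-≤ sucℓ≤ℓ₀ sucℓ≤ℓ₀)) k-large))

    1≤ℓ : 1 ≤ ℓ
    1≤ℓ = ℕ.≤-trans 1≤ℓ₀ ℓ₀≤ℓ

    2^k≤ : 2 ℕ.^ k ≤ ℓ ℕ.* p
    2^k≤ = square-cancel-≤ (ℕ.*-cancelˡ-≤ 16384 (begin
      16384 ℕ.* (2 ℕ.^ k ℕ.* 2 ℕ.^ k) ≡⟨ cong₂ ℕ._*_ (sym 2^d≡) (trans (sym (ℕ.^-distribˡ-+-* 2 k k)) (cong (λ t → 2 ℕ.^ (k ℕ.+ t)) (sym (ℕ.+-identityʳ k)))) ⟩
      2 ℕ.^ d ℕ.* 2 ℕ.^ (2 ℕ.* k) ≡⟨ ℕ.^-distribˡ-+-* 2 d (2 ℕ.* k) ⟨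
      2 ℕ.^ (d ℕ.+ 2 ℕ.* k) ≤⟨ ℕ.<⇒≤ few-sums ⟩
      p ℕ.* p ℕ.* suc k ≤⟨ ℕ.*-monoʳ-≤ (p ℕ.* p) (ℕ.≤-trans ℓ-upper (ℕ.*-monoʳ-≤ 4096 (ℕ.*-mono-≤ suc≤ suc≤))) ⟩
      p ℕ.* p ℕ.* (4096 ℕ.* ((ℓ ℕ.+ ℓ) ℕ.* (ℓ ℕ.+ ℓ))) ≡⟨ e p ℓ ⟩
      16384 ℕ.* (ℓ ℕ.* p ℕ.* (ℓ ℕ.* p)) ∎))
      where
      open ℕ.≤-Reasoning
      suc≤ : suc ℓ ≤ ℓ ℕ.+ ℓ
      suc≤ = ℕ.+-monoˡ-≤ ℓ 1≤ℓ
      e : ∀ p ℓ → p ℕ.* p ℕ.* (4096 ℕ.* ((ℓ ℕ.+ ℓ) ℕ.* (ℓ ℕ.+ ℓ))) ≡ 16384 ℕ.* (ℓ ℕ.* p ℕ.* (ℓ ℕ.* p))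
      e p ℓ = e′ p ℓ 4096
        where
        e′ : ∀ p ℓ c → p ℕ.* p ℕ.* (c ℕ.* ((ℓ ℕ.+ ℓ) ℕ.* (ℓ ℕ.+ ℓ))) ≡ c ℕ.* 4 ℕ.* (ℓ ℕ.* p ℕ.* (ℓ ℕ.* p))
        e′ = solve-∀

    4096≤k : 4096 ≤ k
    4096≤k = ℕ.≤-trans (ℕ.*-monoʳ-≤ 4096 (ℕ.*-mono-≤ 1≤ℓ₀ 1≤ℓ₀)) k-large

    ℓ≤k : ℓ ≤ k
    ℓ≤k = ℕ.≤-trans (ℕ.m≤m*n ℓ ℓ {{ℕ.>-nonZero 1≤ℓ}}) (ℕ.≤-trans (ℕ.m≤n*m (ℓ ℕ.* ℓ) 4096) ℓ-lower)

    -- This is the condition of `freshCount-half`; it follows from 2k³ ≤ 2^k ≤ ℓ p ≤ k p.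
    2k²≤p : 2 ℕ.* (k ℕ.* k) ≤ p
    2k²≤p = ℕ.*-cancelˡ-≤ k {{ℕ.>-nonZero (ℕ.≤-trans (ℕ.s≤s ℕ.z≤n) 4096≤k)}} (begin
      k ℕ.* (2 ℕ.* (k ℕ.* k)) ≡⟨ e k ⟩
      2 ℕ.* (k ℕ.* (k ℕ.* k)) ≤⟨ cube≤2^ (ℕ.≤⇒≤′ (ℕ.≤-trans (ℕ.≤ᵇ⇒≤ 16 4096 _) 4096≤k)) ⟩
      2 ℕ.^ k ≤⟨ 2^k≤ ⟩
      ℓ ℕ.* p ≤⟨ ℕ.*-monoˡ-≤ p ℓ≤k ⟩
      k ℕ.* p ∎)
      where
      open ℕ.≤-Reasoning
      e : ∀ k → k ℕ.* (2 ℕ.* (k ℕ.* k)) ≡ 2 ℕ.* (k ℕ.* (k ℕ.* k))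
      e = solve-∀

  complete-rare : 2 ℕ.^ ℓ₀ ℕ.* completeCount ≤ subsetCount
  complete-rare = ℕ.≤-trans (ℕ.*-monoˡ-≤ completeCount (ℕ.^-monoʳ-≤ 2 ℓ₀≤ℓ))
    (completeCount-rare ℓ 2k²≤p (subst (λ q → 2 ℕ.^ suc ℓ ℕ.* Covering.coverCount field′ k ≤ q ℕ.^ k) (card-Fin p)
      (MainTerm.cover-rare field′ k ℓ 1≤ℓ (ℕ.≤-trans 2^k≤ (ℕ.≤-reflexive (cong (ℓ ℕ.*_) (sym (card-Fin p))))) ℓ-lower (ℕ.<⇒≤ ℓ-upper))))

exponent-for : ∀ {ε} → 0ℚ < ε → ∃ λ ℓ → 1 ≤ ℓ × 1ℚ < ι (2 ℕ.^ ℓ) *ℚ ε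
exponent-for {ε} 0<ε = from (archimedean 0<ε)
  where
  from : (∃ λ N → ∀ n → N ≤ n → 1 ≤ n × inv (ι n) ≤ℚ ε) → ∃ λ ℓ → 1 ≤ ℓ × 1ℚ < ι (2 ℕ.^ ℓ) *ℚ ε
  from (N , small) = suc N , ℕ.s≤s ℕ.z≤n , ℚ.<-≤-trans strict (*-monoˡ (ℚ.<⇒≤ 0<ε) (ι-mono {suc (suc N)} {2 ℕ.^ suc N} (suc≤2^ {suc N} (ℕ.s≤s ℕ.z≤n))))
    where
    Nε : 1ℚ ≤ℚ ι (suc N) *ℚ ε
    Nε = ℚ.≤-trans (ℚ.≤-reflexive (sym (inv-right (0<ι {suc N} (ℕ.s≤s ℕ.z≤n)))))
      (*-monoʳ (0≤ι (suc N)) (proj₂ (small (suc N) (ℕ.n≤1+n N))))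
    strict : 1ℚ < ι (suc (suc N)) *ℚ ε
    strict = ℚ.≤-<-trans (ℚ.≤-trans Nε (ℚ.≤-reflexive (sym (ℚ.+-identityʳ (ι (suc N) *ℚ ε)))))
      (ℚ.<-≤-trans (ℚ.+-monoʳ-< (ι (suc N) *ℚ ε) 0<ε) (ℚ.≤-reflexive (sym (ι-suc-* (suc N) ε))))

-- If 2^k < p no set is complete. Otherwise 2^k₀ ≤ p ≤ 2^k forces k₀ ≤ k, and the estimates for
-- large `k` apply.
completeProb-< : ∀ {ε} → 0ℚ < ε → ∀ ℓ₀ → 1 ≤ ℓ₀ → 1ℚ < ι (2 ℕ.^ ℓ₀) *ℚ ε → ∀ d → 2 ℕ.^ d ≡ 16384 →
  ∀ kMin p k k₀ → kMin ≤ k₀ → 4096 ℕ.* (ℓ₀ ℕ.* ℓ₀) ≤ k₀ → (pr : Prime p) → 3 ≤ p → 2 ℕ.^ k₀ ≤ p →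
  (kMin ≤ k → p ≤ 2 ℕ.^ k → 2 ℕ.^ (d ℕ.+ 2 ℕ.* k) ℕ.< p ℕ.* p ℕ.* suc k) →
  uniformProb (complete? p {{prime⇒nonZero pr}}) (kSubsets p k) < ε
completeProb-< {ε} 0<ε ℓ₀ 1≤ℓ₀ 1<2^ℓ₀ε d 2^d≡ kMin p k k₀ kMin≤k₀ ℓ₀²≤k₀ pr 3≤p 2^k₀≤p few =
  uniformProb-< (complete? p {{prime⇒nonZero pr}}) (kSubsets p k) {ε} {2 ℕ.^ ℓ₀} 0<ε 1<2^ℓ₀ε (rare (p ℕ.≤? 2 ℕ.^ k))
  where
  open CompleteSubsets p pr 3≤p k
  rare : Dec (p ≤ 2 ℕ.^ k) → 2 ℕ.^ ℓ₀ ℕ.* completeCount ≤ subsetCount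
  rare (no 2^k<p) = ℕ.≤-trans (ℕ.≤-reflexive (trans (cong (2 ℕ.^ ℓ₀ ℕ.*_) (completeCount-zero (ℕ.≰⇒> 2^k<p))) (ℕ.*-zeroʳ (2 ℕ.^ ℓ₀)))) ℕ.z≤n
  rare (yes p≤2^k) = complete-rare p k ℓ₀ d 2^d≡ pr 3≤p 1≤ℓ₀ (ℕ.≤-trans ℓ₀²≤k₀ k₀≤k) p≤2^k (few (ℕ.≤-trans kMin≤k₀ k₀≤k) p≤2^k)
    where
    k₀≤k : k₀ ≤ k
    k₀≤k = 2^-cancel-≤ (ℕ.≤-trans 2^k₀≤p p≤2^k)

RareFor : ℝ → ℚ → Set
RareFor c ε = ∃ λ (N : ℕ) → (p : ℕ) → (pr : Prime p) → N ≤ p →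
  let P = fromℕ p
      1<P = 1<fromℕ p (nonTrivial⇒n>1 p {{prime⇒nonTrivial pr}})
      0<P = 1<⇒0< P 1<P
  in (k : ℕ) → IsFloor (+ k) (log₂ P 0<P +ᴿ c *ᴿ log (log P 0<P) (log-pos P 1<P)) →
     uniformProb (complete? p {{prime⇒nonZero pr}}) (kSubsets p k) < ε

theorem1p2 :
  (c : ℝ) → 0ᴿ <ᴿ c → c <ᴿ 1ᴿ /ᴿ (fromℕ 2 *ᴿ log2) ⟨ 2log2-pos ⟩ →
  (ε : ℚ) → 0ℚ < ε →
  ∃ λ (N : ℕ) → (p : ℕ) → (pr : Prime p) → N ≤ p →
    let P = fromℕ p
        1<P = 1<fromℕ p (nonTrivial⇒n>1 p {{prime⇒nonTrivial pr}})
        0<P = 1<⇒0< P 1<P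
    in (k : ℕ) → IsFloor (+ k) (log₂ P 0<P +ᴿ c *ᴿ log (log P 0<P) (log-pos P 1<P)) →
       uniformProb (complete? p {{prime⇒nonZero pr}}) (kSubsets p k) < ε
theorem1p2 c 0<c c< ε 0<ε = from 14 refl (exponent-for 0<ε) (floor-bound c 0<c c< 14)
  where
  -- The value is d = 14, from 16384 = 4 · 4096; it stays a variable so that `2 ℕ.^ (d ℕ.+ 2 ℕ.* k)`
  -- does not unfold into doublings.
  from : ∀ d → 2 ℕ.^ d ≡ 16384 → (∃ λ ℓ → 1 ≤ ℓ × 1ℚ < ι (2 ℕ.^ ℓ) *ℚ ε) → ∃ (FewSumsFrom c d) → RareFor c ε
  -- The 3 excludes the prime 2, and 2^k₀ ensures k₀ ≤ k whenever p ≤ 2^k.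
  from d 2^d≡ (ℓ₀ , 1≤ℓ₀ , 1<2^ℓ₀ε) (kMin , few) = 3 ℕ.+ 2 ℕ.^ k₀ , λ p pr N≤p k (k≤X , _) →
    completeProb-< 0<ε ℓ₀ 1≤ℓ₀ 1<2^ℓ₀ε d 2^d≡ kMin p k k₀ (ℕ.m≤m+n kMin _) (ℕ.m≤n+m _ kMin) pr
      (ℕ.m+n≤o⇒m≤o 3 N≤p) (ℕ.m+n≤o⇒n≤o 3 N≤p)
      (λ kMin≤k p≤2^k → few p k (nonTrivial⇒n>1 p {{prime⇒nonTrivial pr}}) kMin≤k p≤2^k k≤X)
    where
    k₀ : ℕ
    k₀ = kMin ℕ.+ 4096 ℕ.* (ℓ₀ ℕ.* ℓ₀)
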